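{- Let $G$ be a graph, let ${\cal H}(G)$ be its injective hull, and let $\delta \ge 0$ be an integer or a half-integer. Then $hb(G)\le \delta$ if and only if ${\cal H}(G)$ contains - no isometric subgraph isomorphic to $H_2^{\delta}$, when $\delta$ is an integer; - neither an isometric subgraph isomorphic to $H_1^{\delta+\frac12}$ nor one isomorphic to $H_3^{\delta-\frac12}$, when $\delta$ is a half-integer.
   Context: All graphs are finite, connected, unweighted, undirected, without loops or multiple edges; $d(u,v)$ is the shortest-path distance. A subgraph $H$ of $G$ is isometric if it is induced and $d_H(u,v)=d_G(u,v)$ for all its vertices $u,v$. For four vertices $u,v,w,x$, $hb(u,v,w,x)$ is one half of the difference between the two largest of the sums $d(u,v)+d(w,x)$, $d(u,w)+d(v,x)$, $d(u,x)+d(v,w)$; the hyperbolicity $hb(G)$ is the maximum of $hb(u,v,w,x)$ over all quadruples. A graph is Helly if every family of pairwise intersecting disks $D(v,r)=\{u: d(u,v)\le r\}$ has a common vertex. The injective hull ${\cal H}(G)$ of $G$ is the smallest Helly graph into which $G$ embeds isometrically (it exists and is unique up to isomorphism, by Isbell and Dress). King-grid: the graph on $\mathbb{Z}^2$ in which distinct $(x,y),(x',y')$ are adjacent iff $\max(|x-x'|,|y-y'|)=1$. For $u=(x,y)$ let $s(u)=x+y$, $t(u)=x-y$. For non-negative integers $k,l$ define induced subgraphs of the King-grid: - $H_1^{k,l}$ induced by $\{u: 0\le s(u)\le 2k,\ 0\le t(u)\le 2l\}$, with corner points $a=(0,0)$, $b=(l,-l)$, $c=(k+l,k-l)$, $d=(k,k)$;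 - $H_2^{k,l}$ induced by $\{u: 0\le s(u)\le 2k+1,\ -1\le t(u)\le 2l\}\cup\{(-1,0),(k+l+1,k-l+1)\}$, with corner points $a=(-1,0)$, $b=(l,-l)$, $c=(k+l+1,k-l+1)$, $d=(k,k+1)$; - $H_3^{k,l}$ induced by $\{u: 0\le s(u)\le 2k+2,\ -1\le t(u)\le 2l+1\}\cup\{(l,-l-1),(-1,1),(k+1,k+2),(k+l+2,k-l)\}$, with corner points $a=(l,-l-1)$, $b=(-1,1)$, $c=(k+1,k+2)$, $d=(k+l+2,k-l)$. Write $H_i^k=H_i^{k,k}$. -}

module Defs where

open import Level using (Level; suc; zero)
open import Data.Nat as ℕ using (ℕ; _≤_; _⊔_; _⊓_; _∸_)
open import Data.Nat.Properties using (⊔-comm)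
open import Data.Integer as ℤ using (ℤ; +_; -[1+_]; ∣_∣) renaming (_≤_ to _≤ℤ_; _+_ to _+ℤ_; _-_ to _-ℤ_)
open import Data.Integer.Properties using (∣i-j∣≡∣j-i∣; i≡j⇒i-j≡0)
open import Data.Product using (Σ; _×_; _,_; proj₁; proj₂; ∃; ∃-syntax)
open import Data.Sum using (_⊎_)
open import Data.Fin using (Fin)
open import Data.Empty using (⊥)
open import Relation.Nullary using (¬_)
open import Relation.Binary.PropositionalEquality using (_≡_; refl; cong₂; sym; trans; subst)
open import Function.Bundles using (_↔_)

record Graph : Set₁ where
  field
    V     : Set
    _~_   : V → V → Set
    ~-sym : ∀ {u v} → u ~ v → v ~ u
    ~-irr : ∀ {u} → ¬ (u ~ u)
open Graph public

data Walk (G : Graph) : V G → V G → ℕ → Set where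
  here : ∀ {u} → Walk G u u 0
  step : ∀ {u w v k} → _~_ G u w → Walk G w v k → Walk G u v (ℕ.suc k)

Dist : (G : Graph) → V G → V G → ℕ → Set
Dist G u v k = Walk G u v k × (∀ m → Walk G u v m → k ≤ m)

Connected : Graph → Set
Connected G = ∀ u v → ∃[ k ] Walk G u v k

Finite : Graph → Set
Finite G = ∃[ n ] (V G ↔ Fin n)

InDisk : (G : Graph) → V G → ℕ → V G → Set
InDisk G c r u = ∃[ k ] (k ≤ r × Dist G c u k)

Helly : Graph → Set₁
Helly G = (I : Set) (c : I → V G) (r : I → ℕ) →
          (∀ i j → ∃[ z ] (InDisk G (c i) (r i) z × InDisk G (c j) (r j) z)) →
          ∃[ z ] (∀ i → InDisk G (c i) (r i) z)

IsometricEmbedding : (G H : Graph) → (V G → V H) → Set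
IsometricEmbedding G H f =
  ∀ u v k → (Dist G u v k → Dist H (f u) (f v) k) × (Dist H (f u) (f v) k → Dist G u v k)

Induced : (H : Graph) → (V H → Set) → Graph
Induced H S = record
  { V = Σ (V H) S
  ; _~_ = λ a b → _~_ H (proj₁ a) (proj₁ b)
  ; ~-sym = ~-sym H
  ; ~-irr = ~-irr H
  }

IsometricSubgraph : (H : Graph) → (V H → Set) → Set
IsometricSubgraph H S = IsometricEmbedding (Induced H S) H proj₁

IsInjectiveHull : (G H : Graph) → (V G → V H) → Set₁
IsInjectiveHull G H f =
  Connected H × Helly H × IsometricEmbedding G H f ×
  ((S : V H → Set) → (∀ u → S (f u)) → IsometricSubgraph H S →
     Helly (Induced H S) → ∀ v → S v)

ContainsIsometric : (H K : Graph) → Set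
ContainsIsometric H K = ∃[ φ ] IsometricEmbedding K H φ

-- hyperbolicity.  hb(G) ≤ δ with δ = m/2 (m ∈ ℕ).

largest : ℕ → ℕ → ℕ → ℕ
largest a b c = a ⊔ b ⊔ c

secondLargest : ℕ → ℕ → ℕ → ℕ
secondLargest a b c = (a ⊓ b) ⊔ (b ⊓ c) ⊔ (a ⊓ c)

twiceHb : (uv wx uw vx ux vw : ℕ) → ℕ
twiceHb uv wx uw vx ux vw =
  largest (uv ℕ.+ wx) (uw ℕ.+ vx) (ux ℕ.+ vw) ∸ secondLargest (uv ℕ.+ wx) (uw ℕ.+ vx) (ux ℕ.+ vw)

HbLeHalf : Graph → ℕ → Set
HbLeHalf G m =
  ∀ u v w x (duv dwx duw dvx dux dvw : ℕ) →
  Dist G u v duv → Dist G w x dwx → Dist G u w duw →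
  Dist G v x dvx → Dist G u x dux → Dist G v w dvw →
  twiceHb duv dwx duw dvx dux dvw ≤ m

Point : Set
Point = ℤ × ℤ

KingAdj : Point → Point → Set
KingAdj (x , y) (x' , y') = ∣ x -ℤ x' ∣ ⊔ ∣ y -ℤ y' ∣ ≡ 1

private
  kingSym : ∀ {p q} → KingAdj p q → KingAdj q p
  kingSym {x , y} {x' , y'} e =
    trans (cong₂ _⊔_ (∣i-j∣≡∣j-i∣ x' x) (∣i-j∣≡∣j-i∣ y' y)) e

  kingIrr : ∀ {p} → ¬ KingAdj p p
  kingIrr {x , y} e with trans (sym (cong₂ _⊔_ (cong ∣_∣ (i≡j⇒i-j≡0 {x} refl)) (cong ∣_∣ (i≡j⇒i-j≡0 {y} refl)))) e
    where open import Relation.Binary.PropositionalEquality using (cong)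
  ... | ()

KingSub : (Point → Set) → Graph
KingSub P = record
  { V = Σ Point P
  ; _~_ = λ a b → KingAdj (proj₁ a) (proj₁ b)
  ; ~-sym = λ {a} {b} → kingSym {proj₁ a} {proj₁ b}
  ; ~-irr = λ {a} → kingIrr {proj₁ a}
  }

s t : Point → ℤ
s (x , y) = x +ℤ y
t (x , y) = x -ℤ y

Between : ℤ → ℤ → ℤ → Set
Between a z b = (a ≤ℤ z) × (z ≤ℤ b)

ℕ→ℤ : ℕ → ℤ
ℕ→ℤ n = + n

-1ℤ : ℤ
-1ℤ = -[1+ 0 ]

InH1 : ℕ → ℕ → Point → Set
InH1 k l p = (Between (+ 0) (s p) (+ (2 ℕ.* k))) × (Between (+ 0) (t p) (+ (2 ℕ.* l)))

InH2 : ℕ → ℕ → Point → Set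
InH2 k l p =
  ((Between (+ 0) (s p) (+ (2 ℕ.* k ℕ.+ 1))) × (Between (-1ℤ) (t p) (+ (2 ℕ.* l))))
  ⊎ (p ≡ (-1ℤ , + 0))
  ⊎ (p ≡ (+ (k ℕ.+ l ℕ.+ 1) , (+ k ℤ.- + l) +ℤ + 1))

InH3 : ℕ → ℕ → Point → Set
InH3 k l p =
  ((Between (+ 0) (s p) (+ (2 ℕ.* k ℕ.+ 2))) × (Between (-1ℤ) (t p) (+ (2 ℕ.* l ℕ.+ 1))))
  ⊎ (p ≡ (+ l , ℤ.- (+ l) -ℤ + 1))
  ⊎ (p ≡ (-1ℤ , + 1))
  ⊎ (p ≡ (+ (k ℕ.+ 1) , + (k ℕ.+ 2)))
  ⊎ (p ≡ (+ (k ℕ.+ l ℕ.+ 2) , + k ℤ.- + l))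

H₁ H₂ H₃ : ℕ → ℕ → Graph
H₁ k l = KingSub (InH1 k l)
H₂ k l = KingSub (InH2 k l)
H₃ k l = KingSub (InH3 k l)

module Submission where

-- Let m = 2δ.  If hb(G) > δ, then the hull has four points a, b, c, d such that ac + bd exceeds each of the
-- sums ab + cd and ad + bc by at least m + 1.  Unless all slack vanishes and the parities are wrong, the Helly
-- property, applied twice, shrinks them to a "diamond": points b′, d′ at distance m + 1 from each other,
-- both at distance X from a and Z from c, with X + Z = ac, or the same with the two pairs exchanged.
-- In the exceptional case m + 1 = 2k + 2 and the six distances are those of four points lying beyond the
-- corners of H₃ᵏ.  Either way the four points are isometric to four points of the king grid whose
-- pairwise geodesics sweep out H₁, H₂ or H₃.  A nonexpansive map into a Helly graph extends one point at a
-- time, so the region maps into the hull; the map is isometric because any two of its points lie on a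
-- common geodesic between two of the four given points.
--
-- Conversely, the hull is the tight span of G: extremal functions on the vertices of G with the sup metric.
-- A geodesic of the tight span extends at both ends to a geodesic between points of G.  Extending the two
-- diagonals of H₁, H₂ or H₃ in this way moves the corners into G without decreasing the gap between the
-- sums of opposite distances.
--
-- Constructively, distances in G exist only up to double negation, which suffices for the negative
-- conclusion; the infimum in the proof that the tight span is Helly uses weak excluded middle, which the
-- Helly property of a graph with an edge implies.

open import Defs
open import Data.Bool using (Bool; true; false; T; _∧_; _∨_; not; if_then_else_)
open import Data.Bool.Properties using (T-∧; T-irrelevant)
open import Data.Bool.ListAction using (any)
open import Data.Empty using (⊥; ⊥-elim)
open import Data.Fin as Fin using (Fin; zero; suc; #_)
import Data.Fin.Properties as Fin
import Data.Integer as ℤ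
import Data.Integer.Properties as ℤ
open import Data.Integer using (ℤ; +_; -[1+_]; ∣_∣)
import Data.Integer.DivMod as ℤ
open import Data.Integer.Tactic.RingSolver using (solve-∀)
open import Data.List as List using (List; []; _∷_; _++_)
open import Data.List.Relation.Unary.All as All using (All; []; _∷_)
import Data.List.Relation.Unary.All.Properties as All
open import Data.List.Relation.Unary.Any using (here; there)
open import Data.List.Membership.Propositional using (_∈_)
open import Data.List.Membership.Propositional.Properties using (∈-++⁺ˡ; ∈-++⁺ʳ; ∈-map⁺; ∈-map⁻; ∈-upTo⁺; ∈-cartesianProduct⁺; ∈-allFin)
open import Data.Maybe using (Maybe; just; nothing)
open import Data.Nat using (ℕ; zero; suc; _+_; _*_; _∸_; _≤_; _<_; _⊔_; _⊓_; z≤n; s≤s)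
import Data.Nat as ℕ
open import Data.Nat.Induction using (<-rec)
import Data.Nat.Properties as ℕ
open import Data.Product using (Σ; _×_; _,_; proj₁; proj₂; ∃-syntax)
open import Data.Sum using (_⊎_; inj₁; inj₂; [_,_]′)
open import Data.Unit using (⊤; tt)
open import Data.Vec as Vec using (Vec; []; _∷_; lookup; tabulate)
import Data.Vec.Properties as Vec
open import Function using (_∘_; id)
open import Function.Bundles using (_⇔_; mk⇔; Inverse; Equivalence)
open import Relation.Nullary using (¬_; Dec; yes; no; contradiction)
open import Relation.Nullary.Decidable using (⌊_⌋; decidable-stable; _×-dec_; _⊎-dec_; _→-dec_; toWitness; fromWitness)
open import Relation.Binary.Definitions using (tri<; tri≈; tri>)
open import Relation.Binary.PropositionalEquality

-- Linear arithmetic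

-- The constants come from the corners. In `H₁ (suc k) (suc k)` the sides are `k + 1` and both
-- diagonals `2 * k + 2`; in `H₂ k k` the sides are `k + 1` and the diagonals `2 * k + 2` and
-- `2 * k + 1`; in `H₃ k k` the sides are `k + 2` and both diagonals `2 * k + 3`. So the diagonals
-- exceed two opposite sides by exactly `D = m + 1`, where `m = 2 * k` for `H₂` and `m = 2 * k + 1`
-- for the other two. Parity is the obstacle. A diamond needs an integer X with 2X in an interval
-- whose length is the sum of the slacks of the two gap inequalities, so only a single odd number
-- can block it. If this happens for both diagonals, the equations force D to be even and bring the
-- six distances into the form of `pinwheel`: this is the origin of `H₃`, while `H₁` and `H₂` are
-- the diamonds with D even and odd. Nearly all numerical facts, with up to thirteen variables, are
-- linear over the integers. A verified elimination procedure settles them; rounding of constants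
-- makes it sensitive to parity.

Row : ℕ → Set
Row N = Vec ℤ N × ℤ

value : ∀ {N} → Row N → Vec ℤ N → ℤ
value ([]    , k) []      = k
value (c ∷ v , k) (x ∷ ρ) = c ℤ.* x ℤ.+ value (v , k) ρ

combine : ∀ {N} → ℤ → Row N → ℤ → Row N → Row N
combine a (u , k) b (v , l) = Vec.zipWith (λ x y → a ℤ.* x ℤ.+ b ℤ.* y) u v , a ℤ.* k ℤ.+ b ℤ.* l

value-combine : ∀ {N} a (r : Row N) b s ρ →
  value (combine a r b s) ρ ≡ a ℤ.* value r ρ ℤ.+ b ℤ.* value s ρ
value-combine a ([] , k) b ([] , l) [] = refl
value-combine a (c ∷ u , k) b (d ∷ v , l) (x ∷ ρ) = trans
  (cong (λ z → (a ℤ.* c ℤ.+ b ℤ.* d) ℤ.* x ℤ.+ z) (value-combine a (u , k) b (v , l) ρ))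
  (rearrange a b c d x (value (u , k) ρ) (value (v , l) ρ))
  where
  rearrange : ∀ a b c d x p q →
    (a ℤ.* c ℤ.+ b ℤ.* d) ℤ.* x ℤ.+ (a ℤ.* p ℤ.+ b ℤ.* q) ≡
    a ℤ.* (c ℤ.* x ℤ.+ p) ℤ.+ b ℤ.* (d ℤ.* x ℤ.+ q)
  rearrange = solve-∀

constant : ∀ {N} → ℤ → Row N
constant k = Vec.replicate _ (+ 0) , k

value-constant : ∀ {N} k (ρ : Vec ℤ N) → value (constant k) ρ ≡ k
value-constant k []      = refl
value-constant k (x ∷ ρ) = trans (cong₂ ℤ._+_ (ℤ.*-zeroˡ x) (value-constant k ρ)) (ℤ.+-identityˡ k)

variableRow : ∀ {N} → Fin N → Row N
variableRow zero    = + 1 ∷ Vec.replicate _ (+ 0) , + 0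
variableRow (suc i) = + 0 ∷ proj₁ (variableRow i) , proj₂ (variableRow i)

value-variable : ∀ {N} (i : Fin N) ρ → value (variableRow i) ρ ≡ lookup ρ i
value-variable zero (x ∷ ρ) = trans (cong₂ ℤ._+_ (ℤ.*-identityˡ x) (value-constant (+ 0) ρ)) (ℤ.+-identityʳ x)
value-variable (suc i) (x ∷ ρ) = trans (cong₂ ℤ._+_ (ℤ.*-zeroˡ x) (value-variable i ρ)) (ℤ.+-identityˡ _)

data Constraint (N : ℕ) : Set where
  nonneg vanish : Row N → Constraint N

Holds : ∀ {N} → Vec ℤ N → Constraint N → Set
Holds ρ (nonneg r) = + 0 ℤ.≤ value r ρ
Holds ρ (vanish r) = value r ρ ≡ + 0

floorDiv : ℤ → ℕ → ℤ
floorDiv k zero    = + 0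
floorDiv k (suc g) = k ℤ./ℕ suc g

-- Fuel makes the recursion structural. Exhausted fuel yields 1, which merely disables rounding: no
-- inference relies on the result being a greatest common divisor.
gcdFuel : ℕ → ℕ → ℕ → ℕ
gcdFuel zero    a b       = 1
gcdFuel (suc f) a zero    = a
gcdFuel (suc f) a (suc b) = gcdFuel f (suc b) (a ℕ.% suc b)

content : ∀ {N} → Vec ℤ N → ℕ
content []      = 0
content (c ∷ v) = gcdFuel 60 ∣ c ∣ (content v)

value-scale : ∀ {N} g (v : Vec ℤ N) k ρ →
  value (Vec.map (g ℤ.*_) v , k) ρ ≡ g ℤ.* value (v , + 0) ρ ℤ.+ k
value-scale g [] k [] = sym (trans (cong (ℤ._+ k) (ℤ.*-zeroʳ g)) (ℤ.+-identityˡ k))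
value-scale g (c ∷ v) k (x ∷ ρ) = trans (cong (λ z → g ℤ.* c ℤ.* x ℤ.+ z) (value-scale g v k ρ))
  (rearrange g c x (value (v , + 0) ρ) k)
  where
  rearrange : ∀ g c x p k → g ℤ.* c ℤ.* x ℤ.+ (g ℤ.* p ℤ.+ k) ≡ g ℤ.* (c ℤ.* x ℤ.+ p) ℤ.+ k
  rearrange = solve-∀

value-shift : ∀ {N} (v : Vec ℤ N) k ρ → value (v , k) ρ ≡ value (v , + 0) ρ ℤ.+ k
value-shift [] k [] = sym (ℤ.+-identityˡ k)
value-shift (c ∷ v) k (x ∷ ρ) = trans (cong (λ z →
    c ℤ.* x ℤ.+ z) (value-shift v k ρ)) (sym (ℤ.+-assoc (c ℤ.* x) _ k))

-- The quotients computed by the untrusted division are only used after checking them.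
tighten : ∀ {N} → Row N → List (Constraint N)
tighten (v , k) with content v
... | 0     = nonneg (v , k) ∷ []
... | 1     = nonneg (v , k) ∷ []
... | suc g with Vec.map (λ c → floorDiv c (suc g)) v | floorDiv k (suc g)
... | w | l with Vec.≡-dec ℤ._≟_ (Vec.map (+ suc g ℤ.*_) w) v | k ℤ.<? + suc g ℤ.* (l ℤ.+ + 1)
... | yes _ | yes _ = nonneg (w , l) ∷ []
... | _     | _     = nonneg (v , k) ∷ []

tighten-sound : ∀ {N} (r : Row N) ρ → + 0 ℤ.≤ value r ρ → All (Holds ρ) (tighten r)
tighten-sound (v , k) ρ h with content v
... | 0     = h ∷ []
... | 1     = h ∷ []
... | suc (suc g) with Vec.map (λ c → floorDiv c (suc (suc g))) v | floorDiv k (suc (suc g))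
... | w | l with Vec.≡-dec ℤ._≟_ (Vec.map (+ suc (suc g) ℤ.*_) w) v | k ℤ.<? + suc (suc g) ℤ.* (l ℤ.+ + 1)
... | no _     | _     = h ∷ []
... | yes refl | no _  = h ∷ []
-- From `0 ≤ d * e + k` and `k < d * (l + 1)` follows `0 < d * (e + l + 1)`. Cancelling `d` and
-- using integrality gives `0 ≤ e + l`, the rounded constraint.
... | yes refl | yes b = subst (+ 0 ℤ.≤_) (sym (value-shift w l ρ))
        (subst (+ 0 ℤ.≤_) (predOf e l) (ℤ.i<j⇒i≤pred[j] (ℤ.*-cancelˡ-<-nonNeg {+ 0} {e ℤ.+ (l ℤ.+ + 1)} (+ d)
          (subst (ℤ._< + d ℤ.* (e ℤ.+ (l ℤ.+ + 1))) (sym (ℤ.*-zeroʳ (+ d))) pos)))) ∷ []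
  where
  d = suc (suc g)
  e = value (w , + 0) ρ
  pos : + 0 ℤ.< + d ℤ.* (e ℤ.+ (l ℤ.+ + 1))
  pos = ℤ.≤-<-trans (subst (+ 0 ℤ.≤_) (value-scale (+ d) w k ρ) h)
          (subst (_ ℤ.<_) (sym (ℤ.*-distribˡ-+ (+ d) e (l ℤ.+ + 1))) (ℤ.+-monoʳ-< (+ d ℤ.* e) b))
  predOf : ∀ e l → ℤ.pred (e ℤ.+ (l ℤ.+ + 1)) ≡ e ℤ.+ l
  predOf e l = lemma e l
    where
    lemma : ∀ e l → ℤ.- + 1 ℤ.+ (e ℤ.+ (l ℤ.+ + 1)) ≡ e ℤ.+ l
    lemma = solve-∀

negateRow : ∀ {N} → Row N → Row N
negateRow r = combine (ℤ.- + 1) r (+ 0) r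

value-negate : ∀ {N} (r : Row N) ρ → value (negateRow r) ρ ≡ ℤ.- value r ρ
value-negate r ρ = trans (value-combine (ℤ.- + 1) r (+ 0) r ρ) (lemma (value r ρ))
  where
  lemma : ∀ x → ℤ.- + 1 ℤ.* x ℤ.+ + 0 ℤ.* x ≡ ℤ.- x
  lemma = solve-∀

divides? : ℕ → ℤ → Bool
divides? zero    k = true
divides? (suc g) k = (∣ k ∣ ℕ.% suc g) ℕ.≡ᵇ 0

isTrivial : ∀ {N} → Constraint N → Bool
isTrivial (nonneg (v , k)) = (content v ℕ.≡ᵇ 0) ∧ ⌊ + 0 ℤ.≤? k ⌋
isTrivial (vanish (v , k)) = (content v ℕ.≡ᵇ 0) ∧ ⌊ k ℤ.≟ + 0 ⌋

-- An equation whose constant is not a multiple of its content has no integer solution. Written as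
-- two inequalities, it becomes refutable after rounding, since the two rounded constants add up to
-- -1. All parity arguments pass through here.
normalise : ∀ {N} → Constraint N → List (Constraint N)
normalise (nonneg r) = tighten r
normalise (vanish r) = if divides? (content (proj₁ r)) (proj₂ r) then vanish r ∷ []
                       else tighten r ++ tighten (negateRow r)

normalise-sound : ∀ {N} (c : Constraint N) ρ → Holds ρ c → All (Holds ρ) (normalise c)
normalise-sound (nonneg r) ρ h = tighten-sound r ρ h
normalise-sound (vanish r) ρ h with divides? (content (proj₁ r)) (proj₂ r)
... | true  = h ∷ []
... | false = All.++⁺ (tighten-sound r ρ (ℤ.≤-reflexive (sym h)))
    (tighten-sound (negateRow r) ρ (ℤ.≤-reflexive (sym (trans (value-negate r ρ) (cong ℤ.-_ h)))))

dominates : ∀ {N} → Constraint N → Constraint N → Bool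
dominates (nonneg (u , k)) (nonneg (v , l)) = ⌊ Vec.≡-dec ℤ._≟_ u v ⌋ ∧ ⌊ k ℤ.≤? l ⌋
dominates (vanish (u , k)) (vanish (v , l)) = ⌊ Vec.≡-dec ℤ._≟_ u v ⌋ ∧ ⌊ k ℤ.≟ l ⌋
dominates _ _ = false

-- Pruning curbs the quadratic growth of the elimination. Dropping constraints only weakens a
-- system, so any choice of what to drop is sound.
insert : ∀ {N} → Constraint N → List (Constraint N) → List (Constraint N)
insert c cs = if isTrivial c ∨ any (λ d → dominates d c) cs then cs
              else c ∷ List.filterᵇ (λ d → not (dominates c d)) cs

filter-sound : ∀ {A : Set} {P : A → Set} (f : A → Bool) {xs} → All P xs → All P (List.filterᵇ f xs)
filter-sound f [] = []
filter-sound f {x ∷ xs} (p ∷ ps) with f x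
... | true  = p ∷ filter-sound f ps
... | false = filter-sound f ps

insert-sound : ∀ {N} ρ (c : Constraint N) {cs} → Holds ρ c → All (Holds ρ) cs → All (Holds ρ) (insert c cs)
insert-sound ρ c {cs} h hs with isTrivial c ∨ any (λ d → dominates d c) cs
... | true  = hs
... | false = h ∷ filter-sound _ hs

insertAll : ∀ {N} → List (Constraint N) → List (Constraint N) → List (Constraint N)
insertAll []       ds = ds
insertAll (c ∷ cs) ds = insertAll cs (insert c ds)

insertAll-sound : ∀ {N} ρ {cs ds : List (Constraint N)} → All (Holds ρ) cs → All (Holds ρ) ds →
    All (Holds ρ) (insertAll cs ds)
insertAll-sound ρ []       k = k
insertAll-sound ρ (h ∷ hs) k = insertAll-sound ρ hs (insert-sound ρ _ h k)

reduce : ∀ {N} → List (Constraint N) → List (Constraint N)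
reduce []       = []
reduce (c ∷ cs) = insertAll (normalise c) (reduce cs)

reduce-sound : ∀ {N} ρ {cs : List (Constraint N)} → All (Holds ρ) cs → All (Holds ρ) (reduce cs)
reduce-sound ρ []       = []
reduce-sound ρ {c ∷ _} (h ∷ hs) = insertAll-sound ρ (normalise-sound c ρ h) (reduce-sound ρ hs)

tailRow : ∀ {N} → Row (suc N) → Row N
tailRow (_ ∷ v , k) = v , k

head : ∀ {N} → Row (suc N) → ℤ
head (c ∷ _ , _) = c

value-tail : ∀ {N} (r : Row (suc N)) x ρ → head r ≡ + 0 → value r (x ∷ ρ) ≡ value (tailRow r) ρ
value-tail (_ ∷ v , k) x ρ refl = trans (cong (ℤ._+ value (v , k) ρ) (ℤ.*-zeroˡ x)) (ℤ.+-identityˡ _)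

-- A constraint that still contains the eliminated variable is discarded. Thus no proof that a
-- combination cancels this variable enters the soundness argument; a wrong multiplier could only
-- lose information.
dropHead : ∀ {N} → Constraint (suc N) → List (Constraint N)
dropHead (nonneg r) with head r ℤ.≟ + 0
... | yes _ = nonneg (tailRow r) ∷ []
... | no _  = []
dropHead (vanish r) with head r ℤ.≟ + 0
... | yes _ = vanish (tailRow r) ∷ []
... | no _  = []

dropHead-sound : ∀ {N} x ρ (c : Constraint (suc N)) → Holds (x ∷ ρ) c → All (Holds ρ) (dropHead c)
dropHead-sound x ρ (nonneg r) h with head r ℤ.≟ + 0
... | yes e = subst (+ 0 ℤ.≤_) (value-tail r x ρ e) h ∷ []
... | no _  = []
dropHead-sound x ρ (vanish r) h with head r ℤ.≟ + 0
... | yes e = trans (sym (value-tail r x ρ e)) h ∷ []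
... | no _  = []

-- The row `r` is scaled by the absolute value of the pivot, so inequalities survive; the sign of
-- the pivot goes into the multiplier of the equation `e`, where any sign is allowed.
substitute : ∀ {N} → Row (suc N) → Constraint (suc N) → List (Constraint N)
substitute e (nonneg r) =
    dropHead (nonneg (combine (+ ∣ head e ∣) r (ℤ.- (ℤ.sign (head e) ℤ.◃ 1) ℤ.* head r) e))
substitute e (vanish r) =
    dropHead (vanish (combine (+ ∣ head e ∣) r (ℤ.- (ℤ.sign (head e) ℤ.◃ 1) ℤ.* head r) e))

nonneg-scale : ∀ m {x} → + 0 ℤ.≤ x → + 0 ℤ.≤ + m ℤ.* x
nonneg-scale m {x} p = subst (ℤ._≤ + m ℤ.* x) (ℤ.*-zeroʳ (+ m)) (ℤ.*-monoˡ-≤-nonNeg (+ m) p)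

nonneg-combine : ∀ {N} (m n : ℕ) (r s : Row N) ρ → + 0 ℤ.≤ value r ρ → + 0 ℤ.≤ value s ρ →
  + 0 ℤ.≤ value (combine (+ m) r (+ n) s) ρ
nonneg-combine m n r s ρ p q = subst (+ 0 ℤ.≤_) (sym (value-combine (+ m) r (+ n) s ρ))
  (ℤ.+-mono-≤ (nonneg-scale m p) (nonneg-scale n q))

substitute-sound : ∀ {N} x ρ e (c : Constraint (suc N)) → value e (x ∷ ρ) ≡ + 0 → Holds (x ∷ ρ) c →
  All (Holds ρ) (substitute e c)
substitute-sound x ρ e (nonneg r) z h = dropHead-sound x ρ _
  (subst (+ 0 ℤ.≤_) (sym (value-combine (+ a) r b e (x ∷ ρ)))
    (ℤ.+-mono-≤ (nonneg-scale a h)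
      (ℤ.≤-reflexive (sym (trans (cong (b ℤ.*_) z) (ℤ.*-zeroʳ b))))))
  where
  a = ∣ head e ∣
  b = ℤ.- (ℤ.sign (head e) ℤ.◃ 1) ℤ.* head r
substitute-sound x ρ e (vanish r) z h = dropHead-sound x ρ _
  (trans (value-combine (+ a) r b e (x ∷ ρ))
    (cong₂ ℤ._+_ (trans (cong (+ a ℤ.*_) h) (ℤ.*-zeroʳ (+ a))) (trans (cong (b ℤ.*_) z) (ℤ.*-zeroʳ b))))
  where
  a = ∣ head e ∣
  b = ℤ.- (ℤ.sign (head e) ℤ.◃ 1) ℤ.* head r

findEquation : ∀ {N} → List (Constraint (suc N)) → Maybe (Row (suc N))
findEquation [] = nothing
findEquation (nonneg _ ∷ cs) = findEquation cs
findEquation (vanish r ∷ cs) = if ⌊ head r ℤ.≟ + 0 ⌋ then findEquation cs else just r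

findEquation-sound : ∀ {N} ρ {cs : List (Constraint (suc N))} {r} → All (Holds ρ) cs →
    findEquation cs ≡ just r → value r ρ ≡ + 0
findEquation-sound ρ {nonneg _ ∷ cs} (h ∷ hs) e = findEquation-sound ρ hs e
findEquation-sound ρ {vanish r ∷ cs} (h ∷ hs) e with ⌊ head r ℤ.≟ + 0 ⌋ | e
... | true  | e′   = findEquation-sound ρ hs e′
... | false | refl = h

crossWith : ∀ {N} → Row (suc N) → List (Constraint (suc N)) → List (Constraint N)
crossWith r [] = []
crossWith r (vanish _ ∷ cs) = crossWith r cs
crossWith r (nonneg s ∷ cs) with head s
... | -[1+ n ] = dropHead (nonneg (combine (+ suc n) r (+ ∣ head r ∣) s)) ++ crossWith r cs
... | + _      = crossWith r cs

crossWith-sound : ∀ {N} x ρ (r : Row (suc N)) {cs} → + 0 ℤ.≤ value r (x ∷ ρ) → All (Holds (x ∷ ρ)) cs →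
    All (Holds ρ) (crossWith r cs)
crossWith-sound x ρ r p [] = []
crossWith-sound x ρ r {vanish _ ∷ cs} p (h ∷ hs) = crossWith-sound x ρ r p hs
crossWith-sound x ρ r {nonneg s ∷ cs} p (h ∷ hs) with head s
... | -[1+ n ] = All.++⁺ (dropHead-sound x ρ _ (nonneg-combine (suc n) ∣ head r ∣ r s (x ∷ ρ) p h))
    (crossWith-sound x ρ r p hs)
... | + _      = crossWith-sound x ρ r p hs

crossAll : ∀ {N} → List (Constraint (suc N)) → List (Constraint (suc N)) → List (Constraint N)
crossAll [] ds = []
crossAll (vanish _ ∷ cs) ds = crossAll cs ds
crossAll (nonneg r ∷ cs) ds with head r
... | + suc _ = crossWith r ds ++ crossAll cs ds
... | _       = crossAll cs ds

crossAll-sound : ∀ {N} x ρ {cs ds : List (Constraint (suc N))} → All (Holds (x ∷ ρ)) cs →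
    All (Holds (x ∷ ρ)) ds →
  All (Holds ρ) (crossAll cs ds)
crossAll-sound x ρ [] k = []
crossAll-sound x ρ {vanish _ ∷ cs} (h ∷ hs) k = crossAll-sound x ρ hs k
crossAll-sound x ρ {nonneg r ∷ cs} (h ∷ hs) k with head r
... | + suc _  = All.++⁺ (crossWith-sound x ρ r h k) (crossAll-sound x ρ hs k)
... | + zero   = crossAll-sound x ρ hs k
... | -[1+ _ ] = crossAll-sound x ρ hs k

concatAll-sound : ∀ {A B : Set} {P : A → Set} {Q : B → Set} (g : A → List B) → (∀ a → P a → All Q (g a)) →
  ∀ {xs} → All P xs → All Q (List.concatMap g xs)
concatAll-sound g s []       = []
concatAll-sound g s (p ∷ ps) = All.++⁺ (s _ p) (concatAll-sound g s ps)

isAbsurd : ∀ {N} → Constraint N → Bool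
isAbsurd (nonneg (v , k)) = ⌊ Vec.≡-dec ℤ._≟_ v (Vec.replicate _ (+ 0)) ⌋ ∧ ⌊ k ℤ.<? + 0 ⌋
isAbsurd (vanish (v , k)) = ⌊ Vec.≡-dec ℤ._≟_ v (Vec.replicate _ (+ 0)) ⌋ ∧ not ⌊ k ℤ.≟ + 0 ⌋

isAbsurd-sound : ∀ {N} ρ (c : Constraint N) → Holds ρ c → T (isAbsurd c) → ⊥
isAbsurd-sound ρ (nonneg (v , k)) h t with Vec.≡-dec ℤ._≟_ v (Vec.replicate _ (+ 0)) | k ℤ.<? + 0
... | yes refl | yes k<0 = ℤ.<⇒≱ k<0 (subst (+ 0 ℤ.≤_) (value-constant k ρ) h)
isAbsurd-sound ρ (vanish (v , k)) h t with Vec.≡-dec ℤ._≟_ v (Vec.replicate _ (+ 0)) | k ℤ.≟ + 0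
... | yes refl | no k≢0 = k≢0 (trans (sym (value-constant k ρ)) h)

anyAbsurd-sound : ∀ {N} ρ {cs : List (Constraint N)} → All (Holds ρ) cs → T (any isAbsurd cs) → ⊥
anyAbsurd-sound ρ {c ∷ cs} (h ∷ hs) t with isAbsurd c in eq
... | true  = isAbsurd-sound ρ c h (subst T (sym eq) tt)
... | false = anyAbsurd-sound ρ hs t

-- A pivot equation is preferred because it avoids forming all pairs of inequalities. In the absence
-- of one, every equation has head 0, so `dropHead` keeps it and `crossAll` may skip it.
eliminate : ∀ {N} → List (Constraint (suc N)) → List (Constraint N)
eliminate cs with findEquation cs
... | just e  = List.concatMap (substitute e) cs
... | nothing = List.concatMap dropHead cs ++ crossAll cs cs

-- Fourier–Motzkin elimination, with rounding of constants after division by the content.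
refutes : ∀ N → List (Constraint N) → Bool
refutes zero    cs = any isAbsurd cs
refutes (suc N) cs = any isAbsurd cs ∨ refutes N (reduce (eliminate cs))

eliminate-sound : ∀ {N} x ρ {cs : List (Constraint (suc N))} → All (Holds (x ∷ ρ)) cs →
    All (Holds ρ) (eliminate cs)
eliminate-sound x ρ {cs} hs with findEquation cs in eq
... | just e  = concatAll-sound (substitute e) (λ c →
    substitute-sound x ρ e c (findEquation-sound (x ∷ ρ) hs eq)) hs
... | nothing = All.++⁺ (concatAll-sound dropHead (dropHead-sound x ρ) hs) (crossAll-sound x ρ hs hs)

refutes-sound : ∀ N ρ {cs : List (Constraint N)} → All (Holds ρ) cs → T (refutes N cs) → ⊥
refutes-sound zero    []      hs t = anyAbsurd-sound [] hs t
refutes-sound (suc N) (x ∷ ρ) {cs} hs t with any isAbsurd cs in eq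
... | true  = anyAbsurd-sound (x ∷ ρ) hs (subst T (sym eq) tt)
... | false = refutes-sound N ρ (reduce-sound ρ (eliminate-sound x ρ hs)) t

-- Reflection of linear formulas over naturals and integers

infixl 7 _:*_
infixl 6 _:+_ _:-_
infix  4 _:≤_ _:≡_ _:≤ᶻ_ _:≡ᶻ_
infixr 3 _:∧_
infixr 2 _:∨_
infixr 1 _⇒_
infix  1 ⊢_

data NatTerm (n : ℕ) : Set where
  var  : Fin n → NatTerm n
  con  : ℕ → NatTerm n
  _:+_ : NatTerm n → NatTerm n → NatTerm n
  _:*_ : ℕ → NatTerm n → NatTerm n

data IntTerm (n m : ℕ) : Set where
  var  : Fin m → IntTerm n m
  con  : ℤ → IntTerm n m
  nat  : NatTerm n → IntTerm n m
  _:+_ _:-_ : IntTerm n m → IntTerm n m → IntTerm n m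
  :-_  : IntTerm n m → IntTerm n m

data Formula (n m : ℕ) : Set where
  _:≤_ _:≡_   : NatTerm n → NatTerm n → Formula n m
  _:≤ᶻ_ _:≡ᶻ_ : IntTerm n m → IntTerm n m → Formula n m
  _:∧_ _:∨_   : Formula n m → Formula n m → Formula n m
  :⊥          : Formula n m

data Sequent (n m : ℕ) : Set where
  _⇒_ : Formula n m → Sequent n m → Sequent n m
  ⊢_  : Formula n m → Sequent n m

module _ {n} (ρ : Vec ℕ n) where
  ⟦_⟧ⁿ : NatTerm n → ℕ
  ⟦ var i ⟧ⁿ  = lookup ρ i
  ⟦ con k ⟧ⁿ  = k
  ⟦ e :+ f ⟧ⁿ = ⟦ e ⟧ⁿ + ⟦ f ⟧ⁿ
  ⟦ k :* e ⟧ⁿ = k * ⟦ e ⟧ⁿ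

  module _ {m} (σ : Vec ℤ m) where
    ⟦_⟧ᶻ : IntTerm n m → ℤ
    ⟦ var i ⟧ᶻ  = lookup σ i
    ⟦ con k ⟧ᶻ  = k
    ⟦ nat e ⟧ᶻ  = + ⟦ e ⟧ⁿ
    ⟦ e :+ f ⟧ᶻ = ⟦ e ⟧ᶻ ℤ.+ ⟦ f ⟧ᶻ
    ⟦ e :- f ⟧ᶻ = ⟦ e ⟧ᶻ ℤ.- ⟦ f ⟧ᶻ
    ⟦ :- e ⟧ᶻ   = ℤ.- ⟦ e ⟧ᶻ

    ⟦_⟧ : Formula n m → Set
    ⟦ e :≤ f ⟧  = ⟦ e ⟧ⁿ ≤ ⟦ f ⟧ⁿ
    ⟦ e :≡ f ⟧  = ⟦ e ⟧ⁿ ≡ ⟦ f ⟧ⁿ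
    ⟦ e :≤ᶻ f ⟧ = ⟦ e ⟧ᶻ ℤ.≤ ⟦ f ⟧ᶻ
    ⟦ e :≡ᶻ f ⟧ = ⟦ e ⟧ᶻ ≡ ⟦ f ⟧ᶻ
    ⟦ A :∧ B ⟧  = ⟦ A ⟧ × ⟦ B ⟧
    ⟦ A :∨ B ⟧  = ⟦ A ⟧ ⊎ ⟦ B ⟧
    ⟦ :⊥ ⟧      = ⊥

    ⟦_⟧ˢ : Sequent n m → Set
    ⟦ A ⇒ S ⟧ˢ = ⟦ A ⟧ → ⟦ S ⟧ˢ
    ⟦ ⊢ A ⟧ˢ   = ⟦ A ⟧

    decide : ∀ A → Dec ⟦ A ⟧
    decide (e :≤ f)  = ⟦ e ⟧ⁿ ℕ.≤? ⟦ f ⟧ⁿ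
    decide (e :≡ f)  = ⟦ e ⟧ⁿ ℕ.≟ ⟦ f ⟧ⁿ
    decide (e :≤ᶻ f) = ⟦ e ⟧ᶻ ℤ.≤? ⟦ f ⟧ᶻ
    decide (e :≡ᶻ f) = ⟦ e ⟧ᶻ ℤ.≟ ⟦ f ⟧ᶻ
    decide (A :∧ B)  = decide A ×-dec decide B
    decide (A :∨ B)  = decide A ⊎-dec decide B
    decide :⊥        = no id

natRow : ∀ {n} m → NatTerm n → Row (n + m)
natRow m (var i)  = variableRow (i Fin.↑ˡ m)
natRow m (con k)  = constant (+ k)
natRow m (e :+ f) = combine (+ 1) (natRow m e) (+ 1) (natRow m f)
natRow m (k :* e) = combine (+ k) (natRow m e) (+ 0) (natRow m e)

intRow : ∀ {n m} → IntTerm n m → Row (n + m)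
intRow {n} (var i)      = variableRow (n Fin.↑ʳ i)
intRow (con k)          = constant k
intRow {m = m} (nat e)  = natRow m e
intRow (e :+ f)         = combine (+ 1) (intRow e) (+ 1) (intRow f)
intRow (e :- f)         = combine (+ 1) (intRow e) (ℤ.- + 1) (intRow f)
intRow (:- e)           = combine (ℤ.- + 1) (intRow e) (+ 0) (intRow e)

difference : ∀ {N} → Row N → Row N → Row N
difference r s = combine (+ 1) r (ℤ.- + 1) s

negation : ∀ {n m} → Formula n m → Formula n m
negation (e :≤ f)  = con 1 :+ f :≤ e
negation (e :≡ f)  = con 1 :+ f :≤ e :∨ con 1 :+ e :≤ f
negation (e :≤ᶻ f) = con (+ 1) :+ f :≤ᶻ e
negation (e :≡ᶻ f) = con (+ 1) :+ f :≤ᶻ e :∨ con (+ 1) :+ e :≤ᶻ f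
negation (A :∧ B)  = negation A :∨ negation B
negation (A :∨ B)  = negation A :∧ negation B
negation :⊥        = con 0 :≤ con 0

-- Enumerates the disjunctive normal form, in continuation-passing style.
branches : ∀ {n m} → Formula n m → (List (Constraint (n + m)) → Bool) → List (Constraint (n + m)) → Bool
branches {m = m} (e :≤ f) k cs = k (nonneg (difference (natRow m f) (natRow m e)) ∷ cs)
branches {m = m} (e :≡ f) k cs = k (vanish (difference (natRow m f) (natRow m e)) ∷ cs)
branches (e :≤ᶻ f) k cs = k (nonneg (difference (intRow f) (intRow e)) ∷ cs)
branches (e :≡ᶻ f) k cs = k (vanish (difference (intRow f) (intRow e)) ∷ cs)
branches (A :∧ B) k cs = branches A (branches B k) cs
branches (A :∨ B) k cs = branches A k cs ∧ branches B k cs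
branches :⊥ k cs = true

provable : ∀ {n m} → Sequent n m → List (Constraint (n + m)) → Bool
provable {n} {m} (⊢ A) cs = branches (negation A) (λ ds → refutes (n + m) (reduce ds)) cs
provable (A ⇒ S) cs       = branches A (provable S) cs

natsNonneg : ∀ n m → List (Constraint (n + m))
natsNonneg n m = List.map (λ i → nonneg (variableRow (i Fin.↑ˡ m))) (List.allFin n)

module _ {n m} (ρ : Vec ℕ n) (σ : Vec ℤ m) where
  private
    env : Vec ℤ (n + m)
    env = Vec.map +_ ρ Vec.++ σ

    one : ∀ x y → + 1 ℤ.* x ℤ.+ + 1 ℤ.* y ≡ x ℤ.+ y
    one = solve-∀
    minus : ∀ x y → + 1 ℤ.* x ℤ.+ ℤ.- + 1 ℤ.* y ≡ x ℤ.- y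
    minus = solve-∀
    neg : ∀ x → ℤ.- + 1 ℤ.* x ℤ.+ + 0 ℤ.* x ≡ ℤ.- x
    neg = solve-∀
    scale : ∀ k x → k ℤ.* x ℤ.+ + 0 ℤ.* x ≡ k ℤ.* x
    scale = solve-∀

  natRow-value : ∀ e → value (natRow m e) env ≡ + ⟦_⟧ⁿ ρ e
  natRow-value (var i)  = trans (value-variable (i Fin.↑ˡ m) env)
    (trans (Vec.lookup-++ˡ (Vec.map +_ ρ) σ i) (Vec.lookup-map i +_ ρ))
  natRow-value (con k)  = value-constant (+ k) env
  natRow-value (e :+ f) = trans (value-combine (+ 1) (natRow m e) (+ 1) (natRow m f) env)
    (trans (one (value (natRow m e) env) (value (natRow m f) env)) (cong₂ ℤ._+_ (natRow-value e)
        (natRow-value f)))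
  natRow-value (k :* e) = trans (value-combine (+ k) (natRow m e) (+ 0) (natRow m e) env)
    (trans (scale (+ k) _) (trans (cong (+ k ℤ.*_) (natRow-value e)) (sym (ℤ.pos-* k _))))

  intRow-value : ∀ e → value (intRow e) env ≡ ⟦_⟧ᶻ ρ σ e
  intRow-value (var i)  = trans (value-variable (n Fin.↑ʳ i) env) (Vec.lookup-++ʳ (Vec.map +_ ρ) σ i)
  intRow-value (con k)  = value-constant k env
  intRow-value (nat e)  = natRow-value e
  intRow-value (e :+ f) = trans (value-combine (+ 1) (intRow e) (+ 1) (intRow f) env)
    (trans (one (value (intRow e) env) (value (intRow f) env)) (cong₂ ℤ._+_ (intRow-value e) (intRow-value f)))
  intRow-value (e :- f) = trans (value-combine (+ 1) (intRow e) (ℤ.- + 1) (intRow f) env)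
    (trans (minus (value (intRow e) env) (value (intRow f) env)) (cong₂ ℤ._-_ (intRow-value e)
        (intRow-value f)))
  intRow-value (:- e) = trans (value-combine (ℤ.- + 1) (intRow e) (+ 0) (intRow e) env)
    (trans (neg _) (cong ℤ.-_ (intRow-value e)))

  difference-value : ∀ r s {x y} → value r env ≡ x → value s env ≡ y → value (difference r s) env ≡ x ℤ.- y
  difference-value r s p q = trans (value-combine (+ 1) r (ℤ.- + 1) s env) (trans (minus (value r env)
      (value s env)) (cong₂ ℤ._-_ p q))

  negation-sound : ∀ A → ¬ ⟦_⟧ ρ σ A → ⟦_⟧ ρ σ (negation A)
  negation-sound (e :≤ f) h = ℕ.≰⇒> h
  negation-sound (e :≡ f) h with ℕ.<-cmp (⟦_⟧ⁿ ρ e) (⟦_⟧ⁿ ρ f)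
  ... | tri< l _ _ = inj₂ l
  ... | tri≈ _ q _ = contradiction q h
  ... | tri> _ _ g = inj₁ g
  negation-sound (e :≤ᶻ f) h = ℤ.i<j⇒suc[i]≤j (ℤ.≰⇒> h)
  negation-sound (e :≡ᶻ f) h with ℤ.<-cmp (⟦_⟧ᶻ ρ σ e) (⟦_⟧ᶻ ρ σ f)
  ... | tri< l _ _ = inj₂ (ℤ.i<j⇒suc[i]≤j l)
  ... | tri≈ _ q _ = contradiction q h
  ... | tri> _ _ g = inj₁ (ℤ.i<j⇒suc[i]≤j g)
  negation-sound (A :∧ B) h with decide ρ σ A
  ... | no ¬a = inj₁ (negation-sound A ¬a)
  ... | yes a = inj₂ (negation-sound B (λ b → h (a , b)))
  negation-sound (A :∨ B) h = negation-sound A (h ∘ inj₁) , negation-sound B (h ∘ inj₂)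
  negation-sound :⊥ h = z≤n

  branches-sound : ∀ A k → (∀ {ds} → All (Holds env) ds → T (k ds) → ⊥) →
    ∀ {cs} → ⟦_⟧ ρ σ A → All (Holds env) cs → T (branches A k cs) → ⊥
  branches-sound (e :≤ f) k s h hs = s
    (subst (+ 0 ℤ.≤_) (sym (difference-value (natRow m f) (natRow m e) (natRow-value f) (natRow-value e)))
        (ℤ.i≤j⇒0≤j-i (ℤ.+≤+ h)) ∷ hs)
  branches-sound (e :≡ f) k s h hs = s
    (trans (difference-value (natRow m f) (natRow m e) (natRow-value f) (natRow-value e))
        (ℤ.i≡j⇒i-j≡0 (cong +_ (sym h))) ∷ hs)
  branches-sound (e :≤ᶻ f) k s h hs = s
    (subst (+ 0 ℤ.≤_) (sym (difference-value (intRow f) (intRow e) (intRow-value f) (intRow-value e)))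
        (ℤ.i≤j⇒0≤j-i h) ∷ hs)
  branches-sound (e :≡ᶻ f) k s h hs = s
    (trans (difference-value (intRow f) (intRow e) (intRow-value f) (intRow-value e))
        (ℤ.i≡j⇒i-j≡0 (sym h)) ∷ hs)
  branches-sound (A :∧ B) k s (a , b) hs = branches-sound A (branches B k) (λ ks →
      branches-sound B k s b ks) a hs
  branches-sound (A :∨ B) k s {cs} (inj₁ a) hs t = branches-sound A k s a hs (proj₁ (Equivalence.to T-∧ t))
  branches-sound (A :∨ B) k s {cs} (inj₂ b) hs t =
      branches-sound B k s b hs (proj₂ (Equivalence.to (T-∧ {branches A k cs}) t))

  -- For given values every formula, and hence every sequent, is decidable. This is what allows a
  -- refutation of the negated goal to count as a proof.
  provable-sound : ∀ S {cs} → All (Holds env) cs → T (provable S cs) → ⟦_⟧ˢ ρ σ S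
  provable-sound (⊢ A) hs t = decidable-stable (decide ρ σ A) λ ¬a →
    branches-sound (negation A) _ (λ ks →
        refutes-sound (n + m) env (reduce-sound env ks)) (negation-sound A ¬a) hs t
  provable-sound (A ⇒ S) {cs} hs t a = decidable-stable (sequent-dec S) λ ¬s →
    branches-sound A (provable S) (λ ks u → ¬s (provable-sound S ks u)) a hs t
    where
    sequent-dec : ∀ S → Dec (⟦_⟧ˢ ρ σ S)
    sequent-dec (⊢ A)   = decide ρ σ A
    sequent-dec (A ⇒ S) = decide ρ σ A →-dec sequent-dec S

  natsNonneg-hold : All (Holds env) (natsNonneg n m)
  natsNonneg-hold = All.map⁺ (All.tabulate λ {i} _ →
    subst (+ 0 ℤ.≤_) (sym (natRow-value (var i))) (ℤ.+≤+ z≤n))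

Fun : ℕ → Set → Set → Set
Fun zero    A B = B
Fun (suc n) A B = A → Fun n A B

apply : ∀ n {A B} → Fun n A B → (Fin n → A) → B
apply zero    f x = f
apply (suc n) f x = apply n (f (x zero)) (x ∘ suc)

All∀ : ∀ n (A : Set) → (Vec A n → Set) → Set
All∀ zero    A P = P []
All∀ (suc n) A P = ∀ x → All∀ n A (λ xs → P (x ∷ xs))

all∀ : ∀ n {A : Set} {P : Vec A n → Set} → (∀ xs → P xs) → All∀ n A P
all∀ zero    p = p []
all∀ (suc n) p = λ x → all∀ n (λ xs → p (x ∷ xs))

module _ (n m : ℕ) (f : Fun n (NatTerm n) (Fun m (IntTerm n m) (Sequent n m))) where
  private
    sequent : Sequent n m
    sequent = apply m (apply n f var) var

  opaque
    -- The test runs on a closed sequent, so a successful test is proved by `tt`. The resulting type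
    -- computes to the quantified arithmetical statement itself.
    arith : T (provable sequent (natsNonneg n m)) →
            All∀ n ℕ (λ ρ → All∀ m ℤ (λ σ → ⟦_⟧ˢ ρ σ sequent))
    arith t = all∀ n (λ ρ → all∀ m (λ σ → provable-sound ρ σ sequent (natsNonneg-hold ρ σ) t))

-- Distances, disks and Helly graphs

module _ {G : Graph} where

  concat : ∀ {u v w k l} → Walk G u v k → Walk G v w l → Walk G u w (k + l)
  concat here       q = q
  concat (step e p) q = step e (concat p q)

  snoc : ∀ {u v w k} → Walk G u v k → _~_ G v w → Walk G u w (suc k)
  snoc here       e = step e here
  snoc (step f p) e = step f (snoc p e)

  reverse : ∀ {u v k} → Walk G u v k → Walk G v u k
  reverse here       = here
  reverse (step e p) = snoc (reverse p) (~-sym G e)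

  splitWalk : ∀ i {j u v} → Walk G u v (i + j) → ∃[ w ] (Walk G u w i × Walk G w v j)
  splitWalk zero    p          = _ , here , p
  splitWalk (suc i) (step e p) = let w , q , r = splitWalk i p in w , step e q , r

  Dist-unique : ∀ {u v k l} → Dist G u v k → Dist G u v l → k ≡ l
  Dist-unique (p , m) (q , n) = ℕ.≤-antisym (m _ q) (n _ p)

  Dist-sym : ∀ {u v k} → Dist G u v k → Dist G v u k
  Dist-sym (p , m) = reverse p , λ n q → m n (reverse q)

  Dist-refl : ∀ {u} → Dist G u u 0
  Dist-refl = here , λ _ _ → z≤n

  Dist-zero : ∀ {u v} → Dist G u v 0 → u ≡ v
  Dist-zero (here , _) = refl

  Dist-triangle : ∀ {u v w k l m} → Dist G u w m → Dist G u v k → Dist G v w l → m ≤ k + l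
  Dist-triangle (_ , min) (p , _) (q , _) = min _ (concat p q)

  Dist-split : ∀ i {j u v} → Dist G u v (i + j) → ∃[ w ] (Dist G u w i × Dist G w v j)
  Dist-split i {j} (p , min) = let w , q , r = splitWalk i p in
    w , (q , λ n q′ → ℕ.+-cancelʳ-≤ j i n (min _ (concat q′ r))) ,
        (r , λ n r′ → ℕ.+-cancelˡ-≤ i j n (min _ (concat q r′)))

  InDisk-sym : ∀ {u v r} → InDisk G u r v → InDisk G v r u
  InDisk-sym (k , k≤r , d) = k , k≤r , Dist-sym d

  InDisk-mono : ∀ {u v r s} → r ≤ s → InDisk G u r v → InDisk G u s v
  InDisk-mono r≤s (k , k≤r , d) = k , ℕ.≤-trans k≤r r≤s , d

  InDisk-refl : ∀ {u} → InDisk G u 0 u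
  InDisk-refl = 0 , z≤n , Dist-refl

  InDisk⇒≤ : ∀ {u v r k} → InDisk G u r v → Dist G u v k → k ≤ r
  InDisk⇒≤ (l , l≤r , d) e = subst (_≤ _) (Dist-unique d e) l≤r

  disks-meet : ∀ {u v} r s → InDisk G u (r + s) v → ∃[ z ] (InDisk G u r z × InDisk G v s z)
  disks-meet {u} {v} r s (k , k≤ , d) with ℕ.≤-total k r
  ... | inj₁ k≤r = v , (k , k≤r , d) , (0 , z≤n , Dist-refl)
  ... | inj₂ r≤k = let z , p , q = Dist-split r (subst (Dist G u v) (sym (ℕ.m+[n∸m]≡n r≤k)) d) in
    z , (r , ℕ.≤-refl , p) , (k ∸ r , ℕ.m≤n+o⇒m∸n≤o k r k≤ , Dist-sym q)

module Placement {H : Graph} (helly : Helly H) {X : Set} (ρ : X → X → ℕ)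
  (ρ-refl : ∀ x → ρ x x ≡ 0) (ρ-sym : ∀ x y → ρ x y ≡ ρ y x)
  (ρ-triangle : ∀ x y z → ρ x z ≤ ρ x y + ρ y z) where

  Placed : List (X × V H) → Set
  Placed P = ∀ {x z x′ z′} → (x , z) ∈ P → (x′ , z′) ∈ P → InDisk H z (ρ x x′) z′

  -- `Placed` says that the finite partial map `P` is nonexpansive. An admissible image of `x` is a
  -- common point of the disks of radius `ρ x₁ x` around the images already chosen; these meet in
  -- pairs because `ρ x₁ x₂ ≤ ρ x₁ x + ρ x x₂` and a geodesic has points at every intermediate
  -- distance.
  extendOne : ∀ {P} → Placed P → ∀ x → ∃[ z ] Placed ((x , z) ∷ P)
  extendOne {P} placed x = z , λ where
      (here refl) (here refl) → subst (λ r → InDisk H z r z) (sym (ρ-refl x)) InDisk-refl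
      (here refl) (there j)   → subst (λ r → InDisk H z r _) (ρ-sym _ x) (InDisk-sym (near (_ , j)))
      (there i)   (here refl) → near (_ , i)
      (there i)   (there j)   → placed i j
    where
    I : Set
    I = Σ (X × V H) (_∈ P)
    common : ∃[ z ] (∀ (i : I) → InDisk H (proj₂ (proj₁ i)) (ρ (proj₁ (proj₁ i)) x) z)
    common = helly I (λ i → proj₂ (proj₁ i)) (λ i → ρ (proj₁ (proj₁ i)) x) λ where
      ((x₁ , z₁) , i) ((x₂ , z₂) , j) → disks-meet (ρ x₁ x) (ρ x₂ x)
        (InDisk-mono (subst (λ r → ρ x₁ x₂ ≤ ρ x₁ x + r) (ρ-sym x x₂) (ρ-triangle x₁ x x₂)) (placed i j))
    z    = proj₁ common
    near = proj₂ common

  extend : ∀ {P} → Placed P → (L : List X) →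
    ∃[ P′ ] (Placed P′ × (∀ {i} → i ∈ P → i ∈ P′) × (∀ x → x ∈ L → ∃[ z ] (x , z) ∈ P′))
  extend {P} placed [] = P , placed , id , λ _ ()
  extend {P} placed (x ∷ L) =
    let z , placed₁ = extendOne placed x
        P′ , placed′ , incl , cover = extend placed₁ L
    in P′ , placed′ , incl ∘ there , λ where
         _ (here refl) → z , incl (here refl)
         y (there m)   → cover y m

-- Four points of a Helly graph

module _ {G : Graph} where
  between⇒Dist : ∀ {a c z} X Z → InDisk G a X z → InDisk G c Z z → Dist G a c (X + Z) →
      Dist G a z X × Dist G c z Z
  between⇒Dist X Z (k , k≤X , p) (l , l≤Z , q) d =
    let m = Dist-triangle d p (Dist-sym q)
        k≡X = arith 4 0 (λ X Z k l → k :≤ X ⇒ l :≤ Z ⇒ X :+ Z :≤ k :+ l ⇒ ⊢ k :≡ X) tt X Z k l k≤X l≤Z m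
        l≡Z = arith 4 0 (λ X Z k l → k :≤ X ⇒ l :≤ Z ⇒ X :+ Z :≤ k :+ l ⇒ ⊢ l :≡ Z) tt X Z k l k≤X l≤Z m
    in subst (Dist G _ _) k≡X p , subst (Dist G _ _) l≡Z q

  -- Three upper bounds that add up to the exact distance of the ends have no slack. This is what
  -- turns nonexpansive maps into isometries.
  Dist-path : ∀ {a b c d k} x y z → Dist G a d (x + y + z) → InDisk G a x b → InDisk G b y c →
      InDisk G c z d → Dist G b c k → k ≡ y
  Dist-path {k = k} x y z d (n , n≤x , p) q (m , m≤z , r) e = ℕ.≤-antisym (InDisk⇒≤ q e)
      (arith 6 0 (λ x y z l m n → n :≤ x ⇒ m :≤ z ⇒ x :+ y :+ z :≤ n :+ (l :+ m) ⇒ ⊢ y :≤ l)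
          tt x y z k m n n≤x m≤z
         (proj₂ d _ (concat (proj₁ p) (concat (proj₁ e) (proj₁ r)))))

module _ {H : Graph} (helly : Helly H) where
  helly₄ : ∀ {c₀ c₁ c₂ c₃} r₀ r₁ r₂ r₃ →
    InDisk H c₀ (r₀ + r₁) c₁ → InDisk H c₀ (r₀ + r₂) c₂ → InDisk H c₀ (r₀ + r₃) c₃ →
    InDisk H c₁ (r₁ + r₂) c₂ → InDisk H c₁ (r₁ + r₃) c₃ → InDisk H c₂ (r₂ + r₃) c₃ →
    ∃[ z ] (InDisk H c₀ r₀ z × InDisk H c₁ r₁ z × InDisk H c₂ r₂ z × InDisk H c₃ r₃ z)
  helly₄ {c₀} {c₁} {c₂} {c₃} r₀ r₁ r₂ r₃ d₀₁ d₀₂ d₀₃ d₁₂ d₁₃ d₂₃ =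
    let z , h = helly (Fin 4) c r meet in z , h (# 0) , h (# 1) , h (# 2) , h (# 3)
    where
    c : Fin 4 → V H
    c = lookup (c₀ ∷ c₁ ∷ c₂ ∷ c₃ ∷ [])
    r : Fin 4 → ℕ
    r = lookup (r₀ ∷ r₁ ∷ r₂ ∷ r₃ ∷ [])
    Meet : Fin 4 → Fin 4 → Set
    Meet i j = ∃[ z ] (InDisk H (c i) (r i) z × InDisk H (c j) (r j) z)
    self : ∀ i → Meet i i
    self i = c i , InDisk-mono z≤n InDisk-refl , InDisk-mono z≤n InDisk-refl
    swap : ∀ {i j} → Meet i j → Meet j i
    swap (z , p , q) = z , q , p
    m₀₁ = disks-meet r₀ r₁ d₀₁
    m₀₂ = disks-meet r₀ r₂ d₀₂
    m₀₃ = disks-meet r₀ r₃ d₀₃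
    m₁₂ = disks-meet r₁ r₂ d₁₂
    m₁₃ = disks-meet r₁ r₃ d₁₃
    m₂₃ = disks-meet r₂ r₃ d₂₃
    meet : ∀ i j → Meet i j
    meet zero zero = self (# 0)
    meet zero (suc zero) = m₀₁
    meet zero (suc (suc zero)) = m₀₂
    meet zero (suc (suc (suc zero))) = m₀₃
    meet (suc zero) zero = swap {# 0} {# 1} m₀₁
    meet (suc zero) (suc zero) = self (# 1)
    meet (suc zero) (suc (suc zero)) = m₁₂
    meet (suc zero) (suc (suc (suc zero))) = m₁₃
    meet (suc (suc zero)) zero = swap {# 0} {# 2} m₀₂
    meet (suc (suc zero)) (suc zero) = swap {# 1} {# 2} m₁₂
    meet (suc (suc zero)) (suc (suc zero)) = self (# 2)
    meet (suc (suc zero)) (suc (suc (suc zero))) = m₂₃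
    meet (suc (suc (suc zero))) zero = swap {# 0} {# 3} m₀₃
    meet (suc (suc (suc zero))) (suc zero) = swap {# 1} {# 3} m₁₃
    meet (suc (suc (suc zero))) (suc (suc zero)) = swap {# 2} {# 3} m₂₃
    meet (suc (suc (suc zero))) (suc (suc (suc zero))) = self (# 3)

Diamond : (H : Graph) (a b c d : V H) (X Z D : ℕ) → Set
Diamond H a b c d X Z D = Dist H a c (X + Z) × Dist H b d D ×
  Dist H a b X × Dist H a d X × Dist H c b Z × Dist H c d Z

opaque
  -- `Y` will be the distance from b to b′: the larger of `ab - X` and `bc - Z`, the least radius
  -- allowing disks of radii X, Y, Z around a, b, c to meet. The last disjunction records its
  -- minimality, which leaves room for `D` and `W` on the way to d.
  chooseApex : ∀ X Z ab bc → X + Z ≤ ab + bc →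
    ∃[ Y ] (ab ≤ X + Y × bc ≤ Z + Y × (X + Y ≡ ab ⊎ Z + Y ≡ bc))
  chooseApex X Z ab bc h with ℕ.≤-total (ab + Z) (bc + X)
  ... | inj₁ l = bc ∸ Z , arith 5 0 (λ ab X Z bc Y → Z :+ Y :≡ bc ⇒ ab :+ Z :≤ bc :+ X ⇒ ⊢ ab :≤ X :+ Y)
      tt ab X Z bc (bc ∸ Z) e l
                        , ℕ.≤-reflexive (sym e) , inj₂ e
    where
    e : Z + (bc ∸ Z) ≡ bc
    e = ℕ.m+[n∸m]≡n (arith 4 0 (λ X Z ab bc → X :+ Z :≤ ab :+ bc ⇒ ab :+ Z :≤ bc :+ X ⇒ ⊢ Z :≤ bc)
        tt X Z ab bc h l)
  ... | inj₂ l = ab ∸ X , ℕ.≤-reflexive (sym e)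
                        , arith 5 0 (λ bc ab X Z Y → X :+ Y :≡ ab ⇒ bc :+ X :≤ ab :+ Z ⇒ ⊢ bc :≤ Z :+ Y)
                            tt bc ab X Z (ab ∸ X) e l
                        , inj₁ e
    where
    e : X + (ab ∸ X) ≡ ab
    e = ℕ.m+[n∸m]≡n (arith 4 0 (λ X Z ab bc → X :+ Z :≤ ab :+ bc ⇒ bc :+ X :≤ ab :+ Z ⇒ ⊢ X :≤ ab)
        tt X Z ab bc h l)

opaque
  -- What must fit into `bd` is the larger of `ab - X` and `bc - Z`, then `D`, then the larger of
  -- `da - X` and `cd - Z`. Each of the last four hypotheses handles one of the four combinations of
  -- maxima.
  apexDistances : ∀ X Z D ab bc cd da bd → X + Z ≤ ab + bc → X + Z ≤ da + cd →
    ab + cd + D ≤ X + Z + bd → da + bc + D ≤ X + Z + bd → ab + da + D ≤ 2 * X + bd → bc + cd + D ≤ 2 * Z + bd →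
    ∃[ Y ] ∃[ W ] (ab ≤ X + Y × bc ≤ Z + Y × da ≤ X + W × cd ≤ Z + W × Y + D + W ≡ bd)
  apexDistances X Z D ab bc cd da bd tb td hab had hX hZ with chooseApex X Z ab bc tb
  ... | Y , Y₁ , Y₂ , Y₃ = Y , W , Y₁ , Y₂ , da≤ , cd≤ , W≡
    where
    W : ℕ
    W = bd ∸ (Y + D)
    W≡ : Y + D + W ≡ bd
    W≡ = ℕ.m+[n∸m]≡n (arith 9 0 (λ cd da ab bc X Z Y D bd → X :+ Y :≡ ab :∨ Z :+ Y :≡ bc ⇒ X :+ Z :≤ da :+ cd ⇒
           ab :+ cd :+ D :≤ X :+ Z :+ bd ⇒ da :+ bc :+ D :≤ X :+ Z :+ bd ⇒
           ab :+ da :+ D :≤ 2 :* X :+ bd ⇒ bc :+ cd :+ D :≤ 2 :* Z :+ bd ⇒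
           ⊢ Y :+ D :≤ bd) tt cd da ab bc X Z Y D bd Y₃ td hab had hX hZ)
    da≤ : da ≤ X + W
    da≤ = arith 10 0 (λ cd da ab bc bd X Z Y D W → X :+ Y :≡ ab :∨ Z :+ Y :≡ bc ⇒ Y :+ D :+ W :≡ bd ⇒
        da :+ bc :+ D :≤ X :+ Z :+ bd ⇒ ab :+ da :+ D :≤ 2 :* X :+ bd ⇒ ⊢ da :≤ X :+ W)
        tt cd da ab bc bd X Z Y D W Y₃ W≡ had hX
    cd≤ : cd ≤ Z + W
    cd≤ = arith 10 0 (λ cd da ab bc bd X Z Y D W → X :+ Y :≡ ab :∨ Z :+ Y :≡ bc ⇒ Y :+ D :+ W :≡ bd ⇒
        ab :+ cd :+ D :≤ X :+ Z :+ bd ⇒ bc :+ cd :+ D :≤ 2 :* Z :+ bd ⇒ ⊢ cd :≤ Z :+ W)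
        tt cd da ab bc bd X Z Y D W Y₃ W≡ hab hZ

module _ {H : Graph} (helly : Helly H) {a b c d : V H} {ab bc cd da : ℕ} (X Z D Y W : ℕ)
  (Dab : Dist H a b ab) (Dbc : Dist H b c bc) (Dcd : Dist H c d cd) (Dda : Dist H d a da)
  (Dac : Dist H a c (X + Z)) (Dbd : Dist H b d (Y + D + W))
  (ab≤ : ab ≤ X + Y) (bc≤ : bc ≤ Z + Y) (da≤ : da ≤ X + W) (cd≤ : cd ≤ Z + W) where

  opaque
    -- b′ is taken on a geodesic from b to d, and then d′ on a geodesic from b′ to d.
    diamondFromApex : ∃[ b′ ] ∃[ d′ ] Diamond H a b′ c d′ X Z D
    diamondFromApex =
      let b′ , aX , cZ , bY , dV = helly₄ helly X Z Y (D + W)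
            (X + Z , ℕ.≤-refl , Dac) (ab , ab≤ , Dab) (da , weaken X da≤ , Dist-sym Dda)
            (bc , bc≤ , Dist-sym Dbc) (cd , weaken Z cd≤ , Dcd) (Y + D + W
                , ℕ.≤-reflexive (ℕ.+-assoc Y D W) , Dbd)
          ab′ , cb′ = between⇒Dist X Z aX cZ Dac
          bb′ , db′ = between⇒Dist Y (D + W) bY dV (subst (Dist H b d) (ℕ.+-assoc Y D W) Dbd)
          d′ , aX′ , cZ′ , dW , b′D = helly₄ helly X Z W D
            (X + Z , ℕ.≤-refl , Dac) (da , da≤ , Dist-sym Dda) (X , ℕ.m≤m+n X D , ab′)
            (cd , cd≤ , Dcd) (Z , ℕ.m≤m+n Z D , cb′) (D + W , ℕ.≤-reflexive (ℕ.+-comm D W) , db′)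
          ad′ , cd′ = between⇒Dist X Z aX′ cZ′ Dac
      in b′ , d′ , Dac , exact Dbd bb′ b′D (InDisk-sym dW) , ab′ , ad′ , cb′ , cd′
      where
      weaken : ∀ {x} y → x ≤ y + W → x ≤ y + (D + W)
      weaken y h = ℕ.≤-trans h (ℕ.+-monoʳ-≤ y (ℕ.m≤n+m W D))
      exact : ∀ {b b′ d′ d} → Dist H b d (Y + D + W) → Dist H b b′ Y → InDisk H b′ D d′ → InDisk H d′ W d →
          Dist H b′ d′ D
      exact p q (l , l≤D , r) u = subst (Dist H _ _) (Dist-path Y D W p (Y , ℕ.≤-refl , q) (l , l≤D , r) u r) r

module _ {H : Graph} (helly : Helly H) {a b c d : V H} {ab bc cd da bd : ℕ} (X Z D : ℕ)
  (Dab : Dist H a b ab) (Dbc : Dist H b c bc) (Dcd : Dist H c d cd) (Dda : Dist H d a da)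
  (Dac : Dist H a c (X + Z)) (Dbd : Dist H b d bd)
  (hab : ab + cd + D ≤ X + Z + bd) (had : da + bc + D ≤ X + Z + bd)
  (hX : ab + da + D ≤ 2 * X + bd) (hZ : bc + cd + D ≤ 2 * Z + bd) where

  opaque
    diamond : ∃[ b′ ] ∃[ d′ ] Diamond H a b′ c d′ X Z D
    diamond =
      let Y , W , ab≤ , bc≤ , da≤ , cd≤ , bd≡ = apexDistances X Z D ab bc cd da bd (Dist-triangle Dac Dab Dbc)
            (Dist-triangle Dac (Dist-sym Dda) (Dist-sym Dcd)) hab had hX hZ
      in diamondFromApex helly X Z D Y W Dab Dbc Dcd Dda Dac (subst (Dist H b d) (sym bd≡) Dbd) ab≤ bc≤ da≤ cd≤

-- `split-ac` supplies the X and Z that `diamond` asks for; `split-bd` is the same after the cyclic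
-- relabelling b, c, d, a. In `pinwheel`, the numbers A, B, C, E are how far the four points lie
-- beyond the corners of `H₃`.
data FourPointShape (D ab bc cd da ac bd : ℕ) : Set where
  split-ac : ∀ X Z → X + Z ≡ ac → ab + da + D ≤ 2 * X + bd → bc + cd + D ≤ 2 * Z + bd →
             FourPointShape D ab bc cd da ac bd
  split-bd : ∀ X Z → X + Z ≡ bd → bc + ab + D ≤ 2 * X + ac → cd + da + D ≤ 2 * Z + ac →
             FourPointShape D ab bc cd da ac bd
  pinwheel : ∀ k A B C E → D ≡ 2 * k + 2 →
             ab ≡ A + B + k + 2 → bc ≡ B + C + k + 2 → cd ≡ C + E + k + 2 → da ≡ E + A + k + 2 →
             ac ≡ A + C + 2 * k + 3 → bd ≡ B + E + 2 * k + 3 → FourPointShape D ab bc cd da ac bd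

ceilHalf : ∀ n → ∃[ X ] (2 * X ≡ n ⊎ 2 * X ≡ 1 + n)
ceilHalf zero = 0 , inj₁ refl
ceilHalf (suc n) with ceilHalf n
... | X , inj₁ e = suc X , inj₂ (arith 2 0 (λ X n → 2 :* X :≡ n ⇒ ⊢ 2 :* (con 1 :+ X) :≡ con 2 :+ n) tt X n e)
... | X , inj₂ e = X , inj₁ e

-- `Split` places 2X between the ends `ab + da + D - bd` and `2 * ac + bd - (bc + cd + D)`. The
-- length of this interval is the sum of the slacks in the two gap inequalities. In `TightOdd` both
-- ends are `2 * X - 1`, and accordingly both slacks are 0.
Split TightOdd : (D ab bc cd da ac bd : ℕ) → Set
Split D ab bc cd da ac bd =
  ∃[ X ] ∃[ Z ] (X + Z ≡ ac × ab + da + D ≤ 2 * X + bd × bc + cd + D ≤ 2 * Z + bd)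
TightOdd D ab bc cd da ac bd =
  ∃[ X ] (2 * X + bd ≡ 1 + (ab + da + D) × bc + cd + D + 2 * X ≡ 2 * ac + bd + 1 ×
          ab + cd + D ≡ ac + bd × da + bc + D ≡ ac + bd)

opaque
  -- The conditions confine 2X to an interval, which contains an even number unless its ends are equal and
  -- odd; in that case both hypotheses are equalities.
  trySplit : ∀ D ab bc cd da ac bd → ab + cd + D ≤ ac + bd → da + bc + D ≤ ac + bd →
    bd ≤ ab + da → bd ≤ bc + cd →
    Split D ab bc cd da ac bd ⊎ TightOdd D ab bc cd da ac bd
  trySplit D ab bc cd da ac bd h₁ h₂ t₁ t₂ = go (ceilHalf n)
    where
    n : ℕ
    n = (ab + da + D) ∸ bd
    n≡ : bd + n ≡ ab + da + D
    n≡ = ℕ.m+[n∸m]≡n (ℕ.≤-trans t₁ (ℕ.m≤m+n (ab + da) D))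
    go : ∃[ X ] (2 * X ≡ n ⊎ 2 * X ≡ 1 + n) → Split D ab bc cd da ac bd ⊎ TightOdd D ab bc cd da ac bd
    go (X , p) with 2 * X + (bc + cd + D) ℕ.≤? 2 * ac + bd
    ... | yes q = inj₁ (X , ac ∸ X , Z≡
        , subst (_≤ 2 * X + bd) (trans (ℕ.+-comm n bd) n≡) (ℕ.+-monoˡ-≤ bd (n≤ p))
        , arith 7 0 (λ Z bc cd D X ac bd → 2 :* X :+ (bc :+ cd :+ D) :≤ 2 :* ac :+ bd ⇒ X :+ Z :≡ ac ⇒
            ⊢ bc :+ cd :+ D :≤ 2 :* Z :+ bd) tt (ac ∸ X) bc cd D X ac bd q Z≡)
      where
      n≤ : (2 * X ≡ n ⊎ 2 * X ≡ 1 + n) → n ≤ 2 * X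
      n≤ (inj₁ e) = ℕ.≤-reflexive (sym e)
      n≤ (inj₂ e) = subst (n ≤_) (sym e) (ℕ.n≤1+n n)
      Z≡ : X + (ac ∸ X) ≡ ac
      Z≡ = ℕ.m+[n∸m]≡n (arith 6 0 (λ ac X bc cd bd D → 2 :* X :+ (bc :+ cd :+ D) :≤ 2 :* ac :+ bd ⇒
          bd :≤ bc :+ cd ⇒
             ⊢ X :≤ ac) tt ac X bc cd bd D q t₂)
    go (X , inj₁ e) | no ¬q = contradiction
      (arith 9 0 (λ n ab da ac bc cd bd D X → 2 :* X :≡ n ⇒ bd :+ n :≡ ab :+ da :+ D ⇒
          ab :+ cd :+ D :≤ ac :+ bd ⇒ da :+ bc :+ D :≤ ac :+ bd ⇒
          ⊢ 2 :* X :+ (bc :+ cd :+ D) :≤ 2 :* ac :+ bd) tt n ab da ac bc cd bd D X e n≡ h₁ h₂) ¬q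
    go (X , inj₂ e) | no ¬q = inj₂ (X ,
      arith 9 0 (λ n ab da ac bc cd bd D X → 2 :* X :≡ con 1 :+ n ⇒ bd :+ n :≡ ab :+ da :+ D ⇒
          con 1 :+ (2 :* ac :+ bd) :≤ 2 :* X :+ (bc :+ cd :+ D) ⇒
          ab :+ cd :+ D :≤ ac :+ bd ⇒ da :+ bc :+ D :≤ ac :+ bd ⇒
          ⊢ 2 :* X :+ bd :≡ con 1 :+ (ab :+ da :+ D) :∧ bc :+ cd :+ D :+ 2 :* X :≡ 2 :* ac :+ bd :+ con 1
            :∧ ab :+ cd :+ D :≡ ac :+ bd :∧ da :+ bc :+ D :≡ ac :+ bd)
        tt n ab da ac bc cd bd D X e n≡ (ℕ.≰⇒> ¬q) h₁ h₂)

  -- The system is linear and determines all six distances. In the solution A, B, C, E are Gromov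
  -- products minus one half: `2 * A + 1` is `ab + da - bd`, and likewise at the other points.
  pinwheelDistances : ∀ A B C E k {X Y ab bc cd da ac bd} →
    A + (k + 2) ≡ X → B + (k + 2) ≡ Y → C + (X + k + 1) ≡ ac → E + (Y + k + 1) ≡ bd →
    2 * X + bd ≡ 1 + (ab + da + 2 * suc k) → bc + cd + 2 * suc k + 2 * X ≡ 2 * ac + bd + 1 →
    ab + cd + 2 * suc k ≡ ac + bd → da + bc + 2 * suc k ≡ ac + bd → 2 * Y + ac ≡ 1 + (bc + ab + 2 * suc k) →
    ab ≡ A + B + k + 2 × bc ≡ B + C + k + 2 × cd ≡ C + E + k + 2 × da ≡ E + A + k + 2 ×
    ac ≡ A + C + 2 * k + 3 × bd ≡ B + E + 2 * k + 3
  pinwheelDistances A B C E k {ab = ab} {bc} {cd} {da} refl refl refl refl =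
      arith 9 0 (λ ab bc cd da A B C E k →
    let X = A :+ (k :+ con 2) ; Y = B :+ (k :+ con 2) ; ac = C :+ (X :+ k :+ con 1) ; bd =
            E :+ (Y :+ k :+ con 1)
        D = 2 :* (con 1 :+ k) in
    2 :* X :+ bd :≡ con 1 :+ (ab :+ da :+ D) ⇒ bc :+ cd :+ D :+ 2 :* X :≡ 2 :* ac :+ bd :+ con 1 ⇒
    ab :+ cd :+ D :≡ ac :+ bd ⇒ da :+ bc :+ D :≡ ac :+ bd ⇒ 2 :* Y :+ ac :≡ con 1 :+ (bc :+ ab :+ D) ⇒
    ⊢ ab :≡ A :+ B :+ k :+ con 2 :∧ bc :≡ B :+ C :+ k :+ con 2 :∧ cd :≡ C :+ E :+ k :+ con 2 :∧
      da :≡ E :+ A :+ k :+ con 2 :∧ ac :≡ A :+ C :+ 2 :* k :+ con 3 :∧ bd :≡ B :+ E :+ 2 :* k :+ con 3)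
    tt ab bc cd da A B C E k

  fourPointShape : ∀ D ab bc cd da ac bd → 1 ≤ D → ab + cd + D ≤ ac + bd → da + bc + D ≤ ac + bd →
    bd ≤ ab + da → bd ≤ bc + cd → ac ≤ bc + ab → ac ≤ cd + da →
    FourPointShape D ab bc cd da ac bd
  fourPointShape D ab bc cd da ac bd D≥1 h₁ h₂ t₁ t₂ t₃ t₄
    with trySplit D ab bc cd da ac bd h₁ h₂ t₁ t₂
       | trySplit D bc cd da ab bd ac
           (arith 7 0 (λ ab bc cd da ac bd D → da :+ bc :+ D :≤ ac :+ bd ⇒ ⊢ bc :+ da :+ D :≤ bd :+ ac)
               tt ab bc cd da ac bd D h₂)
           (arith 7 0 (λ ab bc cd da ac bd D → ab :+ cd :+ D :≤ ac :+ bd ⇒ ⊢ ab :+ cd :+ D :≤ bd :+ ac)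
               tt ab bc cd da ac bd D h₁)
           t₃ t₄
  ... | inj₁ (X , Z , e , p , q) | _ = split-ac X Z e p q
  ... | inj₂ _ | inj₁ (X , Z , e , p , q) = split-bd X Z e p q
  ... | inj₂ (X , e₁ , e₂ , e₃ , e₄) | inj₂ (Y , f₁ , f₂ , _ , _) with ceilHalf D
  -- Adding the two equations for X and Y and using `da + bc + D ≡ ac + bd` leaves
  -- `2 * X + 2 * Y ≡ 2 + 2 * ab + D`, so `D` cannot be odd.
  ...   | h , inj₂ odd = ⊥-elim (arith 10 0 (λ D bd ac da bc cd ab X Y h → 2 :* h :≡ con 1 :+ D ⇒
            2 :* X :+ bd :≡ con 1 :+ (ab :+ da :+ D) ⇒ 2 :* Y :+ ac :≡ con 1 :+ (bc :+ ab :+ D) ⇒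
            da :+ bc :+ D :≡ ac :+ bd ⇒ ⊢ :⊥) tt D bd ac da bc cd ab X Y h odd e₁ f₁ e₄)
  ...   | zero  , inj₁ refl = contradiction D≥1 (λ ())
  ...   | suc k , inj₁ refl = shape (X ∸ (k + 2)) (Y ∸ (k + 2)) (ac ∸ (X + k + 1)) (bd ∸ (Y + k + 1))
            (ℕ.m∸n+n≡m (bound X ab da bd e₁ t₁)) (ℕ.m∸n+n≡m (bound Y bc ab ac f₁ t₃))
            (ℕ.m∸n+n≡m (bound′ X bc cd ac bd e₂ t₂)) (ℕ.m∸n+n≡m (bound′ Y cd da bd ac f₂ t₄))
    where
    -- The triangle inequality gives only `2 * X ≥ 2 * k + 3`; integrality rounds this up to the
    -- `k + 2` occurring in `pinwheel`.
    bound : ∀ X ab da bd → 2 * X + bd ≡ 1 + (ab + da + 2 * suc k) → bd ≤ ab + da → k + 2 ≤ X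
    bound X ab da bd = arith 5 0 (λ ab da bd X k → 2 :* X :+ bd :≡ con 1 :+ (ab :+ da :+ 2 :* (con 1 :+ k)) ⇒
      bd :≤ ab :+ da ⇒ ⊢ k :+ con 2 :≤ X) tt ab da bd X k
    bound′ : ∀ X bc cd ac bd → bc + cd + 2 * suc k + 2 * X ≡ 2 * ac + bd + 1 → bd ≤ bc + cd → X + k + 1 ≤ ac
    bound′ X bc cd ac bd = arith 6 0 (λ bc cd bd ac X k →
        bc :+ cd :+ 2 :* (con 1 :+ k) :+ 2 :* X :≡ 2 :* ac :+ bd :+ con 1 ⇒
      bd :≤ bc :+ cd ⇒ ⊢ X :+ k :+ con 1 :≤ ac) tt bc cd bd ac X k
    shape : ∀ A B C E → A + (k + 2) ≡ X → B + (k + 2) ≡ Y → C + (X + k + 1) ≡ ac → E + (Y + k + 1) ≡ bd →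
      FourPointShape (2 * suc k) ab bc cd da ac bd
    shape A B C E p q r s = pinwheel k A B C E
      (arith 1 0 (λ k → ⊢ 2 :* (con 1 :+ k) :≡ 2 :* k :+ con 2) tt k)
      (proj₁ all) (proj₁ (proj₂ all)) (proj₁ (proj₂ (proj₂ all))) (proj₁ (proj₂ (proj₂ (proj₂ all))))
      (proj₁ (proj₂ (proj₂ (proj₂ (proj₂ all))))) (proj₂ (proj₂ (proj₂ (proj₂ (proj₂ all)))))
      where
      all : ab ≡ A + B + k + 2 × bc ≡ B + C + k + 2 × cd ≡ C + E + k + 2 × da ≡ E + A + k + 2 ×
            ac ≡ A + C + 2 * k + 3 × bd ≡ B + E + 2 * k + 3
      all = pinwheelDistances A B C E k p q r s e₁ e₂ e₃ e₄ f₁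

-- The king grid

Separation : ℤ → ℤ → ℕ → Set
Separation x y n = x ℤ.≤ y ℤ.+ + n × y ℤ.≤ x ℤ.+ + n × (x ≡ y ℤ.+ + n ⊎ y ≡ x ℤ.+ + n)

-- Together they characterise the king distance by linear formulas, so that `arith` can reason about
-- absolute values and maxima.
Near Attained : Point → Point → ℕ → Set
Near (x , y) (x′ , y′) n = (x ℤ.≤ x′ ℤ.+ + n × x′ ℤ.≤ x ℤ.+ + n) × (y ℤ.≤ y′ ℤ.+ + n × y′ ℤ.≤ y ℤ.+ + n)
Attained (x , y) (x′ , y′) n =
  (x ≡ x′ ℤ.+ + n ⊎ x′ ≡ x ℤ.+ + n) ⊎ (y ≡ y′ ℤ.+ + n ⊎ y′ ≡ y ℤ.+ + n)

:Near :Attained : ∀ {n m} → (x y x′ y′ : IntTerm n m) → NatTerm n → Formula n m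
:Near x y x′ y′ k = (x :≤ᶻ x′ :+ nat k :∧ x′ :≤ᶻ x :+ nat k) :∧ (y :≤ᶻ y′ :+ nat k :∧ y′ :≤ᶻ y :+ nat k)
:Attained x y x′ y′ k = (x :≡ᶻ x′ :+ nat k :∨ x′ :≡ᶻ x :+ nat k) :∨ (y :≡ᶻ y′ :+ nat k :∨ y′ :≡ᶻ y :+ nat k)

kd : Point → Point → ℕ
kd (x , y) (x′ , y′) = ∣ x ℤ.- x′ ∣ ⊔ ∣ y ℤ.- y′ ∣

opaque
  separation : ∀ x y → Separation x y ∣ x ℤ.- y ∣
  separation x y with ℤ.≤-total y x
  ... | inj₁ y≤x =
      let p = arith 1 2 (λ k x y → nat k :≡ᶻ x :- y ⇒ ⊢ x :≡ᶻ y :+ nat k :∧ y :≤ᶻ x :+ nat k)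
              tt ∣ x ℤ.- y ∣ x y e
      in ℤ.≤-reflexive (proj₁ p) , proj₂ p , inj₁ (proj₁ p)
    where
    e : + ∣ x ℤ.- y ∣ ≡ x ℤ.- y
    e = ℤ.0≤i⇒+∣i∣≡i (ℤ.i≤j⇒0≤j-i y≤x)
  ... | inj₂ x≤y =
      let p = arith 1 2 (λ k x y → nat k :≡ᶻ y :- x ⇒ ⊢ x :≤ᶻ y :+ nat k :∧ y :≡ᶻ x :+ nat k)
              tt ∣ x ℤ.- y ∣ x y e
      in proj₁ p , ℤ.≤-reflexive (proj₂ p) , inj₂ (proj₂ p)
    where
    e : + ∣ x ℤ.- y ∣ ≡ y ℤ.- x
    e = trans (cong +_ (ℤ.∣i-j∣≡∣j-i∣ x y)) (ℤ.0≤i⇒+∣i∣≡i (ℤ.i≤j⇒0≤j-i x≤y))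

  Separation-⊔ : ∀ {x y x′ y′} m n → Separation x x′ m → Separation y y′ n →
    Near (x , y) (x′ , y′) (m ⊔ n) × Attained (x , y) (x′ , y′) (m ⊔ n)
  Separation-⊔ {x} {y} {x′} {y′} m n (p , q , a) (r , s , b) with ℕ.≤-total m n
  ... | inj₁ m≤n rewrite ℕ.m≤n⇒m⊔n≡n m≤n = ((raise x x′ p , raise x′ x q) , r , s) , inj₂ b
    where
    raise : ∀ x y → x ℤ.≤ y ℤ.+ + m → x ℤ.≤ y ℤ.+ + n
    raise x y h = ℤ.≤-trans h (ℤ.+-monoʳ-≤ y (ℤ.+≤+ m≤n))
  ... | inj₂ n≤m rewrite ℕ.m≥n⇒m⊔n≡m n≤m = ((p , q) , raise y y′ r , raise y′ y s) , inj₁ a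
    where
    raise : ∀ x y → x ℤ.≤ y ℤ.+ + n → x ℤ.≤ y ℤ.+ + m
    raise x y h = ℤ.≤-trans h (ℤ.+-monoʳ-≤ y (ℤ.+≤+ n≤m))

  kd-spec : ∀ p q → Near p q (kd p q) × Attained p q (kd p q)
  kd-spec (x , y) (x′ , y′) = Separation-⊔ ∣ x ℤ.- x′ ∣ ∣ y ℤ.- y′ ∣ (separation x x′) (separation y y′)

  kd-near : ∀ p q → Near p q (kd p q)
  kd-near p q = proj₁ (kd-spec p q)

  kd-attained : ∀ p q → Attained p q (kd p q)
  kd-attained p q = proj₂ (kd-spec p q)

  kd-least : ∀ p q n → Near p q n → kd p q ≤ n
  kd-least (x , y) (x′ , y′) n h = arith 2 4 (λ d n x y x′ y′ → :Attained x y x′ y′ d ⇒ :Near x y x′ y′ n ⇒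
    ⊢ d :≤ n) tt (kd (x , y) (x′ , y′)) n x y x′ y′ (kd-attained (x , y) (x′ , y′)) h

  kd-≡ : ∀ p q n → Near p q n → Attained p q n → kd p q ≡ n
  kd-≡ p@(x , y) q@(x′ , y′) n h a = ℕ.≤-antisym (kd-least p q n h)
    (arith 2 4 (λ d n x y x′ y′ → :Attained x y x′ y′ n ⇒ :Near x y x′ y′ d ⇒
      ⊢ n :≤ d) tt (kd p q) n x y x′ y′ a (kd-near p q))

  kd-sym : ∀ p q → kd p q ≡ kd q p
  kd-sym (x , y) (x′ , y′) = cong₂ _⊔_ (ℤ.∣i-j∣≡∣j-i∣ x x′) (ℤ.∣i-j∣≡∣j-i∣ y y′)

  kd-refl : ∀ p → kd p p ≡ 0
  kd-refl (x , y) = cong₂ _⊔_ (cong ∣_∣ (ℤ.i≡j⇒i-j≡0 {x} refl)) (cong ∣_∣ (ℤ.i≡j⇒i-j≡0 {y} refl))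

  kd-zero : ∀ p q → kd p q ≡ 0 → p ≡ q
  kd-zero p@(x , y) q@(x′ , y′) e =
    let n = subst (Near p q) e (kd-near p q) in cong₂ _,_
      (arith 0 4 (λ x y x′ y′ → :Near x y x′ y′ (con 0) ⇒ ⊢ x :≡ᶻ x′) tt x y x′ y′ n)
      (arith 0 4 (λ x y x′ y′ → :Near x y x′ y′ (con 0) ⇒ ⊢ y :≡ᶻ y′) tt x y x′ y′ n)

  kd-triangle : ∀ p q r → kd p r ≤ kd p q + kd q r
  kd-triangle p@(x , y) q@(x′ , y′) r@(x″ , y″) = kd-least p r (kd p q + kd q r)
    (arith 2 6 (λ d e x y x′ y′ x″ y″ → :Near x y x′ y′ d ⇒ :Near x′ y′ x″ y″ e ⇒ ⊢ :Near x y x″ y″ (d :+ e))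
      tt (kd p q) (kd q r) x y x′ y′ x″ y″ (kd-near p q) (kd-near q r))

toward : ∀ x y → ∃[ z ] ((x ≡ y × z ≡ x) ⊎ (x ℤ.+ + 1 ℤ.≤ y × z ≡ x ℤ.+ + 1) ⊎ (y ℤ.+ + 1 ℤ.≤ x × z ≡ x ℤ.- + 1))
toward x y with ℤ.<-cmp x y
... | tri< l _ _ = _ , inj₂ (inj₁ (subst (ℤ._≤ y) (ℤ.+-comm (+ 1) x) (ℤ.i<j⇒suc[i]≤j l) , refl))
... | tri≈ _ e _ = _ , inj₁ (e , refl)
... | tri> _ _ g = _ , inj₂ (inj₂ (subst (ℤ._≤ x) (ℤ.+-comm (+ 1) y) (ℤ.i<j⇒suc[i]≤j g) , refl))

:Toward : ∀ {n m} → (x y z : IntTerm n m) → Formula n m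
:Toward x y z = (x :≡ᶻ y :∧ z :≡ᶻ x) :∨ (x :+ con (+ 1) :≤ᶻ y :∧ z :≡ᶻ x :+ con (+ 1)) :∨
                (y :+ con (+ 1) :≤ᶻ x :∧ z :≡ᶻ x :- con (+ 1))

Box : (a b c d : ℤ) → Point → Set
Box a b c d p = Between a (s p) b × Between c (t p) d

:Box : ∀ {n m} → (a b c d x y : IntTerm n m) → Formula n m
:Box a b c d x y = (a :≤ᶻ x :+ y :∧ x :+ y :≤ᶻ b) :∧ (c :≤ᶻ x :- y :∧ x :- y :≤ᶻ d)

-- A local form of being isometric: a geodesic between two points of `P` can be started inside `P`.
-- Induction on the distance completes it.
Stepping : (Point → Set) → Set
Stepping P = ∀ {p q} n → P p → P q → kd p q ≡ suc n → ∃[ r ] (P r × Near p r 1 × Near r q n)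

opaque
  -- Both coordinates move toward the target. Then s and t of the new point lie between their values
  -- at the two ends, so bounds that hold at both ends persist.
  Box-stepping : ∀ {a b c d} → Stepping (Box a b c d)
  Box-stepping {a} {b} {c} {d} {x , y} {x′ , y′} n P Q e with toward x x′ | toward y y′
  ... | u , hu | v , hv = (u , v)
      , ( arith 0 8 (λ u v x y x′ y′ a b → :Toward x x′ u ⇒ :Toward y y′ v ⇒ a :≤ᶻ x :+ y :∧ x :+ y :≤ᶻ b ⇒
            a :≤ᶻ x′ :+ y′ :∧ x′ :+ y′ :≤ᶻ b ⇒ ⊢ a :≤ᶻ u :+ v :∧ u :+ v :≤ᶻ b)
            tt u v x y x′ y′ a b hu hv (proj₁ P) (proj₁ Q)
        , arith 0 8 (λ u v x y x′ y′ c d → :Toward x x′ u ⇒ :Toward y y′ v ⇒ c :≤ᶻ x :- y :∧ x :- y :≤ᶻ d ⇒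
            c :≤ᶻ x′ :- y′ :∧ x′ :- y′ :≤ᶻ d ⇒ ⊢ c :≤ᶻ u :- v :∧ u :- v :≤ᶻ d)
            tt u v x y x′ y′ c d hu hv (proj₂ P) (proj₂ Q) )
      , ( arith 0 3 (λ u x x′ → :Toward x x′ u ⇒ ⊢ x :≤ᶻ u :+ con (+ 1) :∧ u :≤ᶻ x :+ con (+ 1)) tt u x x′ hu
        , arith 0 3 (λ u x x′ → :Toward x x′ u ⇒ ⊢ x :≤ᶻ u :+ con (+ 1) :∧ u :≤ᶻ x :+ con (+ 1)) tt v y y′ hv )
      , ( closer u x x′ hu (proj₁ near) , closer v y y′ hv (proj₂ near) )
    where
    near : Near (x , y) (x′ , y′) (suc n)
    near = subst (Near (x , y) (x′ , y′)) e (kd-near (x , y) (x′ , y′))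
    closer : ∀ u x x′ → (x ≡ x′ × u ≡ x) ⊎ (x ℤ.+ + 1 ℤ.≤ x′ × u ≡ x ℤ.+ + 1) ⊎ (x′ ℤ.+ + 1 ℤ.≤ x × u ≡ x ℤ.- + 1) →
      (x ℤ.≤ x′ ℤ.+ + suc n × x′ ℤ.≤ x ℤ.+ + suc n) → (u ℤ.≤ x′ ℤ.+ + n × x′ ℤ.≤ u ℤ.+ + n)
    closer = arith 1 3 (λ n u x x′ → :Toward x x′ u ⇒
               x :≤ᶻ x′ :+ nat (con 1 :+ n) :∧ x′ :≤ᶻ x :+ nat (con 1 :+ n) ⇒
               ⊢ u :≤ᶻ x′ :+ nat n :∧ x′ :≤ᶻ u :+ nat n) tt n

near-sym : ∀ p q {n} → Near p q n → Near q p n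
near-sym _ _ ((a , b) , (c , d)) = (b , a) , (d , c)

near-self : ∀ p → Near p p 0
near-self p = subst (Near p p) (kd-refl p) (kd-near p p)

near-triangle : ∀ p q r m n → Near p q m → Near q r n → Near p r (m + n)
near-triangle (x , y) (x′ , y′) (x″ , y″) m n = arith 2 6 (λ m n x y x′ y′ x″ y″ →
  :Near x y x′ y′ m ⇒ :Near x′ y′ x″ y″ n ⇒ ⊢ :Near x y x″ y″ (m :+ n)) tt m n x y x′ y′ x″ y″

-- Describes the first step of a geodesic from an added point `e`. The targets `P` and the landing
-- set `B` are separate because targets are added one at a time while the step keeps landing in the
-- core.
Exits : (Point → Set) → (Point → Set) → Point → Set
Exits P B e = ∀ q n → P q → Near e q (suc n) → ∃[ r ] (B r × Near e r 1 × Near r q n)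

adjoin-stepping : ∀ {P e} → Stepping P → Exits P P e → Stepping (λ p → P p ⊎ p ≡ e)
adjoin-stepping {P} {e} st exit {p} {q} n (inj₁ Pp) (inj₁ Pq) d =
  let r , Pr , h = st n Pp Pq d in r , inj₁ Pr , h
adjoin-stepping {P} {e} st exit {p} {q} n (inj₂ refl) (inj₁ Pq) d =
  let r , Pr , h = exit q n Pq (subst (Near p q) d (kd-near p q)) in r , inj₁ Pr , h
adjoin-stepping {P} {e} st exit {p} {q} n (inj₂ refl) (inj₂ refl) d =
  contradiction (trans (sym d) (kd-refl p)) (λ ())
adjoin-stepping {P} {e} st exit {p} {q} zero (inj₁ Pp) (inj₂ refl) d =
  e , inj₂ refl , subst (Near p e) d (kd-near p e) , near-self e
-- The geodesic to `e` is found from its far end: `r` is the first step from `e` toward `p`, at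
-- distance `suc n` from `p`, so a step from `p` toward `r` inside `P` is also a step toward `e`.
adjoin-stepping {P} {e} st exit {p} {q} (suc n) (inj₁ Pp) (inj₂ refl) d =
  let r , Pr , er , rp = exit p (suc n) Pp (near-sym p e (subst (Near p e) d (kd-near p e)))
      pr≡ = ℕ.≤-antisym (kd-least p r (suc n) (near-sym r p rp))
              (ℕ.≤-pred (ℕ.≤-trans (ℕ.≤-reflexive (sym d)) (ℕ.≤-trans (kd-triangle p r e)
                (ℕ.≤-trans (ℕ.+-monoʳ-≤ (kd p r) (kd-least r e 1 (near-sym e r er)))
                    (ℕ.≤-reflexive (ℕ.+-comm (kd p r) 1))))))
      w , Pw , pw , wr = st n Pp Pr pr≡
  in w , inj₁ Pw , pw , subst (Near w e) (ℕ.+-comm n 1) (near-triangle w r e n 1 wr (near-sym e r er))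

transport-stepping : ∀ {P Q : Point → Set} → (∀ {p} → P p → Q p) → (∀ {p} → Q p → P p) → Stepping P → Stepping Q
transport-stepping to from st n Qp Qq d = let r , Pr , h = st n (from Qp) (from Qq) d in r , to Pr , h

-- Vertices of `KingSub P` carry membership proofs. A point with two such proofs would give two
-- vertices at king distance 0 but not at graph distance 0.
Propositional : (Point → Set) → Set
Propositional P = ∀ p (a b : P p) → a ≡ b

module _ {P : Point → Set} (stepping : Stepping P) (prop : Propositional P) where

  reach : ∀ n (u v : Σ Point P) → kd (proj₁ u) (proj₁ v) ≤ n → ∃[ m ] (m ≤ n × Walk (KingSub P) u v m)
  reach n (p , a) (q , b) h with kd p q in eq
  reach n (p , a) (q , b) h | zero with kd-zero p q eq
  ... | refl = 0 , z≤n , subst (λ c → Walk (KingSub P) (p , a) (p , c) 0) (prop p a b) here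
  reach (suc n) (p , a) (q , b) (s≤s h) | suc k =
    let r , c , pr , rq = stepping k a b eq
        m , m≤n , w = reach n (r , c) (q , b) (ℕ.≤-trans (kd-least r q k rq) h)
    in suc m , s≤s m≤n , step (adjacent p q r k eq pr rq) w
    where
    adjacent : ∀ p q r k → kd p q ≡ suc k → Near p r 1 → Near r q k → KingAdj p r
    adjacent p q r k e pr rq = ℕ.≤-antisym (kd-least p r 1 pr) (ℕ.+-cancelʳ-≤ k 1 (kd p r)
      (ℕ.≤-trans (ℕ.≤-reflexive (sym e)) (ℕ.≤-trans (kd-triangle p r q) (ℕ.+-monoʳ-≤ (kd p r)
          (kd-least r q k rq)))))

kd-walk : ∀ {P u v m} → Walk (KingSub P) u v m → kd (proj₁ u) (proj₁ v) ≤ m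
kd-walk {u = p , _} here = ℕ.≤-reflexive (kd-refl p)
kd-walk {u = p , _} {v = q , _} (step {w = r , _} e w) =
  ℕ.≤-trans (kd-triangle p r q) (ℕ.+-mono-≤ (ℕ.≤-reflexive e) (kd-walk w))

KingIsometric : (Point → Set) → Set
KingIsometric P = ∀ (u v : Σ Point P) → Dist (KingSub P) u v (kd (proj₁ u) (proj₁ v))

stepping⇒isometric : ∀ {P} → Stepping P → Propositional P → KingIsometric P
stepping⇒isometric {P} st prop u v =
  let m , m≤ , w = reach st prop _ u v ℕ.≤-refl
  in subst (Walk (KingSub P) u v) (ℕ.≤-antisym m≤ (kd-walk w)) w , λ _ → kd-walk

Between-prop : ∀ {a z b} (h k : Between a z b) → h ≡ k
Between-prop (p , q) (p′ , q′) = cong₂ _,_ (ℤ.≤-irrelevant p p′) (ℤ.≤-irrelevant q q′)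

Box-prop : ∀ {a b c d} → Propositional (Box a b c d)
Box-prop _ (h , k) (h′ , k′) = cong₂ _,_ (Between-prop h h′) (Between-prop k k′)

point-prop : ∀ {e} → Propositional (_≡ e)
point-prop _ refl refl = refl

⊎-prop : ∀ {P Q : Point → Set} → Propositional P → Propositional Q → (∀ p → P p → Q p → ⊥) →
    Propositional (λ p → P p ⊎ Q p)
⊎-prop P Q disj p (inj₁ a) (inj₁ b) = cong inj₁ (P p a b)
⊎-prop P Q disj p (inj₂ a) (inj₂ b) = cong inj₂ (Q p a b)
⊎-prop P Q disj p (inj₁ a) (inj₂ b) = ⊥-elim (disj p a b)
⊎-prop P Q disj p (inj₂ a) (inj₁ b) = ⊥-elim (disj p b a)

H₁-isometric : ∀ k l → KingIsometric (InH1 k l)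
H₁-isometric k l = stepping⇒isometric Box-stepping Box-prop

side : ∀ a z → a ℤ.+ + 1 ℤ.≤ z ⊎ z ℤ.≤ a
side a z with z ℤ.≤? a
... | yes h = inj₂ h
... | no  h = inj₁ (subst (ℤ._≤ z) (ℤ.+-comm (+ 1) a) (ℤ.i<j⇒suc[i]≤j (ℤ.≰⇒> h)))

exits-⊎ : ∀ {P B : Point → Set} {e f} → Exits P B e →
  (∀ n → Near e f (suc n) → ∃[ r ] (B r × Near e r 1 × Near r f n)) → Exits (λ p → P p ⊎ p ≡ f) B e
exits-⊎ E F q n (inj₁ Pq) = E q n Pq
exits-⊎ E F q n (inj₂ refl) = F n

exits-mono : ∀ {P B C : Point → Set} {e} → (∀ {p} → B p → C p) → Exits P B e → Exits P C e
exits-mono f E q n Pq h = let r , Br , g = E q n Pq h in r , f Br , g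

-- The points added to the boxes in `H₂` and `H₃`

module Extended₂ (k : ℕ) where
  Core : Point → Set
  Core = Box (+ 0) (+ (2 * k + 1)) (-1ℤ) (+ (2 * k))

  e1 : Point
  e1 = (-1ℤ , + 0)

  e2 : Point
  e2 = (+ (k + k + 1) , (+ k ℤ.- + k) ℤ.+ + 1)

  opaque
    -- The only neighbours of `e1` in the core are `(0, 0)` and `(0, 1)`. Distances from `e1` to the
    -- core are horizontal, and the neighbour in the half of the target, `y ≤ 0` or `y ≥ 1`, has it
    -- in its horizontal cone again.
    exit1 : Exits Core Core e1
    exit1 (x , y) n Q h with side (+ 0) y
    ... | inj₁ c = (+ 0 , + 1) , arith 2 2 (λ n k x y → (con (+ 0)) :+ con (+ 1) :≤ᶻ y ⇒
        :Box (con (+ 0)) (nat (2 :* k :+ con 1)) (con -1ℤ) (nat (2 :* k)) x y ⇒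
        :Near (con -1ℤ) (con (+ 0)) x y (con 1 :+ n) ⇒
        ⊢ :Box (con (+ 0)) (nat (2 :* k :+ con 1)) (con -1ℤ) (nat (2 :* k)) (con (+ 0)) (con (+ 1)) :∧
            :Near (con -1ℤ) (con (+ 0)) (con (+ 0)) (con (+ 1)) (con 1) :∧
            :Near (con (+ 0)) (con (+ 1)) x y n) tt n k x y c Q h
    ... | inj₂ c = (+ 0 , + 0) , arith 2 2 (λ n k x y → y :≤ᶻ (con (+ 0)) ⇒
        :Box (con (+ 0)) (nat (2 :* k :+ con 1)) (con -1ℤ) (nat (2 :* k)) x y ⇒
        :Near (con -1ℤ) (con (+ 0)) x y (con 1 :+ n) ⇒
        ⊢ :Box (con (+ 0)) (nat (2 :* k :+ con 1)) (con -1ℤ) (nat (2 :* k)) (con (+ 0)) (con (+ 0)) :∧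
            :Near (con -1ℤ) (con (+ 0)) (con (+ 0)) (con (+ 0)) (con 1) :∧
            :Near (con (+ 0)) (con (+ 0)) x y n) tt n k x y c Q h

    outside1 : ¬ Core e1
    outside1 h = arith 1 0 (λ k →
        :Box (con (+ 0)) (nat (2 :* k :+ con 1)) (con -1ℤ) (nat (2 :* k)) (con -1ℤ) (con (+ 0)) ⇒ ⊢ :⊥) tt k h

    exit2 : Exits Core Core e2
    exit2 (x , y) n Q h with side (+ 0) y
    ... | inj₁ c = (+ (2 * k) , + 1) , arith 2 2 (λ n k x y → (con (+ 0)) :+ con (+ 1) :≤ᶻ y ⇒
        :Box (con (+ 0)) (nat (2 :* k :+ con 1)) (con -1ℤ) (nat (2 :* k)) x y ⇒
        :Near (nat (k :+ k :+ con 1)) ((nat k :- nat k) :+ con (+ 1)) x y (con 1 :+ n) ⇒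
        ⊢ :Box (con (+ 0)) (nat (2 :* k :+ con 1)) (con -1ℤ) (nat (2 :* k)) (nat (2 :* k)) (con (+ 1)) :∧
            :Near (nat (k :+ k :+ con 1)) ((nat k :- nat k) :+ con (+ 1)) (nat (2 :* k)) (con (+ 1))
            (con 1) :∧ :Near (nat (2 :* k)) (con (+ 1)) x y n) tt n k x y c Q h
    ... | inj₂ c = (+ (2 * k) , + 0) , arith 2 2 (λ n k x y → y :≤ᶻ (con (+ 0)) ⇒
        :Box (con (+ 0)) (nat (2 :* k :+ con 1)) (con -1ℤ) (nat (2 :* k)) x y ⇒
        :Near (nat (k :+ k :+ con 1)) ((nat k :- nat k) :+ con (+ 1)) x y (con 1 :+ n) ⇒
        ⊢ :Box (con (+ 0)) (nat (2 :* k :+ con 1)) (con -1ℤ) (nat (2 :* k)) (nat (2 :* k)) (con (+ 0)) :∧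
            :Near (nat (k :+ k :+ con 1)) ((nat k :- nat k) :+ con (+ 1)) (nat (2 :* k)) (con (+ 0))
            (con 1) :∧ :Near (nat (2 :* k)) (con (+ 0)) x y n) tt n k x y c Q h

    exit21 : ∀ n → Near e2 e1 (suc n) → ∃[ r ] (Core r × Near e2 r 1 × Near r e1 n)
    exit21 n h = (+ (2 * k) , + 0) , arith 2 0 (λ n k →
        :Near (nat (k :+ k :+ con 1)) ((nat k :- nat k) :+ con (+ 1)) (con -1ℤ) (con (+ 0)) (con 1 :+ n) ⇒
        ⊢ :Box (con (+ 0)) (nat (2 :* k :+ con 1)) (con -1ℤ) (nat (2 :* k)) (nat (2 :* k)) (con (+ 0)) :∧
            :Near (nat (k :+ k :+ con 1)) ((nat k :- nat k) :+ con (+ 1)) (nat (2 :* k)) (con (+ 0))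
            (con 1) :∧ :Near (nat (2 :* k)) (con (+ 0)) (con -1ℤ) (con (+ 0)) n) tt n k h

    outside2 : ¬ Core e2
    outside2 h = arith 1 0 (λ k →
        :Box (con (+ 0)) (nat (2 :* k :+ con 1)) (con -1ℤ) (nat (2 :* k)) (nat (k :+ k :+ con 1))
        ((nat k :- nat k) :+ con (+ 1)) ⇒ ⊢ :⊥) tt k h

    distinct12 : e1 ≢ e2
    distinct12 h = arith 1 0 (λ k → (con -1ℤ) :≡ᶻ (nat (k :+ k :+ con 1)) ⇒
        (con (+ 0)) :≡ᶻ ((nat k :- nat k) :+ con (+ 1)) ⇒ ⊢ :⊥) tt k (cong proj₁ h) (cong proj₂ h)

  isometric : KingIsometric (InH2 k k)
  isometric = stepping⇒isometric
    (transport-stepping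
      (λ { (inj₁ (inj₁ h)) → inj₁ h ; (inj₁ (inj₂ h)) → inj₂ (inj₁ h) ; (inj₂ h) → inj₂ (inj₂ h) })
      (λ { (inj₁ h) → inj₁ (inj₁ h) ; (inj₂ (inj₁ h)) → inj₁ (inj₂ h) ; (inj₂ (inj₂ h)) → inj₂ h })
      (adjoin-stepping (adjoin-stepping Box-stepping exit1) (exits-mono inj₁ (exits-⊎ exit2 exit21))))
    (⊎-prop Box-prop (⊎-prop point-prop point-prop (λ { _ refl h → distinct12 h }))
      (λ { _ h (inj₁ refl) → outside1 h ; _ h (inj₂ refl) → outside2 h }))

module Extended₃ (k : ℕ) where
  Core : Point → Set
  Core = Box (+ 0) (+ (2 * k + 2)) (-1ℤ) (+ (2 * k + 1))

  e1 : Point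
  e1 = (+ k , ℤ.- (+ k) ℤ.- + 1)

  e2 : Point
  e2 = (-1ℤ , + 1)

  e3 : Point
  e3 = (+ (k + 1) , + (k + 2))

  e4 : Point
  e4 = (+ (k + k + 2) , + k ℤ.- + k)

  opaque
    -- Distances from `e1` and `e3` to the core are vertical, and the right neighbour depends on the
    -- half `x ≤ k` or `x ≥ k + 1` containing the target. For `e2` and `e4` they are horizontal,
    -- with halves `y ≤ 0` and `y ≥ 1`.
    exit1 : Exits Core Core e1
    exit1 (x , y) n Q h with side (+ k) x
    ... | inj₁ c = (+ (k + 1) , ℤ.- (+ k)) , arith 2 2 (λ n k x y → (nat k) :+ con (+ 1) :≤ᶻ x ⇒
        :Box (con (+ 0)) (nat (2 :* k :+ con 2)) (con -1ℤ) (nat (2 :* k :+ con 1)) x y ⇒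
        :Near (nat k) ((:- nat k) :- con (+ 1)) x y (con 1 :+ n) ⇒
        ⊢ :Box (con (+ 0)) (nat (2 :* k :+ con 2)) (con -1ℤ) (nat (2 :* k :+ con 1)) (nat (k :+ con 1))
            ((:- nat k)) :∧ :Near (nat k) ((:- nat k) :- con (+ 1)) (nat (k :+ con 1)) ((:- nat k))
            (con 1) :∧ :Near (nat (k :+ con 1)) ((:- nat k)) x y n) tt n k x y c Q h
    ... | inj₂ c = (+ k , ℤ.- (+ k)) , arith 2 2 (λ n k x y → x :≤ᶻ (nat k) ⇒
        :Box (con (+ 0)) (nat (2 :* k :+ con 2)) (con -1ℤ) (nat (2 :* k :+ con 1)) x y ⇒
        :Near (nat k) ((:- nat k) :- con (+ 1)) x y (con 1 :+ n) ⇒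
        ⊢ :Box (con (+ 0)) (nat (2 :* k :+ con 2)) (con -1ℤ) (nat (2 :* k :+ con 1)) (nat k)
            ((:- nat k)) :∧ :Near (nat k) ((:- nat k) :- con (+ 1)) (nat k) ((:- nat k)) (con 1) :∧
            :Near (nat k) ((:- nat k)) x y n) tt n k x y c Q h

    outside1 : ¬ Core e1
    outside1 h = arith 1 0 (λ k →
        :Box (con (+ 0)) (nat (2 :* k :+ con 2)) (con -1ℤ) (nat (2 :* k :+ con 1)) (nat k)
        ((:- nat k) :- con (+ 1)) ⇒ ⊢ :⊥) tt k h

    exit2 : Exits Core Core e2
    exit2 (x , y) n Q h with side (+ 0) y
    ... | inj₁ c = (+ 0 , + 1) , arith 2 2 (λ n k x y → (con (+ 0)) :+ con (+ 1) :≤ᶻ y ⇒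
        :Box (con (+ 0)) (nat (2 :* k :+ con 2)) (con -1ℤ) (nat (2 :* k :+ con 1)) x y ⇒
        :Near (con -1ℤ) (con (+ 1)) x y (con 1 :+ n) ⇒
        ⊢ :Box (con (+ 0)) (nat (2 :* k :+ con 2)) (con -1ℤ) (nat (2 :* k :+ con 1)) (con (+ 0))
            (con (+ 1)) :∧ :Near (con -1ℤ) (con (+ 1)) (con (+ 0)) (con (+ 1)) (con 1) :∧
            :Near (con (+ 0)) (con (+ 1)) x y n) tt n k x y c Q h
    ... | inj₂ c = (+ 0 , + 0) , arith 2 2 (λ n k x y → y :≤ᶻ (con (+ 0)) ⇒
        :Box (con (+ 0)) (nat (2 :* k :+ con 2)) (con -1ℤ) (nat (2 :* k :+ con 1)) x y ⇒
        :Near (con -1ℤ) (con (+ 1)) x y (con 1 :+ n) ⇒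
        ⊢ :Box (con (+ 0)) (nat (2 :* k :+ con 2)) (con -1ℤ) (nat (2 :* k :+ con 1)) (con (+ 0))
            (con (+ 0)) :∧ :Near (con -1ℤ) (con (+ 1)) (con (+ 0)) (con (+ 0)) (con 1) :∧
            :Near (con (+ 0)) (con (+ 0)) x y n) tt n k x y c Q h

    exit21 : ∀ n → Near e2 e1 (suc n) → ∃[ r ] (Core r × Near e2 r 1 × Near r e1 n)
    exit21 n h = (+ 0 , + 0) , arith 2 0 (λ n k →
        :Near (con -1ℤ) (con (+ 1)) (nat k) ((:- nat k) :- con (+ 1)) (con 1 :+ n) ⇒
        ⊢ :Box (con (+ 0)) (nat (2 :* k :+ con 2)) (con -1ℤ) (nat (2 :* k :+ con 1)) (con (+ 0))
            (con (+ 0)) :∧ :Near (con -1ℤ) (con (+ 1)) (con (+ 0)) (con (+ 0)) (con 1) :∧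
            :Near (con (+ 0)) (con (+ 0)) (nat k) ((:- nat k) :- con (+ 1)) n) tt n k h

    outside2 : ¬ Core e2
    outside2 h = arith 1 0 (λ k →
        :Box (con (+ 0)) (nat (2 :* k :+ con 2)) (con -1ℤ) (nat (2 :* k :+ con 1)) (con -1ℤ) (con (+ 1)) ⇒
        ⊢ :⊥) tt k h

    exit3 : Exits Core Core e3
    exit3 (x , y) n Q h with side (+ k) x
    ... | inj₁ c = (+ (k + 1) , + (k + 1)) , arith 2 2 (λ n k x y → (nat k) :+ con (+ 1) :≤ᶻ x ⇒
        :Box (con (+ 0)) (nat (2 :* k :+ con 2)) (con -1ℤ) (nat (2 :* k :+ con 1)) x y ⇒
        :Near (nat (k :+ con 1)) (nat (k :+ con 2)) x y (con 1 :+ n) ⇒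
        ⊢ :Box (con (+ 0)) (nat (2 :* k :+ con 2)) (con -1ℤ) (nat (2 :* k :+ con 1)) (nat (k :+ con 1))
            (nat (k :+ con 1)) :∧ :Near (nat (k :+ con 1)) (nat (k :+ con 2)) (nat (k :+ con 1))
            (nat (k :+ con 1)) (con 1) :∧ :Near (nat (k :+ con 1)) (nat (k :+ con 1)) x y n) tt n k x y c Q h
    ... | inj₂ c = (+ k , + (k + 1)) , arith 2 2 (λ n k x y → x :≤ᶻ (nat k) ⇒
        :Box (con (+ 0)) (nat (2 :* k :+ con 2)) (con -1ℤ) (nat (2 :* k :+ con 1)) x y ⇒
        :Near (nat (k :+ con 1)) (nat (k :+ con 2)) x y (con 1 :+ n) ⇒
        ⊢ :Box (con (+ 0)) (nat (2 :* k :+ con 2)) (con -1ℤ) (nat (2 :* k :+ con 1)) (nat k)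
            (nat (k :+ con 1)) :∧ :Near (nat (k :+ con 1)) (nat (k :+ con 2)) (nat k) (nat (k :+ con 1))
            (con 1) :∧ :Near (nat k) (nat (k :+ con 1)) x y n) tt n k x y c Q h

    exit31 : ∀ n → Near e3 e1 (suc n) → ∃[ r ] (Core r × Near e3 r 1 × Near r e1 n)
    exit31 n h = (+ k , + (k + 1)) , arith 2 0 (λ n k →
        :Near (nat (k :+ con 1)) (nat (k :+ con 2)) (nat k) ((:- nat k) :- con (+ 1)) (con 1 :+ n) ⇒
        ⊢ :Box (con (+ 0)) (nat (2 :* k :+ con 2)) (con -1ℤ) (nat (2 :* k :+ con 1)) (nat k)
            (nat (k :+ con 1)) :∧ :Near (nat (k :+ con 1)) (nat (k :+ con 2)) (nat k) (nat (k :+ con 1))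
            (con 1) :∧ :Near (nat k) (nat (k :+ con 1)) (nat k) ((:- nat k) :- con (+ 1)) n) tt n k h

    exit32 : ∀ n → Near e3 e2 (suc n) → ∃[ r ] (Core r × Near e3 r 1 × Near r e2 n)
    exit32 n h = (+ k , + (k + 1)) , arith 2 0 (λ n k →
        :Near (nat (k :+ con 1)) (nat (k :+ con 2)) (con -1ℤ) (con (+ 1)) (con 1 :+ n) ⇒
        ⊢ :Box (con (+ 0)) (nat (2 :* k :+ con 2)) (con -1ℤ) (nat (2 :* k :+ con 1)) (nat k)
            (nat (k :+ con 1)) :∧ :Near (nat (k :+ con 1)) (nat (k :+ con 2)) (nat k) (nat (k :+ con 1))
            (con 1) :∧ :Near (nat k) (nat (k :+ con 1)) (con -1ℤ) (con (+ 1)) n) tt n k h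

    outside3 : ¬ Core e3
    outside3 h = arith 1 0 (λ k →
        :Box (con (+ 0)) (nat (2 :* k :+ con 2)) (con -1ℤ) (nat (2 :* k :+ con 1)) (nat (k :+ con 1))
        (nat (k :+ con 2)) ⇒ ⊢ :⊥) tt k h

    exit4 : Exits Core Core e4
    exit4 (x , y) n Q h with side (+ 0) y
    ... | inj₁ c = (+ (2 * k + 1) , + 1) , arith 2 2 (λ n k x y → (con (+ 0)) :+ con (+ 1) :≤ᶻ y ⇒
        :Box (con (+ 0)) (nat (2 :* k :+ con 2)) (con -1ℤ) (nat (2 :* k :+ con 1)) x y ⇒
        :Near (nat (k :+ k :+ con 2)) (nat k :- nat k) x y (con 1 :+ n) ⇒
        ⊢ :Box (con (+ 0)) (nat (2 :* k :+ con 2)) (con -1ℤ) (nat (2 :* k :+ con 1))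
            (nat (2 :* k :+ con 1)) (con (+ 1)) :∧
            :Near (nat (k :+ k :+ con 2)) (nat k :- nat k) (nat (2 :* k :+ con 1)) (con (+ 1)) (con 1) :∧
            :Near (nat (2 :* k :+ con 1)) (con (+ 1)) x y n) tt n k x y c Q h
    ... | inj₂ c = (+ (2 * k + 1) , + 0) , arith 2 2 (λ n k x y → y :≤ᶻ (con (+ 0)) ⇒
        :Box (con (+ 0)) (nat (2 :* k :+ con 2)) (con -1ℤ) (nat (2 :* k :+ con 1)) x y ⇒
        :Near (nat (k :+ k :+ con 2)) (nat k :- nat k) x y (con 1 :+ n) ⇒
        ⊢ :Box (con (+ 0)) (nat (2 :* k :+ con 2)) (con -1ℤ) (nat (2 :* k :+ con 1))
            (nat (2 :* k :+ con 1)) (con (+ 0)) :∧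
            :Near (nat (k :+ k :+ con 2)) (nat k :- nat k) (nat (2 :* k :+ con 1)) (con (+ 0)) (con 1) :∧
            :Near (nat (2 :* k :+ con 1)) (con (+ 0)) x y n) tt n k x y c Q h

    exit41 : ∀ n → Near e4 e1 (suc n) → ∃[ r ] (Core r × Near e4 r 1 × Near r e1 n)
    exit41 n h = (+ (2 * k + 1) , + 0) , arith 2 0 (λ n k →
        :Near (nat (k :+ k :+ con 2)) (nat k :- nat k) (nat k) ((:- nat k) :- con (+ 1)) (con 1 :+ n) ⇒
        ⊢ :Box (con (+ 0)) (nat (2 :* k :+ con 2)) (con -1ℤ) (nat (2 :* k :+ con 1))
            (nat (2 :* k :+ con 1)) (con (+ 0)) :∧
            :Near (nat (k :+ k :+ con 2)) (nat k :- nat k) (nat (2 :* k :+ con 1)) (con (+ 0)) (con 1) :∧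
            :Near (nat (2 :* k :+ con 1)) (con (+ 0)) (nat k) ((:- nat k) :- con (+ 1)) n) tt n k h

    exit42 : ∀ n → Near e4 e2 (suc n) → ∃[ r ] (Core r × Near e4 r 1 × Near r e2 n)
    exit42 n h = (+ (2 * k + 1) , + 1) , arith 2 0 (λ n k →
        :Near (nat (k :+ k :+ con 2)) (nat k :- nat k) (con -1ℤ) (con (+ 1)) (con 1 :+ n) ⇒
        ⊢ :Box (con (+ 0)) (nat (2 :* k :+ con 2)) (con -1ℤ) (nat (2 :* k :+ con 1))
            (nat (2 :* k :+ con 1)) (con (+ 1)) :∧
            :Near (nat (k :+ k :+ con 2)) (nat k :- nat k) (nat (2 :* k :+ con 1)) (con (+ 1)) (con 1) :∧
            :Near (nat (2 :* k :+ con 1)) (con (+ 1)) (con -1ℤ) (con (+ 1)) n) tt n k h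

    exit43 : ∀ n → Near e4 e3 (suc n) → ∃[ r ] (Core r × Near e4 r 1 × Near r e3 n)
    exit43 n h = (+ (2 * k + 1) , + 1) , arith 2 0 (λ n k →
        :Near (nat (k :+ k :+ con 2)) (nat k :- nat k) (nat (k :+ con 1)) (nat (k :+ con 2)) (con 1 :+ n) ⇒
        ⊢ :Box (con (+ 0)) (nat (2 :* k :+ con 2)) (con -1ℤ) (nat (2 :* k :+ con 1))
            (nat (2 :* k :+ con 1)) (con (+ 1)) :∧
            :Near (nat (k :+ k :+ con 2)) (nat k :- nat k) (nat (2 :* k :+ con 1)) (con (+ 1)) (con 1) :∧
            :Near (nat (2 :* k :+ con 1)) (con (+ 1)) (nat (k :+ con 1)) (nat (k :+ con 2)) n) tt n k h

    outside4 : ¬ Core e4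
    outside4 h = arith 1 0 (λ k →
        :Box (con (+ 0)) (nat (2 :* k :+ con 2)) (con -1ℤ) (nat (2 :* k :+ con 1)) (nat (k :+ k :+ con 2))
        (nat k :- nat k) ⇒ ⊢ :⊥) tt k h

    distinct12 : e1 ≢ e2
    distinct12 h = arith 1 0 (λ k → (nat k) :≡ᶻ (con -1ℤ) ⇒ ((:- nat k) :- con (+ 1)) :≡ᶻ (con (+ 1)) ⇒
        ⊢ :⊥) tt k (cong proj₁ h) (cong proj₂ h)

    distinct13 : e1 ≢ e3
    distinct13 h = arith 1 0 (λ k → (nat k) :≡ᶻ (nat (k :+ con 1)) ⇒
        ((:- nat k) :- con (+ 1)) :≡ᶻ (nat (k :+ con 2)) ⇒ ⊢ :⊥) tt k (cong proj₁ h) (cong proj₂ h)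

    distinct23 : e2 ≢ e3
    distinct23 h = arith 1 0 (λ k → (con -1ℤ) :≡ᶻ (nat (k :+ con 1)) ⇒ (con (+ 1)) :≡ᶻ (nat (k :+ con 2)) ⇒
        ⊢ :⊥) tt k (cong proj₁ h) (cong proj₂ h)

    distinct14 : e1 ≢ e4
    distinct14 h = arith 1 0 (λ k → (nat k) :≡ᶻ (nat (k :+ k :+ con 2)) ⇒
        ((:- nat k) :- con (+ 1)) :≡ᶻ (nat k :- nat k) ⇒ ⊢ :⊥) tt k (cong proj₁ h) (cong proj₂ h)

    distinct24 : e2 ≢ e4
    distinct24 h = arith 1 0 (λ k → (con -1ℤ) :≡ᶻ (nat (k :+ k :+ con 2)) ⇒
        (con (+ 1)) :≡ᶻ (nat k :- nat k) ⇒ ⊢ :⊥) tt k (cong proj₁ h) (cong proj₂ h)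

    distinct34 : e3 ≢ e4
    distinct34 h = arith 1 0 (λ k → (nat (k :+ con 1)) :≡ᶻ (nat (k :+ k :+ con 2)) ⇒
        (nat (k :+ con 2)) :≡ᶻ (nat k :- nat k) ⇒ ⊢ :⊥) tt k (cong proj₁ h) (cong proj₂ h)

  isometric : KingIsometric (InH3 k k)
  isometric = stepping⇒isometric
    (transport-stepping
      (λ { (inj₁ (inj₁ (inj₁ (inj₁ h)))) → inj₁ h ; (inj₁ (inj₁ (inj₁ (inj₂ h)))) → inj₂ (inj₁ h)
         ; (inj₁ (inj₁ (inj₂ h))) → inj₂ (inj₂ (inj₁ h)) ; (inj₁ (inj₂ h)) → inj₂ (inj₂ (inj₂ (inj₁ h)))
         ; (inj₂ h) → inj₂ (inj₂ (inj₂ (inj₂ h))) })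
      (λ { (inj₁ h) → inj₁ (inj₁ (inj₁ (inj₁ h))) ; (inj₂ (inj₁ h)) → inj₁ (inj₁ (inj₁ (inj₂ h)))
         ; (inj₂ (inj₂ (inj₁ h))) → inj₁ (inj₁ (inj₂ h)) ; (inj₂ (inj₂ (inj₂ (inj₁ h)))) → inj₁ (inj₂ h)
         ; (inj₂ (inj₂ (inj₂ (inj₂ h)))) → inj₂ h })
      (adjoin-stepping (adjoin-stepping (adjoin-stepping (adjoin-stepping Box-stepping
        exit1)
        (exits-mono inj₁ (exits-⊎ exit2 exit21)))
        (exits-mono (inj₁ ∘ inj₁) (exits-⊎ (exits-⊎ exit3 exit31) exit32)))
        (exits-mono (inj₁ ∘ inj₁ ∘ inj₁) (exits-⊎ (exits-⊎ (exits-⊎ exit4 exit41) exit42) exit43))))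
    (⊎-prop Box-prop
      (⊎-prop point-prop
        (⊎-prop point-prop (⊎-prop point-prop point-prop (λ { _ refl h → distinct34 h }))
          (λ { _ refl (inj₁ h) → distinct23 h ; _ refl (inj₂ h) → distinct24 h }))
        (λ { _ refl (inj₁ h) → distinct12 h ; _ refl (inj₂ (inj₁ h)) →
            distinct13 h ; _ refl (inj₂ (inj₂ h)) → distinct14 h }))
      (λ { _ h (inj₁ refl) → outside1 h ; _ h (inj₂ (inj₁ refl)) → outside2 h
         ; _ h (inj₂ (inj₂ (inj₁ refl))) → outside3 h ; _ h (inj₂ (inj₂ (inj₂ refl))) → outside4 h }))

H₂-isometric : ∀ k → KingIsometric (InH2 k k)
H₂-isometric k = Extended₂.isometric k

H₃-isometric : ∀ k → KingIsometric (InH3 k k)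
H₃-isometric k = Extended₃.isometric k

-- Embedding regions of the king grid

data Axis : Set where
  horizontal vertical : Axis

coordinate : Axis → Point → ℤ
coordinate horizontal = proj₁
coordinate vertical   = proj₂

-- Cone α p q says that the king distance from p to q is the decrease of the coordinate α.
Cone : Axis → Point → Point → Set
Cone horizontal (x , y) (x′ , y′) = y ℤ.≤ y′ ℤ.+ (x ℤ.- x′) × y′ ℤ.≤ y ℤ.+ (x ℤ.- x′)
Cone vertical   (x , y) (x′ , y′) = x ℤ.≤ x′ ℤ.+ (y ℤ.- y′) × x′ ℤ.≤ x ℤ.+ (y ℤ.- y′)

:Cone : ∀ {n m} → Axis → (x y x′ y′ : IntTerm n m) → Formula n m
:Cone horizontal x y x′ y′ = y :≤ᶻ y′ :+ (x :- x′) :∧ y′ :≤ᶻ y :+ (x :- x′)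
:Cone vertical   x y x′ y′ = x :≤ᶻ x′ :+ (y :- y′) :∧ x′ :≤ᶻ x :+ (y :- y′)

opaque
  cone-kd : ∀ α p q → Cone α p q → + kd p q ≡ coordinate α p ℤ.- coordinate α q
  cone-kd horizontal p@(x , y) q@(x′ , y′) h = arith 1 4 (λ d x y x′ y′ →
    :Near x y x′ y′ d ⇒ :Attained x y x′ y′ d ⇒ :Cone horizontal x y x′ y′ ⇒ ⊢ nat d :≡ᶻ x :- x′)
    tt (kd p q) x y x′ y′ (kd-near p q) (kd-attained p q) h
  cone-kd vertical p@(x , y) q@(x′ , y′) h = arith 1 4 (λ d x y x′ y′ →
    :Near x y x′ y′ d ⇒ :Attained x y x′ y′ d ⇒ :Cone vertical x y x′ y′ ⇒ ⊢ nat d :≡ᶻ y :- y′)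
    tt (kd p q) x y x′ y′ (kd-near p q) (kd-attained p q) h

  cone-total : ∀ p q → ∃[ α ] (Cone α p q ⊎ Cone α q p)
  cone-total p@(x , y) q@(x′ , y′) with kd-attained p q | kd-near p q
  ... | inj₁ h | n = horizontal , arith 1 4 (λ d x y x′ y′ → x :≡ᶻ x′ :+ nat d :∨ x′ :≡ᶻ x :+ nat d ⇒
      :Near x y x′ y′ d ⇒
          ⊢ :Cone horizontal x y x′ y′ :∨ :Cone horizontal x′ y′ x y) tt (kd p q) x y x′ y′ h n
  ... | inj₂ h | n = vertical , arith 1 4 (λ d x y x′ y′ → y :≡ᶻ y′ :+ nat d :∨ y′ :≡ᶻ y :+ nat d ⇒
      :Near x y x′ y′ d ⇒
          ⊢ :Cone vertical x y x′ y′ :∨ :Cone vertical x′ y′ x y) tt (kd p q) x y x′ y′ h n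

  cone-trans : ∀ α p q r → Cone α p q → Cone α q r → Cone α p r
  cone-trans horizontal (x , y) (x′ , y′) (x″ , y″) = arith 0 6 (λ x y x′ y′ x″ y″ →
    :Cone horizontal x y x′ y′ ⇒ :Cone horizontal x′ y′ x″ y″ ⇒ ⊢ :Cone horizontal x y x″ y″) tt x y x′ y′ x″ y″
  cone-trans vertical (x , y) (x′ , y′) (x″ , y″) = arith 0 6 (λ x y x′ y′ x″ y″ →
    :Cone vertical x y x′ y′ ⇒ :Cone vertical x′ y′ x″ y″ ⇒ ⊢ :Cone vertical x y x″ y″) tt x y x′ y′ x″ y″

  -- Inside a cone the distance is the difference of one fixed coordinate, and such differences add
  -- up along a chain. So a chain of cones with the same axis is a geodesic.
  kd-cones : ∀ α p q r → Cone α p q → Cone α q r → kd p r ≡ kd p q + kd q r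
  kd-cones α p q r h k = ℤ.+-injective (trans (cone-kd α p r (cone-trans α p q r h k))
    (trans (telescope (coordinate α p) (coordinate α q) (coordinate α r))
      (sym (cong₂ ℤ._+_ (cone-kd α p q h) (cone-kd α q r k)))))
    where
    telescope : ∀ a b c → a ℤ.- c ≡ (a ℤ.- b) ℤ.+ (b ℤ.- c)
    telescope = solve-∀

-- Maps are extended along lists, so a whole square containing the region is listed. Zero appears
-- twice in `range`, which does no harm: a repeated point has distance 0 to itself and receives the
-- same image.
lattice : ℕ → List Point
lattice n = List.cartesianProduct range range
  where
  range : List ℤ
  range = List.map +_ (List.upTo (suc n)) ++ List.map (λ i → ℤ.- + i) (List.upTo (suc n))

∈-lattice : ∀ n {x y} → ∣ x ∣ ≤ n → ∣ y ∣ ≤ n → (x , y) ∈ lattice n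
∈-lattice n h k = ∈-cartesianProduct⁺ (∈-range _ h) (∈-range _ k)
  where
  ∈-range : ∀ x → ∣ x ∣ ≤ n → x ∈ (List.map +_ (List.upTo (suc n)) ++ List.map (λ i →
      ℤ.- + i) (List.upTo (suc n)))
  ∈-range (+ i)    h = ∈-++⁺ˡ (∈-map⁺ +_ (∈-upTo⁺ (s≤s h)))
  ∈-range -[1+ i ] h = ∈-++⁺ʳ (List.map +_ (List.upTo (suc n))) (∈-map⁺ (λ i → ℤ.- + i) (∈-upTo⁺ (s≤s h)))

Exact : (H : Graph) → List (Point × V H) → Set
Exact H P = ∀ {p z q w} → (p , z) ∈ P → (q , w) ∈ P → Dist H z w (kd p q)

exact₄ : ∀ {H p₀ p₁ p₂ p₃} {z₀ z₁ z₂ z₃ : V H} →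
  Dist H z₀ z₁ (kd p₀ p₁) → Dist H z₀ z₂ (kd p₀ p₂) → Dist H z₀ z₃ (kd p₀ p₃) →
  Dist H z₁ z₂ (kd p₁ p₂) → Dist H z₁ z₃ (kd p₁ p₃) → Dist H z₂ z₃ (kd p₂ p₃) →
  Exact H ((p₀ , z₀) ∷ (p₁ , z₁) ∷ (p₂ , z₂) ∷ (p₃ , z₃) ∷ [])
exact₄ {H} {p₀} {p₁} {p₂} {p₃} d₀₁ d₀₂ d₀₃ d₁₂ d₁₃ d₂₃ = go
  where
  self : ∀ p {z} → Dist H z z (kd p p)
  self p = subst (Dist H _ _) (sym (kd-refl p)) Dist-refl
  flip : ∀ p q {z w} → Dist H z w (kd p q) → Dist H w z (kd q p)
  flip p q d = subst (Dist H _ _) (kd-sym p q) (Dist-sym d)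
  go : Exact H _
  go (here refl) (here refl) = self p₀
  go (here refl) (there (here refl)) = d₀₁
  go (here refl) (there (there (here refl))) = d₀₂
  go (here refl) (there (there (there (here refl)))) = d₀₃
  go (there (here refl)) (here refl) = flip p₀ p₁ d₀₁
  go (there (here refl)) (there (here refl)) = self p₁
  go (there (here refl)) (there (there (here refl))) = d₁₂
  go (there (here refl)) (there (there (there (here refl)))) = d₁₃
  go (there (there (here refl))) (here refl) = flip p₀ p₂ d₀₂
  go (there (there (here refl))) (there (here refl)) = flip p₁ p₂ d₁₂
  go (there (there (here refl))) (there (there (here refl))) = self p₂
  go (there (there (here refl))) (there (there (there (here refl)))) = d₂₃
  go (there (there (there (here refl)))) (here refl) = flip p₀ p₃ d₀₃
  go (there (there (there (here refl)))) (there (here refl)) = flip p₁ p₃ d₁₃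
  go (there (there (there (here refl)))) (there (there (here refl))) = flip p₂ p₃ d₂₃
  go (there (there (there (here refl)))) (there (there (there (here refl)))) = self p₃

-- By `kd-cones`, `u` and `v` then lie in this order on a geodesic between two points of `P`.
Chain : List Point → Point → Point → Set
Chain P u v = ∃[ α ] ∃[ p ] ∃[ q ] (p ∈ P × q ∈ P × Cone α p u × Cone α u v × Cone α v q)

Spanned : List Point → (Point → Set) → Set
Spanned P R = ∀ {u v} → R u → R v → u ≡ v ⊎ Chain P u v ⊎ Chain P v u

module _ {H : Graph} (helly : Helly H) {P : List (Point × V H)} (exact : Exact H P)
  {R : Point → Set} (isometric : KingIsometric R)
  (N : ℕ) (bounded : ∀ {p} → R p → ∣ proj₁ p ∣ ≤ N × ∣ proj₂ p ∣ ≤ N)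
  (spanned : Spanned (List.map proj₁ P) R) where

  open Placement helly kd kd-refl kd-sym kd-triangle

  private
    placement : ∃[ P′ ] (Placed P′ × (∀ {i} → i ∈ P → i ∈ P′) × (∀ x → x ∈ lattice N → ∃[ z ] (x , z) ∈ P′))
    placement = extend (λ i j → _ , ℕ.≤-refl , exact i j) (lattice N)

    placed : Placed (proj₁ placement)
    placed = proj₁ (proj₂ placement)

    inj : ∀ {i} → i ∈ P → i ∈ proj₁ placement
    inj = proj₁ (proj₂ (proj₂ placement))

    image : (u : Σ Point R) → ∃[ z ] (proj₁ u , z) ∈ proj₁ placement
    image (p , r) = proj₂ (proj₂ (proj₂ placement)) p (∈-lattice N (proj₁ (bounded r)) (proj₂ (bounded r)))

    chain-distance : ∀ {u v z w} → Chain (List.map proj₁ P) u v →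
      (u , z) ∈ proj₁ placement → (v , w) ∈ proj₁ placement → Dist H z w (kd u v)
    chain-distance {u} {v} {z} {w} (α , p , q , i , j , pu , uv , vq) zi wi
      with ∈-map⁻ proj₁ i | ∈-map⁻ proj₁ j
    ... | (p , a) , i′ , refl | (q , b) , j′ , refl with placed (inj i′) zi | placed zi wi | placed wi (inj j′)
    ...   | near | m , m≤ , d | near′ = subst (Dist H z w) (Dist-path (kd p u) (kd u v) (kd v q)
            (subst (Dist H a b) pq≡ (exact i′ j′)) near (m , m≤ , d) near′ d) d
      where
      pq≡ : kd p q ≡ kd p u + kd u v + kd v q
      pq≡ = trans (kd-cones α p v q (cone-trans α p u v pu uv) vq) (cong (_+ kd v q) (kd-cones α p u v pu uv))

  embed : ContainsIsometric H (KingSub R)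
  embed = φ , λ u v k →
      (λ d → subst (Dist H (φ u) (φ v)) (Dist-unique (isometric u v) d) (dist u v))
    , (λ d → subst (Dist (KingSub R) u v) (Dist-unique (dist u v) d) (isometric u v))
    where
    φ : Σ Point R → V H
    φ u = proj₁ (image u)
    dist : ∀ u v → Dist H (φ u) (φ v) (kd (proj₁ u) (proj₁ v))
    dist u v with spanned (proj₂ u) (proj₂ v)
    ... | inj₂ (inj₁ c) = chain-distance c (proj₂ (image u)) (proj₂ (image v))
    ... | inj₂ (inj₂ c) = subst (Dist H (φ u) (φ v)) (kd-sym (proj₁ v) (proj₁ u))
                            (Dist-sym (chain-distance c (proj₂ (image v)) (proj₂ (image u))))
    ... | inj₁ refl with placed (proj₂ (image u)) (proj₂ (image v))
    ...   | m , m≤ , d = subst (Dist H (φ u) (φ v)) (ℕ.≤-antisym m≤ (subst (_≤ m)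
        (sym (kd-refl (proj₁ u))) z≤n)) d

-- Coordinates for four points beyond the corners of a region

abs-bounds : ∀ n {x y} → (x ℤ.≤ + n × ℤ.- (+ n) ℤ.≤ x) × (y ℤ.≤ + n × ℤ.- (+ n) ℤ.≤ y) → ∣ x ∣ ≤ n × ∣ y ∣ ≤ n
abs-bounds n ((a , b) , (c , d)) = abs-bound _ a b , abs-bound _ c d
  where
  abs-bound : ∀ x → x ℤ.≤ + n → ℤ.- (+ n) ℤ.≤ x → ∣ x ∣ ≤ n
  abs-bound (+ i)    (ℤ.+≤+ h) _ = h
  abs-bound -[1+ i ] _         h = ℤ.drop‿+≤+ (subst (+ suc i ℤ.≤_) (ℤ.neg-involutive (+ n)) (ℤ.neg-mono-≤ h))

-- A diamond with `D = 2 * k`, where X is `A + k` and Z is `C + k`: b and d sit on corners of the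
-- region, while a and c lie A to the left and C to the right of the other two.
module Span₁ (k A C : ℕ) where
  aᶜ : Point
  aᶜ = (ℤ.- (+ A) , + 0)
  bᶜ : Point
  bᶜ = (+ k , ℤ.- (+ k))
  cᶜ : Point
  cᶜ = (+ (2 * k + C) , + 0)
  dᶜ : Point
  dᶜ = (+ k , + k)

  corners : List Point
  corners = aᶜ ∷ bᶜ ∷ cᶜ ∷ dᶜ ∷ []

  Core : Point → Set
  Core = Box (+ 0) (+ (2 * k)) (+ 0) (+ (2 * k))

  opaque
    kd-ab : kd aᶜ bᶜ ≡ A + k
    kd-ab = kd-≡ aᶜ bᶜ (A + k)
      (arith 3 0 (λ k A C → ⊢ :Near (:- nat A) (con (+ 0)) (nat k) ((:- nat k)) (A :+ k)) tt k A C)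
      (arith 3 0 (λ k A C → ⊢ :Attained (:- nat A) (con (+ 0)) (nat k) ((:- nat k)) (A :+ k)) tt k A C)

    kd-ac : kd aᶜ cᶜ ≡ A + k + (C + k)
    kd-ac = kd-≡ aᶜ cᶜ (A + k + (C + k))
      (arith 3 0 (λ k A C → ⊢ :Near (:- nat A) (con (+ 0)) (nat (2 :* k :+ C)) (con (+ 0))
          (A :+ k :+ (C :+ k))) tt k A C)
      (arith 3 0 (λ k A C → ⊢ :Attained (:- nat A) (con (+ 0)) (nat (2 :* k :+ C)) (con (+ 0))
          (A :+ k :+ (C :+ k))) tt k A C)

    kd-ad : kd aᶜ dᶜ ≡ A + k
    kd-ad = kd-≡ aᶜ dᶜ (A + k)
      (arith 3 0 (λ k A C → ⊢ :Near (:- nat A) (con (+ 0)) (nat k) (nat k) (A :+ k)) tt k A C)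
      (arith 3 0 (λ k A C → ⊢ :Attained (:- nat A) (con (+ 0)) (nat k) (nat k) (A :+ k)) tt k A C)

    kd-bc : kd bᶜ cᶜ ≡ C + k
    kd-bc = kd-≡ bᶜ cᶜ (C + k)
      (arith 3 0 (λ k A C → ⊢ :Near (nat k) ((:- nat k)) (nat (2 :* k :+ C)) (con (+ 0)) (C :+ k)) tt k A C)
      (arith 3 0 (λ k A C → ⊢ :Attained (nat k) ((:- nat k)) (nat (2 :* k :+ C)) (con (+ 0)) (C :+ k)) tt k A C)

    kd-bd : kd bᶜ dᶜ ≡ 2 * k
    kd-bd = kd-≡ bᶜ dᶜ (2 * k)
      (arith 3 0 (λ k A C → ⊢ :Near (nat k) ((:- nat k)) (nat k) (nat k) (2 :* k)) tt k A C)
      (arith 3 0 (λ k A C → ⊢ :Attained (nat k) ((:- nat k)) (nat k) (nat k) (2 :* k)) tt k A C)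

    kd-cd : kd cᶜ dᶜ ≡ C + k
    kd-cd = kd-≡ cᶜ dᶜ (C + k)
      (arith 3 0 (λ k A C → ⊢ :Near (nat (2 :* k :+ C)) (con (+ 0)) (nat k) (nat k) (C :+ k)) tt k A C)
      (arith 3 0 (λ k A C → ⊢ :Attained (nat (2 :* k :+ C)) (con (+ 0)) (nat k) (nat k) (C :+ k)) tt k A C)

    right : ∀ u → Core u → Cone horizontal cᶜ u
    right (x , y) = arith 3 2 (λ k A C x y →
        :Box (con (+ 0)) (nat (2 :* k)) (con (+ 0)) (nat (2 :* k)) x y ⇒
        ⊢ :Cone horizontal (nat (2 :* k :+ C)) (con (+ 0)) x y) tt k A C x y

    left : ∀ u → Core u → Cone horizontal u aᶜ
    left (x , y) = arith 3 2 (λ k A C x y →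
        :Box (con (+ 0)) (nat (2 :* k)) (con (+ 0)) (nat (2 :* k)) x y ⇒
        ⊢ :Cone horizontal x y (:- nat A) (con (+ 0))) tt k A C x y

    top : ∀ u → Core u → Cone vertical dᶜ u
    top (x , y) = arith 3 2 (λ k A C x y → :Box (con (+ 0)) (nat (2 :* k)) (con (+ 0)) (nat (2 :* k)) x y ⇒
        ⊢ :Cone vertical (nat k) (nat k) x y) tt k A C x y

    bottom : ∀ u → Core u → Cone vertical u bᶜ
    bottom (x , y) = arith 3 2 (λ k A C x y →
        :Box (con (+ 0)) (nat (2 :* k)) (con (+ 0)) (nat (2 :* k)) x y ⇒
        ⊢ :Cone vertical x y (nat k) ((:- nat k))) tt k A C x y

  core-spanned : ∀ {u v} → Core u → Core v → Chain corners u v ⊎ Chain corners v u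
  core-spanned {u} {v} U V with cone-total u v
  ... | horizontal , inj₁ h = inj₁ (horizontal , _ , _ , there (there (here refl)) , here refl
      , right u U , h , left v V)
  ... | horizontal , inj₂ h = inj₂ (horizontal , _ , _ , there (there (here refl)) , here refl
      , right v V , h , left u U)
  ... | vertical , inj₁ h = inj₁ (vertical , _ , _ , there (there (there (here refl)))
      , there (here refl) , top u U , h , bottom v V)
  ... | vertical , inj₂ h = inj₂ (vertical , _ , _ , there (there (there (here refl)))
      , there (here refl) , top v V , h , bottom u U)

  spanned : Spanned corners (InH1 k k)
  spanned U V = inj₂ (core-spanned U V)

  bounded : ∀ {p} → (InH1 k k) p → ∣ proj₁ p ∣ ≤ (2 * k) × ∣ proj₂ p ∣ ≤ (2 * k)
  bounded {x , y} U = abs-bounds (2 * k) (arith 1 2 (λ k x y →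
      :Box (con (+ 0)) (nat (2 :* k)) (con (+ 0)) (nat (2 :* k)) x y ⇒ ⊢ (x :≤ᶻ nat (2 :* k) :∧
      (:- nat (2 :* k)) :≤ᶻ x) :∧ (y :≤ᶻ nat (2 :* k) :∧ (:- nat (2 :* k)) :≤ᶻ y)) tt k x y U)

-- A diamond with `D = 2 * k + 1`. The vertical diagonal from `- k` to `k + 1` has no middle, so a
-- is put in row 0 and c in row 1. Since X and Z are at least half of `D`, integrality makes them at
-- least `k + 1`, and this rounding leaves room for the added points `e1` and `e2`.
module Span₂ (k A C : ℕ) where
  aᶜ : Point
  aᶜ = (-1ℤ ℤ.- + A , + 0)
  bᶜ : Point
  bᶜ = (+ k , ℤ.- (+ k))
  cᶜ : Point
  cᶜ = (+ (2 * k + 1 + C) , + 1)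
  dᶜ : Point
  dᶜ = (+ k , + (k + 1))

  corners : List Point
  corners = aᶜ ∷ bᶜ ∷ cᶜ ∷ dᶜ ∷ []

  open Extended₂ k using (Core; e1; e2)

  opaque
    kd-ab : kd aᶜ bᶜ ≡ A + (k + 1)
    kd-ab = kd-≡ aᶜ bᶜ (A + (k + 1))
      (arith 3 0 (λ k A C → ⊢ :Near (con -1ℤ :- nat A) (con (+ 0)) (nat k) ((:- nat k))
          (A :+ (k :+ con 1))) tt k A C)
      (arith 3 0 (λ k A C → ⊢ :Attained (con -1ℤ :- nat A) (con (+ 0)) (nat k) ((:- nat k))
          (A :+ (k :+ con 1))) tt k A C)

    kd-ac : kd aᶜ cᶜ ≡ A + (k + 1) + (C + (k + 1))
    kd-ac = kd-≡ aᶜ cᶜ (A + (k + 1) + (C + (k + 1)))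
      (arith 3 0 (λ k A C → ⊢ :Near (con -1ℤ :- nat A) (con (+ 0)) (nat (2 :* k :+ con 1 :+ C))
          (con (+ 1)) (A :+ (k :+ con 1) :+ (C :+ (k :+ con 1)))) tt k A C)
      (arith 3 0 (λ k A C → ⊢ :Attained (con -1ℤ :- nat A) (con (+ 0)) (nat (2 :* k :+ con 1 :+ C))
          (con (+ 1)) (A :+ (k :+ con 1) :+ (C :+ (k :+ con 1)))) tt k A C)

    kd-ad : kd aᶜ dᶜ ≡ A + (k + 1)
    kd-ad = kd-≡ aᶜ dᶜ (A + (k + 1))
      (arith 3 0 (λ k A C → ⊢ :Near (con -1ℤ :- nat A) (con (+ 0)) (nat k) (nat (k :+ con 1))
          (A :+ (k :+ con 1))) tt k A C)
      (arith 3 0 (λ k A C → ⊢ :Attained (con -1ℤ :- nat A) (con (+ 0)) (nat k) (nat (k :+ con 1))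
          (A :+ (k :+ con 1))) tt k A C)

    kd-bc : kd bᶜ cᶜ ≡ C + (k + 1)
    kd-bc = kd-≡ bᶜ cᶜ (C + (k + 1))
      (arith 3 0 (λ k A C → ⊢ :Near (nat k) ((:- nat k)) (nat (2 :* k :+ con 1 :+ C)) (con (+ 1))
          (C :+ (k :+ con 1))) tt k A C)
      (arith 3 0 (λ k A C → ⊢ :Attained (nat k) ((:- nat k)) (nat (2 :* k :+ con 1 :+ C)) (con (+ 1))
          (C :+ (k :+ con 1))) tt k A C)

    kd-bd : kd bᶜ dᶜ ≡ 2 * k + 1
    kd-bd = kd-≡ bᶜ dᶜ (2 * k + 1)
      (arith 3 0 (λ k A C → ⊢ :Near (nat k) ((:- nat k)) (nat k) (nat (k :+ con 1)) (2 :* k :+ con 1)) tt k A C)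
      (arith 3 0 (λ k A C → ⊢ :Attained (nat k) ((:- nat k)) (nat k) (nat (k :+ con 1))
          (2 :* k :+ con 1)) tt k A C)

    kd-cd : kd cᶜ dᶜ ≡ C + (k + 1)
    kd-cd = kd-≡ cᶜ dᶜ (C + (k + 1))
      (arith 3 0 (λ k A C → ⊢ :Near (nat (2 :* k :+ con 1 :+ C)) (con (+ 1)) (nat k) (nat (k :+ con 1))
          (C :+ (k :+ con 1))) tt k A C)
      (arith 3 0 (λ k A C → ⊢ :Attained (nat (2 :* k :+ con 1 :+ C)) (con (+ 1)) (nat k)
          (nat (k :+ con 1)) (C :+ (k :+ con 1))) tt k A C)

    right : ∀ u → Core u → Cone horizontal cᶜ u
    right (x , y) = arith 3 2 (λ k A C x y →
        :Box (con (+ 0)) (nat (2 :* k :+ con 1)) (con -1ℤ) (nat (2 :* k)) x y ⇒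
        ⊢ :Cone horizontal (nat (2 :* k :+ con 1 :+ C)) (con (+ 1)) x y) tt k A C x y

    left : ∀ u → Core u → Cone horizontal u aᶜ
    left (x , y) = arith 3 2 (λ k A C x y →
        :Box (con (+ 0)) (nat (2 :* k :+ con 1)) (con -1ℤ) (nat (2 :* k)) x y ⇒
        ⊢ :Cone horizontal x y (con -1ℤ :- nat A) (con (+ 0))) tt k A C x y

    top : ∀ u → Core u → Cone vertical dᶜ u
    top (x , y) = arith 3 2 (λ k A C x y →
        :Box (con (+ 0)) (nat (2 :* k :+ con 1)) (con -1ℤ) (nat (2 :* k)) x y ⇒
        ⊢ :Cone vertical (nat k) (nat (k :+ con 1)) x y) tt k A C x y

    bottom : ∀ u → Core u → Cone vertical u bᶜ
    bottom (x , y) = arith 3 2 (λ k A C x y →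
        :Box (con (+ 0)) (nat (2 :* k :+ con 1)) (con -1ℤ) (nat (2 :* k)) x y ⇒
        ⊢ :Cone vertical x y (nat k) ((:- nat k))) tt k A C x y

    to1 : ∀ u → Core u → Cone horizontal u e1
    to1 (x , y) = arith 3 2 (λ k A C x y →
        :Box (con (+ 0)) (nat (2 :* k :+ con 1)) (con -1ℤ) (nat (2 :* k)) x y ⇒
        ⊢ :Cone horizontal x y (con -1ℤ) (con (+ 0))) tt k A C x y

    from2 : ∀ u → Core u → Cone horizontal e2 u
    from2 (x , y) = arith 3 2 (λ k A C x y →
        :Box (con (+ 0)) (nat (2 :* k :+ con 1)) (con -1ℤ) (nat (2 :* k)) x y ⇒
        ⊢ :Cone horizontal (nat (k :+ k :+ con 1)) ((nat k :- nat k) :+ con (+ 1)) x y) tt k A C x y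

    hend1 : Cone horizontal e1 aᶜ
    hend1 = arith 3 0 (λ k A C → ⊢ :Cone horizontal (con -1ℤ) (con (+ 0)) (con -1ℤ :- nat A)
        (con (+ 0))) tt k A C

    hstart2 : Cone horizontal cᶜ e2
    hstart2 = arith 3 0 (λ k A C →
        ⊢ :Cone horizontal (nat (2 :* k :+ con 1 :+ C)) (con (+ 1)) (nat (k :+ k :+ con 1))
        ((nat k :- nat k) :+ con (+ 1))) tt k A C

    pair21 : Cone horizontal e2 e1
    pair21 = arith 3 0 (λ k A C →
        ⊢ :Cone horizontal (nat (k :+ k :+ con 1)) ((nat k :- nat k) :+ con (+ 1)) (con -1ℤ)
        (con (+ 0))) tt k A C

  core-spanned : ∀ {u v} → Core u → Core v → Chain corners u v ⊎ Chain corners v u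
  core-spanned {u} {v} U V with cone-total u v
  ... | horizontal , inj₁ h = inj₁ (horizontal , _ , _ , there (there (here refl)) , here refl
      , right u U , h , left v V)
  ... | horizontal , inj₂ h = inj₂ (horizontal , _ , _ , there (there (here refl)) , here refl
      , right v V , h , left u U)
  ... | vertical , inj₁ h = inj₁ (vertical , _ , _ , there (there (there (here refl)))
      , there (here refl) , top u U , h , bottom v V)
  ... | vertical , inj₂ h = inj₂ (vertical , _ , _ , there (there (there (here refl)))
      , there (here refl) , top v V , h , bottom u U)

  spanned : Spanned corners (InH2 k k)
  spanned (inj₁ U) (inj₁ V) = inj₂ (core-spanned U V)
  spanned {u} (inj₁ U) (inj₂ (inj₁ refl)) =
      inj₂ (inj₁ (horizontal , _ , _ , there (there (here refl)) , here refl , right u U , to1 u U , hend1))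
  spanned {v = v} (inj₂ (inj₁ refl)) (inj₁ V) =
      inj₂ (inj₂ (horizontal , _ , _ , there (there (here refl)) , here refl , right v V , to1 v V , hend1))
  spanned (inj₂ (inj₁ refl)) (inj₂ (inj₁ refl)) = inj₁ refl
  spanned {u} (inj₁ U) (inj₂ (inj₂ refl)) =
      inj₂ (inj₂ (horizontal , _ , _ , there (there (here refl)) , here refl , hstart2 , from2 u U , left u U))
  spanned {v = v} (inj₂ (inj₂ refl)) (inj₁ V) =
      inj₂ (inj₁ (horizontal , _ , _ , there (there (here refl)) , here refl , hstart2 , from2 v V , left v V))
  spanned (inj₂ (inj₂ refl)) (inj₂ (inj₂ refl)) = inj₁ refl
  spanned (inj₂ (inj₂ refl)) (inj₂ (inj₁ refl)) =
      inj₂ (inj₁ (horizontal , _ , _ , there (there (here refl)) , here refl , hstart2 , pair21 , hend1))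
  spanned (inj₂ (inj₁ refl)) (inj₂ (inj₂ refl)) =
      inj₂ (inj₂ (horizontal , _ , _ , there (there (here refl)) , here refl , hstart2 , pair21 , hend1))

  bounded : ∀ {p} → (InH2 k k) p → ∣ proj₁ p ∣ ≤ (2 * k + 1) × ∣ proj₂ p ∣ ≤ (2 * k + 1)
  bounded {x , y} (inj₁ U) = abs-bounds (2 * k + 1) (arith 1 2 (λ k x y →
      :Box (con (+ 0)) (nat (2 :* k :+ con 1)) (con -1ℤ) (nat (2 :* k)) x y ⇒
      ⊢ (x :≤ᶻ nat (2 :* k :+ con 1) :∧ (:- nat (2 :* k :+ con 1)) :≤ᶻ x) :∧
      (y :≤ᶻ nat (2 :* k :+ con 1) :∧ (:- nat (2 :* k :+ con 1)) :≤ᶻ y)) tt k x y U)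
  bounded (inj₂ (inj₁ refl)) = abs-bounds (2 * k + 1) (arith 1 0 (λ k →
      ⊢ ((con -1ℤ) :≤ᶻ nat (2 :* k :+ con 1) :∧ (:- nat (2 :* k :+ con 1)) :≤ᶻ (con -1ℤ)) :∧
      ((con (+ 0)) :≤ᶻ nat (2 :* k :+ con 1) :∧ (:- nat (2 :* k :+ con 1)) :≤ᶻ (con (+ 0)))) tt k )
  bounded (inj₂ (inj₂ refl)) = abs-bounds (2 * k + 1) (arith 1 0 (λ k →
      ⊢ ((nat (k :+ k :+ con 1)) :≤ᶻ nat (2 :* k :+ con 1) :∧
      (:- nat (2 :* k :+ con 1)) :≤ᶻ (nat (k :+ k :+ con 1))) :∧
      (((nat k :- nat k) :+ con (+ 1)) :≤ᶻ nat (2 :* k :+ con 1) :∧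
      (:- nat (2 :* k :+ con 1)) :≤ᶻ ((nat k :- nat k) :+ con (+ 1)))) tt k )

-- Each point lies beyond its corner along a grid diagonal: A down left, B up left, C up right, E
-- down right. Thus each of these amounts contributes fully to all three distances from its point,
-- and a chain along either axis can be continued from a corner to the point beyond it.
module Span₃ (k A B C E : ℕ) where
  aᶜ : Point
  aᶜ = (+ k ℤ.- + A , ℤ.- + (k + 1 + A))
  bᶜ : Point
  bᶜ = (-1ℤ ℤ.- + B , + (1 + B))
  cᶜ : Point
  cᶜ = (+ (k + 1 + C) , + (k + 2 + C))
  dᶜ : Point
  dᶜ = (+ (2 * k + 2 + E) , ℤ.- (+ E))

  corners : List Point
  corners = aᶜ ∷ bᶜ ∷ cᶜ ∷ dᶜ ∷ []

  open Extended₃ k using (Core; e1; e2; e3; e4)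

  opaque
    kd-ab : kd aᶜ bᶜ ≡ A + B + k + 2
    kd-ab = kd-≡ aᶜ bᶜ (A + B + k + 2)
      (arith 5 0 (λ k A B C E → ⊢ :Near (nat k :- nat A) (:- nat (k :+ con 1 :+ A)) (con -1ℤ :- nat B)
          (nat (con 1 :+ B)) (A :+ B :+ k :+ con 2)) tt k A B C E)
      (arith 5 0 (λ k A B C E → ⊢ :Attained (nat k :- nat A) (:- nat (k :+ con 1 :+ A)) (con -1ℤ :- nat B)
          (nat (con 1 :+ B)) (A :+ B :+ k :+ con 2)) tt k A B C E)

    kd-ac : kd aᶜ cᶜ ≡ A + C + 2 * k + 3
    kd-ac = kd-≡ aᶜ cᶜ (A + C + 2 * k + 3)
      (arith 5 0 (λ k A B C E → ⊢ :Near (nat k :- nat A) (:- nat (k :+ con 1 :+ A))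
          (nat (k :+ con 1 :+ C)) (nat (k :+ con 2 :+ C)) (A :+ C :+ 2 :* k :+ con 3)) tt k A B C E)
      (arith 5 0 (λ k A B C E → ⊢ :Attained (nat k :- nat A) (:- nat (k :+ con 1 :+ A))
          (nat (k :+ con 1 :+ C)) (nat (k :+ con 2 :+ C)) (A :+ C :+ 2 :* k :+ con 3)) tt k A B C E)

    kd-ad : kd aᶜ dᶜ ≡ E + A + k + 2
    kd-ad = kd-≡ aᶜ dᶜ (E + A + k + 2)
      (arith 5 0 (λ k A B C E → ⊢ :Near (nat k :- nat A) (:- nat (k :+ con 1 :+ A))
          (nat (2 :* k :+ con 2 :+ E)) (:- nat E) (E :+ A :+ k :+ con 2)) tt k A B C E)
      (arith 5 0 (λ k A B C E → ⊢ :Attained (nat k :- nat A) (:- nat (k :+ con 1 :+ A))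
          (nat (2 :* k :+ con 2 :+ E)) (:- nat E) (E :+ A :+ k :+ con 2)) tt k A B C E)

    kd-bc : kd bᶜ cᶜ ≡ B + C + k + 2
    kd-bc = kd-≡ bᶜ cᶜ (B + C + k + 2)
      (arith 5 0 (λ k A B C E → ⊢ :Near (con -1ℤ :- nat B) (nat (con 1 :+ B)) (nat (k :+ con 1 :+ C))
          (nat (k :+ con 2 :+ C)) (B :+ C :+ k :+ con 2)) tt k A B C E)
      (arith 5 0 (λ k A B C E → ⊢ :Attained (con -1ℤ :- nat B) (nat (con 1 :+ B)) (nat (k :+ con 1 :+ C))
          (nat (k :+ con 2 :+ C)) (B :+ C :+ k :+ con 2)) tt k A B C E)

    kd-bd : kd bᶜ dᶜ ≡ B + E + 2 * k + 3
    kd-bd = kd-≡ bᶜ dᶜ (B + E + 2 * k + 3)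
      (arith 5 0 (λ k A B C E → ⊢ :Near (con -1ℤ :- nat B) (nat (con 1 :+ B)) (nat (2 :* k :+ con 2 :+ E))
          (:- nat E) (B :+ E :+ 2 :* k :+ con 3)) tt k A B C E)
      (arith 5 0 (λ k A B C E → ⊢ :Attained (con -1ℤ :- nat B) (nat (con 1 :+ B))
          (nat (2 :* k :+ con 2 :+ E)) (:- nat E) (B :+ E :+ 2 :* k :+ con 3)) tt k A B C E)

    kd-cd : kd cᶜ dᶜ ≡ C + E + k + 2
    kd-cd = kd-≡ cᶜ dᶜ (C + E + k + 2)
      (arith 5 0 (λ k A B C E → ⊢ :Near (nat (k :+ con 1 :+ C)) (nat (k :+ con 2 :+ C))
          (nat (2 :* k :+ con 2 :+ E)) (:- nat E) (C :+ E :+ k :+ con 2)) tt k A B C E)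
      (arith 5 0 (λ k A B C E → ⊢ :Attained (nat (k :+ con 1 :+ C)) (nat (k :+ con 2 :+ C))
          (nat (2 :* k :+ con 2 :+ E)) (:- nat E) (C :+ E :+ k :+ con 2)) tt k A B C E)

    right : ∀ u → Core u → Cone horizontal dᶜ u
    right (x , y) = arith 5 2 (λ k A B C E x y →
        :Box (con (+ 0)) (nat (2 :* k :+ con 2)) (con -1ℤ) (nat (2 :* k :+ con 1)) x y ⇒
        ⊢ :Cone horizontal (nat (2 :* k :+ con 2 :+ E)) (:- nat E) x y) tt k A B C E x y

    left : ∀ u → Core u → Cone horizontal u bᶜ
    left (x , y) = arith 5 2 (λ k A B C E x y →
        :Box (con (+ 0)) (nat (2 :* k :+ con 2)) (con -1ℤ) (nat (2 :* k :+ con 1)) x y ⇒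
        ⊢ :Cone horizontal x y (con -1ℤ :- nat B) (nat (con 1 :+ B))) tt k A B C E x y

    top : ∀ u → Core u → Cone vertical cᶜ u
    top (x , y) = arith 5 2 (λ k A B C E x y →
        :Box (con (+ 0)) (nat (2 :* k :+ con 2)) (con -1ℤ) (nat (2 :* k :+ con 1)) x y ⇒
        ⊢ :Cone vertical (nat (k :+ con 1 :+ C)) (nat (k :+ con 2 :+ C)) x y) tt k A B C E x y

    bottom : ∀ u → Core u → Cone vertical u aᶜ
    bottom (x , y) = arith 5 2 (λ k A B C E x y →
        :Box (con (+ 0)) (nat (2 :* k :+ con 2)) (con -1ℤ) (nat (2 :* k :+ con 1)) x y ⇒
        ⊢ :Cone vertical x y (nat k :- nat A) (:- nat (k :+ con 1 :+ A))) tt k A B C E x y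

    to1 : ∀ u → Core u → Cone vertical u e1
    to1 (x , y) = arith 5 2 (λ k A B C E x y →
        :Box (con (+ 0)) (nat (2 :* k :+ con 2)) (con -1ℤ) (nat (2 :* k :+ con 1)) x y ⇒
        ⊢ :Cone vertical x y (nat k) ((:- nat k) :- con (+ 1))) tt k A B C E x y

    to2 : ∀ u → Core u → Cone horizontal u e2
    to2 (x , y) = arith 5 2 (λ k A B C E x y →
        :Box (con (+ 0)) (nat (2 :* k :+ con 2)) (con -1ℤ) (nat (2 :* k :+ con 1)) x y ⇒
        ⊢ :Cone horizontal x y (con -1ℤ) (con (+ 1))) tt k A B C E x y

    from3 : ∀ u → Core u → Cone vertical e3 u
    from3 (x , y) = arith 5 2 (λ k A B C E x y →
        :Box (con (+ 0)) (nat (2 :* k :+ con 2)) (con -1ℤ) (nat (2 :* k :+ con 1)) x y ⇒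
        ⊢ :Cone vertical (nat (k :+ con 1)) (nat (k :+ con 2)) x y) tt k A B C E x y

    from4 : ∀ u → Core u → Cone horizontal e4 u
    from4 (x , y) = arith 5 2 (λ k A B C E x y →
        :Box (con (+ 0)) (nat (2 :* k :+ con 2)) (con -1ℤ) (nat (2 :* k :+ con 1)) x y ⇒
        ⊢ :Cone horizontal (nat (k :+ k :+ con 2)) (nat k :- nat k) x y) tt k A B C E x y

    hend1 : Cone horizontal e1 aᶜ
    hend1 = arith 5 0 (λ k A B C E →
        ⊢ :Cone horizontal (nat k) ((:- nat k) :- con (+ 1)) (nat k :- nat A)
        (:- nat (k :+ con 1 :+ A))) tt k A B C E

    vend1 : Cone vertical e1 aᶜ
    vend1 = arith 5 0 (λ k A B C E →
        ⊢ :Cone vertical (nat k) ((:- nat k) :- con (+ 1)) (nat k :- nat A) (:- nat (k :+ con 1 :+ A)))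
        tt k A B C E

    hend2 : Cone horizontal e2 bᶜ
    hend2 = arith 5 0 (λ k A B C E →
        ⊢ :Cone horizontal (con -1ℤ) (con (+ 1)) (con -1ℤ :- nat B) (nat (con 1 :+ B))) tt k A B C E

    vstart2 : Cone vertical bᶜ e2
    vstart2 = arith 5 0 (λ k A B C E →
        ⊢ :Cone vertical (con -1ℤ :- nat B) (nat (con 1 :+ B)) (con -1ℤ) (con (+ 1))) tt k A B C E

    hstart3 : Cone horizontal cᶜ e3
    hstart3 = arith 5 0 (λ k A B C E →
        ⊢ :Cone horizontal (nat (k :+ con 1 :+ C)) (nat (k :+ con 2 :+ C)) (nat (k :+ con 1))
        (nat (k :+ con 2))) tt k A B C E

    vstart3 : Cone vertical cᶜ e3
    vstart3 = arith 5 0 (λ k A B C E →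
        ⊢ :Cone vertical (nat (k :+ con 1 :+ C)) (nat (k :+ con 2 :+ C)) (nat (k :+ con 1))
        (nat (k :+ con 2))) tt k A B C E

    hstart4 : Cone horizontal dᶜ e4
    hstart4 = arith 5 0 (λ k A B C E →
        ⊢ :Cone horizontal (nat (2 :* k :+ con 2 :+ E)) (:- nat E) (nat (k :+ k :+ con 2))
        (nat k :- nat k)) tt k A B C E

    vend4 : Cone vertical e4 dᶜ
    vend4 = arith 5 0 (λ k A B C E →
        ⊢ :Cone vertical (nat (k :+ k :+ con 2)) (nat k :- nat k) (nat (2 :* k :+ con 2 :+ E))
        (:- nat E)) tt k A B C E

    pair21 : Cone vertical e2 e1
    pair21 = arith 5 0 (λ k A B C E →
        ⊢ :Cone vertical (con -1ℤ) (con (+ 1)) (nat k) ((:- nat k) :- con (+ 1))) tt k A B C E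

    pair31 : Cone vertical e3 e1
    pair31 = arith 5 0 (λ k A B C E →
        ⊢ :Cone vertical (nat (k :+ con 1)) (nat (k :+ con 2)) (nat k) ((:- nat k) :- con (+ 1))) tt k A B C E

    pair41 : Cone horizontal e4 e1
    pair41 = arith 5 0 (λ k A B C E →
        ⊢ :Cone horizontal (nat (k :+ k :+ con 2)) (nat k :- nat k) (nat k) ((:- nat k) :- con (+ 1)))
        tt k A B C E

    pair32 : Cone horizontal e3 e2
    pair32 = arith 5 0 (λ k A B C E →
        ⊢ :Cone horizontal (nat (k :+ con 1)) (nat (k :+ con 2)) (con -1ℤ) (con (+ 1))) tt k A B C E

    pair42 : Cone horizontal e4 e2
    pair42 = arith 5 0 (λ k A B C E →
        ⊢ :Cone horizontal (nat (k :+ k :+ con 2)) (nat k :- nat k) (con -1ℤ) (con (+ 1))) tt k A B C E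

    pair34 : Cone vertical e3 e4
    pair34 = arith 5 0 (λ k A B C E →
        ⊢ :Cone vertical (nat (k :+ con 1)) (nat (k :+ con 2)) (nat (k :+ k :+ con 2)) (nat k :- nat k))
        tt k A B C E

  core-spanned : ∀ {u v} → Core u → Core v → Chain corners u v ⊎ Chain corners v u
  core-spanned {u} {v} U V with cone-total u v
  ... | horizontal , inj₁ h = inj₁ (horizontal , _ , _ , there (there (there (here refl)))
      , there (here refl) , right u U , h , left v V)
  ... | horizontal , inj₂ h = inj₂ (horizontal , _ , _ , there (there (there (here refl)))
      , there (here refl) , right v V , h , left u U)
  ... | vertical , inj₁ h = inj₁ (vertical , _ , _ , there (there (here refl)) , here refl , top u U , h
      , bottom v V)
  ... | vertical , inj₂ h = inj₂ (vertical , _ , _ , there (there (here refl)) , here refl , top v V , h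
      , bottom u U)

  spanned : Spanned corners (InH3 k k)
  spanned (inj₁ U) (inj₁ V) = inj₂ (core-spanned U V)
  spanned {u} (inj₁ U) (inj₂ (inj₁ refl)) =
      inj₂ (inj₁ (vertical , _ , _ , there (there (here refl)) , here refl , top u U , to1 u U , vend1))
  spanned {v = v} (inj₂ (inj₁ refl)) (inj₁ V) =
      inj₂ (inj₂ (vertical , _ , _ , there (there (here refl)) , here refl , top v V , to1 v V , vend1))
  spanned (inj₂ (inj₁ refl)) (inj₂ (inj₁ refl)) = inj₁ refl
  spanned {u} (inj₁ U) (inj₂ (inj₂ (inj₁ refl))) =
      inj₂ (inj₁ (horizontal , _ , _ , there (there (there (here refl))) , there (here refl) , right u U
      , to2 u U , hend2))
  spanned {v = v} (inj₂ (inj₂ (inj₁ refl))) (inj₁ V) =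
      inj₂ (inj₂ (horizontal , _ , _ , there (there (there (here refl))) , there (here refl) , right v V
      , to2 v V , hend2))
  spanned (inj₂ (inj₂ (inj₁ refl))) (inj₂ (inj₂ (inj₁ refl))) = inj₁ refl
  spanned {u} (inj₁ U) (inj₂ (inj₂ (inj₂ (inj₁ refl)))) =
      inj₂ (inj₂ (vertical , _ , _ , there (there (here refl)) , here refl , vstart3 , from3 u U , bottom u U))
  spanned {v = v} (inj₂ (inj₂ (inj₂ (inj₁ refl)))) (inj₁ V) =
      inj₂ (inj₁ (vertical , _ , _ , there (there (here refl)) , here refl , vstart3 , from3 v V , bottom v V))
  spanned (inj₂ (inj₂ (inj₂ (inj₁ refl)))) (inj₂ (inj₂ (inj₂ (inj₁ refl)))) = inj₁ refl
  spanned {u} (inj₁ U) (inj₂ (inj₂ (inj₂ (inj₂ refl)))) =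
      inj₂ (inj₂ (horizontal , _ , _ , there (there (there (here refl))) , there (here refl) , hstart4
      , from4 u U , left u U))
  spanned {v = v} (inj₂ (inj₂ (inj₂ (inj₂ refl)))) (inj₁ V) =
      inj₂ (inj₁ (horizontal , _ , _ , there (there (there (here refl))) , there (here refl) , hstart4
      , from4 v V , left v V))
  spanned (inj₂ (inj₂ (inj₂ (inj₂ refl)))) (inj₂ (inj₂ (inj₂ (inj₂ refl)))) = inj₁ refl
  -- Cyclically consecutive added points differ by `k + 1` in one coordinate and by `k + 2` in the
  -- other. The longer one alternates between vertical and horizontal around the region, so every
  -- added point occurs in chains along both axes.
  spanned (inj₂ (inj₂ (inj₁ refl))) (inj₂ (inj₁ refl)) =
      inj₂ (inj₁ (vertical , _ , _ , there (here refl) , here refl , vstart2 , pair21 , vend1))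
  spanned (inj₂ (inj₁ refl)) (inj₂ (inj₂ (inj₁ refl))) =
      inj₂ (inj₂ (vertical , _ , _ , there (here refl) , here refl , vstart2 , pair21 , vend1))
  spanned (inj₂ (inj₂ (inj₂ (inj₁ refl)))) (inj₂ (inj₁ refl)) =
      inj₂ (inj₁ (vertical , _ , _ , there (there (here refl)) , here refl , vstart3 , pair31 , vend1))
  spanned (inj₂ (inj₁ refl)) (inj₂ (inj₂ (inj₂ (inj₁ refl)))) =
      inj₂ (inj₂ (vertical , _ , _ , there (there (here refl)) , here refl , vstart3 , pair31 , vend1))
  spanned (inj₂ (inj₂ (inj₂ (inj₂ refl)))) (inj₂ (inj₁ refl)) =
      inj₂ (inj₁ (horizontal , _ , _ , there (there (there (here refl))) , here refl , hstart4 , pair41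
      , hend1))
  spanned (inj₂ (inj₁ refl)) (inj₂ (inj₂ (inj₂ (inj₂ refl)))) =
      inj₂ (inj₂ (horizontal , _ , _ , there (there (there (here refl))) , here refl , hstart4 , pair41
      , hend1))
  spanned (inj₂ (inj₂ (inj₂ (inj₁ refl)))) (inj₂ (inj₂ (inj₁ refl))) =
      inj₂ (inj₁ (horizontal , _ , _ , there (there (here refl)) , there (here refl) , hstart3 , pair32
      , hend2))
  spanned (inj₂ (inj₂ (inj₁ refl))) (inj₂ (inj₂ (inj₂ (inj₁ refl)))) =
      inj₂ (inj₂ (horizontal , _ , _ , there (there (here refl)) , there (here refl) , hstart3 , pair32
      , hend2))
  spanned (inj₂ (inj₂ (inj₂ (inj₂ refl)))) (inj₂ (inj₂ (inj₁ refl))) =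
      inj₂ (inj₁ (horizontal , _ , _ , there (there (there (here refl))) , there (here refl) , hstart4
      , pair42 , hend2))
  spanned (inj₂ (inj₂ (inj₁ refl))) (inj₂ (inj₂ (inj₂ (inj₂ refl)))) =
      inj₂ (inj₂ (horizontal , _ , _ , there (there (there (here refl))) , there (here refl) , hstart4
      , pair42 , hend2))
  spanned (inj₂ (inj₂ (inj₂ (inj₁ refl)))) (inj₂ (inj₂ (inj₂ (inj₂ refl)))) =
      inj₂ (inj₁ (vertical , _ , _ , there (there (here refl)) , there (there (there (here refl)))
      , vstart3 , pair34 , vend4))
  spanned (inj₂ (inj₂ (inj₂ (inj₂ refl)))) (inj₂ (inj₂ (inj₂ (inj₁ refl)))) =
      inj₂ (inj₂ (vertical , _ , _ , there (there (here refl)) , there (there (there (here refl)))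
      , vstart3 , pair34 , vend4))

  bounded : ∀ {p} → (InH3 k k) p → ∣ proj₁ p ∣ ≤ (2 * k + 2) × ∣ proj₂ p ∣ ≤ (2 * k + 2)
  bounded {x , y} (inj₁ U) = abs-bounds (2 * k + 2) (arith 1 2 (λ k x y →
      :Box (con (+ 0)) (nat (2 :* k :+ con 2)) (con -1ℤ) (nat (2 :* k :+ con 1)) x y ⇒
      ⊢ (x :≤ᶻ nat (2 :* k :+ con 2) :∧ (:- nat (2 :* k :+ con 2)) :≤ᶻ x) :∧
      (y :≤ᶻ nat (2 :* k :+ con 2) :∧ (:- nat (2 :* k :+ con 2)) :≤ᶻ y)) tt k x y U)
  bounded (inj₂ (inj₁ refl)) = abs-bounds (2 * k + 2) (arith 1 0 (λ k →
      ⊢ ((nat k) :≤ᶻ nat (2 :* k :+ con 2) :∧ (:- nat (2 :* k :+ con 2)) :≤ᶻ (nat k)) :∧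
      (((:- nat k) :- con (+ 1)) :≤ᶻ nat (2 :* k :+ con 2) :∧
      (:- nat (2 :* k :+ con 2)) :≤ᶻ ((:- nat k) :- con (+ 1)))) tt k )
  bounded (inj₂ (inj₂ (inj₁ refl))) = abs-bounds (2 * k + 2) (arith 1 0 (λ k →
      ⊢ ((con -1ℤ) :≤ᶻ nat (2 :* k :+ con 2) :∧ (:- nat (2 :* k :+ con 2)) :≤ᶻ (con -1ℤ)) :∧
      ((con (+ 1)) :≤ᶻ nat (2 :* k :+ con 2) :∧ (:- nat (2 :* k :+ con 2)) :≤ᶻ (con (+ 1)))) tt k )
  bounded (inj₂ (inj₂ (inj₂ (inj₁ refl)))) = abs-bounds (2 * k + 2) (arith 1 0 (λ k →
      ⊢ ((nat (k :+ con 1)) :≤ᶻ nat (2 :* k :+ con 2) :∧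
      (:- nat (2 :* k :+ con 2)) :≤ᶻ (nat (k :+ con 1))) :∧
      ((nat (k :+ con 2)) :≤ᶻ nat (2 :* k :+ con 2) :∧
      (:- nat (2 :* k :+ con 2)) :≤ᶻ (nat (k :+ con 2)))) tt k )
  bounded (inj₂ (inj₂ (inj₂ (inj₂ refl)))) = abs-bounds (2 * k + 2) (arith 1 0 (λ k →
      ⊢ ((nat (k :+ k :+ con 2)) :≤ᶻ nat (2 :* k :+ con 2) :∧
      (:- nat (2 :* k :+ con 2)) :≤ᶻ (nat (k :+ k :+ con 2))) :∧
      ((nat k :- nat k) :≤ᶻ nat (2 :* k :+ con 2) :∧ (:- nat (2 :* k :+ con 2)) :≤ᶻ (nat k :- nat k))) tt k )

-- From a gap in a Helly graph to an embedded region

ContainsWide : Graph → ℕ → Set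
ContainsWide H D =
  (∃[ k ] (D ≡ 2 * k + 1 × ContainsIsometric H (H₂ k k))) ⊎
  (∃[ k ] (D ≡ 2 * k + 2 × (ContainsIsometric H (H₁ (suc k) (suc k)) ⊎ ContainsIsometric H (H₃ k k))))

module _ {H : Graph} (helly : Helly H) where

  diamond⇒H₁ : ∀ {a b c d} k A C → Diamond H a b c d (A + k) (C + k) (2 * k) → ContainsIsometric H (H₁ k k)
  diamond⇒H₁ k A C (ac , bd , ab , ad , cb , cd) =
    embed helly (exact₄ (to kd-ab ab) (to kd-ac ac) (to kd-ad ad) (to kd-bc (Dist-sym cb)) (to kd-bd bd)
        (to kd-cd cd))
      (H₁-isometric k k) (2 * k) (λ {p} → bounded {p}) spanned
    where
    open Span₁ k A C
    to : ∀ {x y m n} → m ≡ n → Dist H x y n → Dist H x y m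
    to e = subst (Dist H _ _) (sym e)

  diamond⇒H₂ : ∀ {a b c d} k A C → Diamond H a b c d (A + (k + 1)) (C + (k + 1)) (2 * k + 1) →
      ContainsIsometric H (H₂ k k)
  diamond⇒H₂ k A C (ac , bd , ab , ad , cb , cd) =
    embed helly (exact₄ (to kd-ab ab) (to kd-ac ac) (to kd-ad ad) (to kd-bc (Dist-sym cb)) (to kd-bd bd)
        (to kd-cd cd))
      (H₂-isometric k) (2 * k + 1) bounded spanned
    where
    open Span₂ k A C
    to : ∀ {x y m n} → m ≡ n → Dist H x y n → Dist H x y m
    to e = subst (Dist H _ _) (sym e)

  pinwheel⇒H₃ : ∀ {a b c d} k A B C E →
    Dist H a b (A + B + k + 2) → Dist H b c (B + C + k + 2) → Dist H c d (C + E + k + 2) →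
        Dist H d a (E + A + k + 2) →
    Dist H a c (A + C + 2 * k + 3) → Dist H b d (B + E + 2 * k + 3) → ContainsIsometric H (H₃ k k)
  pinwheel⇒H₃ k A B C E ab bc cd da ac bd =
    embed helly (exact₄ (to kd-ab ab) (to kd-ac ac) (to kd-ad (Dist-sym da)) (to kd-bc bc) (to kd-bd bd)
        (to kd-cd cd))
      (H₃-isometric k) (2 * k + 2) bounded spanned
    where
    open Span₃ k A B C E
    to : ∀ {x y m n} → m ≡ n → Dist H x y n → Dist H x y m
    to e = subst (Dist H _ _) (sym e)

  -- The paths from b to d through a and c give `D ≤ X + X` and `D ≤ Z + Z`. The excess of X and Z
  -- over half of `D`, rounded up, is the distance of a and c beyond the corners.
  diamond⇒wide : ∀ {a b c d} X Z D → 1 ≤ D → Diamond H a b c d X Z D → ContainsWide H D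
  diamond⇒wide X Z D D≥1 dia@(ac , bd , ab , ad , cb , cd) = go (ceilHalf D)
    where
    D≤2X : D ≤ X + X
    D≤2X = Dist-triangle bd (Dist-sym ab) ad
    D≤2Z : D ≤ Z + Z
    D≤2Z = Dist-triangle bd (Dist-sym cb) cd
    go : ∃[ h ] (2 * h ≡ D ⊎ 2 * h ≡ 1 + D) → ContainsWide H D
    go (zero , inj₁ e) = contradiction (subst (1 ≤_) (sym e) D≥1) (λ ())
    go (suc k , inj₁ refl) = inj₂ (k , arith 1 0 (λ k → ⊢ 2 :* (con 1 :+ k) :≡ 2 :* k :+ con 2) tt k ,
      inj₁ (diamond⇒H₁ (suc k) (X ∸ suc k) (Z ∸ suc k)
        (subst₂ (λ x z → Diamond H _ _ _ _ x z (2 * suc k)) (sym (ℕ.m∸n+n≡m (half X D≤2X)))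
            (sym (ℕ.m∸n+n≡m (half Z D≤2Z))) dia)))
      where
      half : ∀ Y → 2 * suc k ≤ Y + Y → suc k ≤ Y
      half Y = arith 2 0 (λ k Y → 2 :* (con 1 :+ k) :≤ Y :+ Y ⇒ ⊢ con 1 :+ k :≤ Y) tt k Y
    go (zero , inj₂ ())
    go (suc k , inj₂ e) = inj₁ (k , D≡ , diamond⇒H₂ k (X ∸ (k + 1)) (Z ∸ (k + 1))
        (subst₂ (λ x z → Diamond H _ _ _ _ x z (2 * k + 1)) (sym (ℕ.m∸n+n≡m (half X D≤2X)))
            (sym (ℕ.m∸n+n≡m (half Z D≤2Z)))
          (subst (Diamond H _ _ _ _ X Z) D≡ dia)))
      where
      D≡ : D ≡ 2 * k + 1
      D≡ = arith 2 0 (λ D k → 2 :* (con 1 :+ k) :≡ con 1 :+ D ⇒ ⊢ D :≡ 2 :* k :+ con 1) tt D k e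
      half : ∀ Y → D ≤ Y + Y → k + 1 ≤ Y
      half Y = arith 3 0 (λ D k Y → D :≡ 2 :* k :+ con 1 ⇒ D :≤ Y :+ Y ⇒ ⊢ k :+ con 1 :≤ Y) tt D k Y D≡

  wide : ∀ {a b c d ab bc cd da ac bd} D → 1 ≤ D →
    Dist H a b ab → Dist H b c bc → Dist H c d cd → Dist H d a da → Dist H a c ac → Dist H b d bd →
    ab + cd + D ≤ ac + bd → da + bc + D ≤ ac + bd → ContainsWide H D
  wide {a} {b} {c} {d} {ab} {bc} {cd} {da} {ac} {bd} D D≥1 Dab Dbc Dcd Dda Dac Dbd hab had =
    go (fourPointShape D ab bc cd da ac bd D≥1 hab had
      (Dist-triangle Dbd (Dist-sym Dab) (Dist-sym Dda))
      (Dist-triangle Dbd Dbc Dcd)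
      (Dist-triangle (Dist-sym Dac) (Dist-sym Dbc) (Dist-sym Dab)) (Dist-triangle (Dist-sym Dac) Dcd Dda))
    where
    go : FourPointShape D ab bc cd da ac bd → ContainsWide H D
    go (split-ac X Z refl hX hZ) =
      let _ , _ , dia = diamond helly X Z D Dab Dbc Dcd Dda Dac Dbd hab had hX hZ in diamond⇒wide X Z D D≥1 dia
    go (split-bd X Z refl hX hZ) =
      let _ , _ , dia = diamond helly X Z D Dbc Dcd Dda Dab Dbd (Dist-sym Dac)
            (subst₂ _≤_ (cong (_+ D) (ℕ.+-comm da bc)) (ℕ.+-comm ac (X + Z)) had)
            (subst (ab + cd + D ≤_) (ℕ.+-comm ac (X + Z)) hab) hX hZ
      in diamond⇒wide X Z D D≥1 dia
    go (pinwheel k A B C E refl refl refl refl refl refl refl) =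
      inj₂ (k , refl , inj₂ (pinwheel⇒H₃ k A B C E Dab Dbc Dcd Dda Dac Dbd))

-- The tight span of a finite metric

sup : ∀ {n} → Vec ℕ n → Vec ℕ n → ℕ
sup []      []      = 0
sup (x ∷ e) (y ∷ f) = ℕ.∣ x - y ∣ ⊔ sup e f

opaque
  sup-bound : ∀ {n} (e f : Vec ℕ n) i → lookup e i ≤ lookup f i + sup e f
  sup-bound (x ∷ e) (y ∷ f) zero    = ℕ.≤-trans (ℕ.m≤n+∣m-n∣ x y) (ℕ.+-monoʳ-≤ y (ℕ.m≤m⊔n _ _))
  sup-bound (x ∷ e) (y ∷ f) (suc i) = ℕ.≤-trans (sup-bound e f i) (ℕ.+-monoʳ-≤ (lookup f i) (ℕ.m≤n⊔m _ _))

  sup-least : ∀ {n} (e f : Vec ℕ n) r → (∀ i → lookup e i ≤ lookup f i + r) → (∀ i →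
      lookup f i ≤ lookup e i + r) → sup e f ≤ r
  sup-least []      []      r p q = z≤n
  sup-least (x ∷ e) (y ∷ f) r p q =
      ℕ.⊔-lub (difference-≤ (p zero) (q zero)) (sup-least e f r (p ∘ suc) (q ∘ suc))
    where
    difference-≤ : x ≤ y + r → y ≤ x + r → ℕ.∣ x - y ∣ ≤ r
    difference-≤ h k with ℕ.≤-total x y
    ... | inj₁ x≤y = subst (_≤ r) (sym (ℕ.m≤n⇒∣m-n∣≡n∸m x≤y)) (ℕ.m≤n+o⇒m∸n≤o y x k)
    ... | inj₂ y≤x = subst (_≤ r) (sym (ℕ.m≤n⇒∣n-m∣≡n∸m y≤x)) (ℕ.m≤n+o⇒m∸n≤o x y h)

  sup-refl : ∀ {n} (e : Vec ℕ n) → sup e e ≡ 0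
  sup-refl e = ℕ.n≤0⇒n≡0 (sup-least e e 0 (λ i → ℕ.m≤m+n _ 0) (λ i → ℕ.m≤m+n _ 0))

  sup-sym : ∀ {n} (e f : Vec ℕ n) → sup e f ≡ sup f e
  sup-sym []      []      = refl
  sup-sym (x ∷ e) (y ∷ f) = cong₂ _⊔_ (ℕ.∣-∣-comm x y) (sup-sym e f)

  sup-triangle : ∀ {n} (e f g : Vec ℕ n) → sup e g ≤ sup e f + sup f g
  sup-triangle e f g = sup-least e g _
    (λ i → through (lookup e i) (lookup f i) (lookup g i) (sup e f) (sup f g) (sup-bound e f i)
        (sup-bound f g i))
    (λ i → subst (λ r → lookup g i ≤ lookup e i + r) (ℕ.+-comm (sup f g) (sup e f))
      (through (lookup g i) (lookup f i) (lookup e i) (sup f g) (sup e f)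
        (subst (λ r → lookup g i ≤ lookup f i + r) (sup-sym g f) (sup-bound g f i))
        (subst (λ r → lookup f i ≤ lookup e i + r) (sup-sym f e) (sup-bound f e i))))
    where
    through : ∀ a b c r s → a ≤ b + r → b ≤ c + s → a ≤ c + (r + s)
    through a b c r s = arith 5 0 (λ a b c r s → a :≤ b :+ r ⇒ b :≤ c :+ s ⇒ ⊢ a :≤ c :+ (r :+ s)) tt a b c r s

  sup-attained : ∀ {n} (e f : Vec ℕ n) {k} → sup e f ≡ suc k →
    ∃[ i ] (lookup e i ≡ lookup f i + suc k ⊎ lookup f i ≡ lookup e i + suc k)
  sup-attained [] [] ()
  sup-attained (x ∷ e) (y ∷ f) {k} h with ℕ.⊔-sel ℕ.∣ x - y ∣ (sup e f)
  ... | inj₂ s = let i , p = sup-attained e f (trans (sym s) h) in suc i , p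
  ... | inj₁ s with ℕ.≤-total x y
  ...   | inj₁ x≤y = zero , inj₂ (trans (sym (ℕ.m+[n∸m]≡n x≤y)) (cong (λ z →
      x + z) (trans (sym (ℕ.m≤n⇒∣m-n∣≡n∸m x≤y)) (trans (sym s) h))))
  ...   | inj₂ y≤x = zero , inj₁ (trans (sym (ℕ.m+[n∸m]≡n y≤x)) (cong (λ z →
      y + z) (trans (sym (ℕ.m≤n⇒∣n-m∣≡n∸m y≤x)) (trans (sym s) h))))

upperBound : ∀ {n} (h : Fin n → ℕ) → ∃[ M ] (∀ i → h i ≤ M)
upperBound {zero}  h = 0 , λ ()
upperBound {suc n} h = let M , b = upperBound (h ∘ suc) in h zero ⊔ M , λ where
  zero    → ℕ.m≤m⊔n (h zero) M
  (suc i) → ℕ.≤-trans (b i) (ℕ.m≤n⊔m (h zero) M)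

boundedVectors : ℕ → ∀ n → List (Vec ℕ n)
boundedVectors M zero    = [] ∷ []
boundedVectors M (suc n) = List.map (λ p →
    proj₁ p ∷ proj₂ p) (List.cartesianProduct (List.upTo (suc M)) (boundedVectors M n))

∈-boundedVectors : ∀ M {n} (e : Vec ℕ n) → (∀ i → lookup e i ≤ M) → e ∈ boundedVectors M n
∈-boundedVectors M []      b = here refl
∈-boundedVectors M (x ∷ e) b = ∈-map⁺ (λ p → proj₁ p ∷ proj₂ p)
  (∈-cartesianProduct⁺ (∈-upTo⁺ (s≤s (b zero))) (∈-boundedVectors M e (b ∘ suc)))

decrement : ∀ {n} → Vec ℕ n → Fin n → Vec ℕ n
decrement (x ∷ e) zero    = ℕ.pred x ∷ e
decrement (x ∷ e) (suc i) = x ∷ decrement e i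

lookup-decrement : ∀ {n} (e : Vec ℕ n) i → lookup (decrement e i) i ≡ ℕ.pred (lookup e i)
lookup-decrement (x ∷ e) zero    = refl
lookup-decrement (x ∷ e) (suc i) = lookup-decrement e i

lookup-decrement-≢ : ∀ {n} (e : Vec ℕ n) {i j} → i ≢ j → lookup (decrement e i) j ≡ lookup e j
lookup-decrement-≢ (x ∷ e) {zero}  {zero}  i≢j = ⊥-elim (i≢j refl)
lookup-decrement-≢ (x ∷ e) {zero}  {suc j} i≢j = refl
lookup-decrement-≢ (x ∷ e) {suc i} {zero}  i≢j = refl
lookup-decrement-≢ (x ∷ e) {suc i} {suc j} i≢j = lookup-decrement-≢ e (i≢j ∘ cong suc)

sum-decrement : ∀ {n} (e : Vec ℕ n) i → 1 ≤ lookup e i → suc (Vec.sum (decrement e i)) ≤ Vec.sum e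
sum-decrement (suc x ∷ e) zero    _ = ℕ.≤-refl
sum-decrement (x ∷ e)     (suc i) h =
    subst (_≤ x + Vec.sum e) (ℕ.+-suc x _) (ℕ.+-monoʳ-≤ x (sum-decrement e i h))

decrement-≤ : ∀ {n} (e : Vec ℕ n) i j → lookup (decrement e i) j ≤ lookup e j
decrement-≤ (x ∷ e) zero    zero    = ℕ.pred[n]≤n
decrement-≤ (x ∷ e) zero    (suc j) = ℕ.≤-refl
decrement-≤ (x ∷ e) (suc i) zero    = ℕ.≤-refl
decrement-≤ (x ∷ e) (suc i) (suc j) = decrement-≤ e i j

module TightSpan {n} (δ : Fin n → Fin n → ℕ) (δ-refl : ∀ i → δ i i ≡ 0) (δ-sym : ∀ i j → δ i j ≡ δ j i)
  (δ-triangle : ∀ i j k → δ i k ≤ δ i j + δ j k) where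

  -- These are the integer points of the tight span. Among integer-valued admissible functions,
  -- tightness at every index is pointwise minimality.
  Admissible Tight Extremal : Vec ℕ n → Set
  Admissible e = ∀ i j → δ i j ≤ lookup e i + lookup e j
  Tight e      = ∀ i → ∃[ j ] (lookup e i + lookup e j ≡ δ i j)
  Extremal e   = Admissible e × Tight e

  tightAt? : ∀ e i → Dec (∃[ j ] (lookup e i + lookup e j ≡ δ i j))
  tightAt? e i = Fin.any? λ j → lookup e i + lookup e j ℕ.≟ δ i j

  extremal? : ∀ e → Dec (Extremal e)
  extremal? e = Fin.all? (λ i → Fin.all? λ j → δ i j ℕ.≤? lookup e i + lookup e j) ×-dec Fin.all? (tightAt? e)

  opaque
    -- A Boolean test is used because `T` of it has at most one proof; this makes membership in
    -- `Span` below proof-irrelevant.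
    isExtremal : Vec ℕ n → Bool
    isExtremal e = ⌊ extremal? e ⌋

    isExtremal-sound : ∀ {e} → T (isExtremal e) → Extremal e
    isExtremal-sound {e} = toWitness {a? = extremal? e}

    isExtremal-complete : ∀ {e} → Extremal e → T (isExtremal e)
    isExtremal-complete {e} = fromWitness {a? = extremal? e}

  -- The Kuratowski embedding: a point is represented by its distances to all points.
  kernel : Fin n → Vec ℕ n
  kernel i = tabulate (δ i)

  lookup-kernel : ∀ i j → lookup (kernel i) j ≡ δ i j
  lookup-kernel i j = Vec.lookup∘tabulate (δ i) j

  opaque
    kernel-extremal : ∀ i → Extremal (kernel i)
    kernel-extremal i =
        (λ j k → subst₂ (λ a b → δ j k
            ≤ a + b) (trans (δ-sym j i) (sym (lookup-kernel i j))) (sym (lookup-kernel i k)) (δ-triangle j i k))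
      , (λ j → i , trans (cong₂ _+_ (trans (lookup-kernel i j) (δ-sym i j)) (trans (lookup-kernel i i)
          (δ-refl i))) (ℕ.+-identityʳ _))

    -- Greedy descent: an entry that is tight against no entry, itself included, is positive and can
    -- be lowered by one without losing admissibility. The sum drops each time, and `m` bounds it.
    descend : ∀ m h → Vec.sum h ≤ m → Admissible h → ∃[ e ] (Extremal e × (∀ i → lookup e i ≤ lookup h i))
    descend m h s adm with Fin.all? (tightAt? h)
    ... | yes tight = h , (adm , tight) , λ _ → ℕ.≤-refl
    ... | no ¬tight with Fin.¬∀⟶∃¬ n _ (tightAt? h) ¬tight
    ...   | i , ¬tightᵢ = continue m s
      where
      slack : ∀ j → suc (δ i j) ≤ lookup h i + lookup h j
      slack j = ℕ.≤∧≢⇒< (adm i j) (λ e → ¬tightᵢ (j , sym e))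
      positive : ∀ x → suc (δ i i) ≤ x + x → 1 ≤ x
      positive zero    ()
      positive (suc x) _ = s≤s z≤n
      hᵢ>0 : 1 ≤ lookup h i
      hᵢ>0 = positive (lookup h i) (slack i)
      h′ : Vec ℕ n
      h′ = decrement h i
      lower : ∀ x {y d} → 1 ≤ x → suc d ≤ x + y → d ≤ ℕ.pred x + y
      lower (suc x) _ (s≤s p) = p
      adm′ : Admissible h′
      adm′ j k with i Fin.≟ j | i Fin.≟ k
      ... | yes refl | yes refl = subst (_≤ lookup h′ i + lookup h′ i) (sym (δ-refl i)) z≤n
      ... | yes refl | no i≢k = subst₂ (λ a b →
          δ i k ≤ a + b) (sym (lookup-decrement h i)) (sym (lookup-decrement-≢ h i≢k))
              (lower (lookup h i) hᵢ>0 (slack k))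
      ... | no i≢j | yes refl = subst₂ _≤_ (δ-sym i j)
              (trans (cong₂ _+_ (sym (lookup-decrement h i)) (sym (lookup-decrement-≢ h i≢j)))
                  (ℕ.+-comm (lookup h′ i) (lookup h′ j)))
              (lower (lookup h i) hᵢ>0 (slack j))
      ... | no i≢j | no i≢k = subst₂ (λ a b →
          δ j k ≤ a + b) (sym (lookup-decrement-≢ h i≢j)) (sym (lookup-decrement-≢ h i≢k)) (adm j k)
      continue : ∀ m → Vec.sum h ≤ m → ∃[ e ] (Extremal e × (∀ i → lookup e i ≤ lookup h i))
      continue zero    s = contradiction (ℕ.≤-trans (sum-decrement h i hᵢ>0) s) (λ ())
      continue (suc m) s =
        let e , ext , e≤ = descend m h′ (ℕ.≤-pred (ℕ.≤-trans (sum-decrement h i hᵢ>0) s)) adm′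
        in e , ext , λ j → ℕ.≤-trans (e≤ j) (decrement-≤ h i j)

    extremalBelow : ∀ h → Admissible h → ∃[ e ] (Extremal e × (∀ i → lookup e i ≤ lookup h i))
    extremalBelow h = descend _ h ℕ.≤-refl

    -- The opposite inequality is free: if `j` is tight for `i`, then `e i = δ i j - e j ≤ f i + f j
    -- - e j ≤ f i + r`. Therefore lying in a disk around an extremal function is a one-sided
    -- condition.
    sup-extremal : ∀ e f r → Extremal e → Admissible f → (∀ i → lookup f i ≤ lookup e i + r) → sup e f ≤ r
    sup-extremal e f r (adm , tight) admf h = sup-least e f r (λ i →
      let j , t = tight i in
      arith 6 0 (λ d a b a′ b′ r → a :+ b :≡ d ⇒ d :≤ a′ :+ b′ ⇒ b′ :≤ b :+ r ⇒ ⊢ a :≤ a′ :+ r) tt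
        (δ i j) (lookup e i) (lookup e j) (lookup f i) (lookup f j) r t (admf i j) (h j)) h

    sup-kernel : ∀ {e} → Extremal e → ∀ i → sup e (kernel i) ≤ lookup e i
    sup-kernel {e} ext i = sup-extremal e (kernel i) (lookup e i) ext (proj₁ (kernel-extremal i)) λ j →
      subst₂ _≤_ (sym (lookup-kernel i j)) (ℕ.+-comm (lookup e i) (lookup e j)) (proj₁ ext i j)

    sup-kernels : ∀ i j → sup (kernel i) (kernel j) ≡ δ i j
    sup-kernels i j = ℕ.≤-antisym
      (subst (sup (kernel i) (kernel j) ≤_) (lookup-kernel i j) (sup-kernel {kernel i} (kernel-extremal i) j))
      (subst₂ (λ a b → a ≤ b + sup (kernel i) (kernel j)) (lookup-kernel i j) (trans (lookup-kernel j j)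
          (δ-refl j))
        (sup-bound (kernel i) (kernel j) j))

    -- By `sup-extremal`, an extremal function below both `e + 1` and `f + k` is within 1 of `e` and
    -- `k` of `f`. The minimum of these two functions is admissible: a mixed pair is covered by
    -- `δ i j ≤ e i + e j ≤ e i + f j + (k + 1)`.
    geodesicStep : ∀ {e f k} → Extremal e → Extremal f → sup e f ≤ suc k →
      ∃[ g ] (Extremal g × sup e g ≤ 1 × sup g f ≤ k)
    geodesicStep {e} {f} {k} ext ext′ d =
      let g , extg , g≤ = extremalBelow h adm in g , extg
        , sup-extremal e g 1 ext (proj₁ extg) (λ i →
            ℕ.≤-trans (g≤ i) (ℕ.≤-trans (ℕ.≤-reflexive (h≡ i)) (ℕ.m⊓n≤m _ _)))
        , subst (_≤ k) (sup-sym f g)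
          (sup-extremal f g k ext′ (proj₁ extg) (λ i →
              ℕ.≤-trans (g≤ i) (ℕ.≤-trans (ℕ.≤-reflexive (h≡ i)) (ℕ.m⊓n≤n _ _))))
      where
      h : Vec ℕ n
      h = tabulate (λ i → (lookup e i + 1) ⊓ (lookup f i + k))
      h≡ : ∀ i → lookup h i ≡ (lookup e i + 1) ⊓ (lookup f i + k)
      h≡ = Vec.lookup∘tabulate _
      cross : ∀ i j → δ i j ≤ lookup e i + 1 + (lookup f j + k)
      cross i j = arith 6 0 (λ d a b c s k → d :≤ a :+ b ⇒ b :≤ c :+ s ⇒ s :≤ con 1 :+ k ⇒
          ⊢ d :≤ a :+ con 1 :+ (c :+ k)) tt
        (δ i j) (lookup e i) (lookup e j) (lookup f j) (sup e f) k (proj₁ ext i j) (sup-bound e f j) d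
      adm : Admissible h
      adm i j = subst₂ (λ a b → δ i j ≤ a + b) (sym (h≡ i)) (sym (h≡ j)) (both i j)
        where
        both : ∀ i j → δ i j ≤ (lookup e i + 1) ⊓ (lookup f i + k) + (lookup e j + 1) ⊓ (lookup f j + k)
        both i j with ℕ.⊓-sel (lookup e i + 1) (lookup f i + k) | ℕ.⊓-sel (lookup e j + 1) (lookup f j + k)
        ... | inj₁ p | inj₁ q rewrite p | q =
            ℕ.≤-trans (proj₁ ext i j) (ℕ.+-mono-≤ (ℕ.m≤m+n (lookup e i) 1) (ℕ.m≤m+n (lookup e j) 1))
        ... | inj₁ p | inj₂ q rewrite p | q = cross i j
        ... | inj₂ p | inj₁ q rewrite p | q = subst₂ _≤_ (δ-sym j i) (ℕ.+-comm (lookup e j + 1) _) (cross j i)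
        ... | inj₂ p | inj₂ q rewrite p | q =
            ℕ.≤-trans (proj₁ ext′ i j) (ℕ.+-mono-≤ (ℕ.m≤m+n (lookup f i) k) (ℕ.m≤m+n (lookup f j) k))

-- The injective hull is the tight span

WLEM : Set₁
WLEM = (P : Set) → ¬ P ⊎ ¬ ¬ P

-- The common point of D(a,1) with the "disks" that are {a} if P holds and {b} if it fails decides P.
helly⇒WLEM : ∀ {H a b} → Helly H → Dist H a b 1 → WLEM
helly⇒WLEM {H} {a} {b} helly ab P = decideAt (helly (⊤ ⊎ P ⊎ ¬ P) centre radius meet)
  where
  centre : ⊤ ⊎ P ⊎ ¬ P → V H
  centre (inj₁ _)        = a
  centre (inj₂ (inj₁ _)) = a
  centre (inj₂ (inj₂ _)) = b
  radius : ⊤ ⊎ P ⊎ ¬ P → ℕ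
  radius (inj₁ _) = 1
  radius (inj₂ _) = 0
  a∈ : ∀ {r} → InDisk H a r a
  a∈ = InDisk-mono z≤n InDisk-refl
  meet : ∀ i j → ∃[ z ] (InDisk H (centre i) (radius i) z × InDisk H (centre j) (radius j) z)
  meet (inj₁ _) (inj₁ _) = a , a∈ , a∈
  meet (inj₁ _) (inj₂ (inj₁ _)) = a , a∈ , a∈
  meet (inj₁ _) (inj₂ (inj₂ _)) = b , (1 , ℕ.≤-refl , ab) , InDisk-refl
  meet (inj₂ (inj₁ _)) (inj₁ _) = a , a∈ , a∈
  meet (inj₂ (inj₁ _)) (inj₂ (inj₁ _)) = a , a∈ , a∈
  meet (inj₂ (inj₁ p)) (inj₂ (inj₂ ¬p)) = contradiction p ¬p
  meet (inj₂ (inj₂ _)) (inj₁ _) = b , InDisk-refl , (1 , ℕ.≤-refl , ab)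
  meet (inj₂ (inj₂ ¬p)) (inj₂ (inj₁ p)) = contradiction p ¬p
  meet (inj₂ (inj₂ _)) (inj₂ (inj₂ _)) = b , InDisk-refl , InDisk-refl
  atZero : ∀ {u v} → InDisk H u 0 v → u ≡ v
  atZero (0 , _ , d) = Dist-zero d
  decideAt : ∃[ z ] (∀ i → InDisk H (centre i) (radius i) z) → ¬ P ⊎ ¬ ¬ P
  decideAt (z , h) with h (inj₁ tt)
  ... | zero , _ , az = inj₂ λ ¬p → contradiction
          (Dist-unique (subst (λ w → Dist H a w 0) (sym (atZero (h (inj₂ (inj₂ ¬p))))) az) ab) (λ ())
  ... | suc _ , _ , az = inj₁ λ p → contradiction
          (Dist-unique (subst (λ w → Dist H a w _) (sym (atZero (h (inj₂ (inj₁ p))))) az) Dist-refl) (λ ())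

vec-ext : ∀ {n} {e f : Vec ℕ n} → (∀ i → lookup e i ≡ lookup f i) → e ≡ f
vec-ext {e = e} {f} h = trans (sym (Vec.tabulate∘lookup e)) (trans (Vec.tabulate-cong h)
    (Vec.tabulate∘lookup f))

largestBelow : ∀ M (Q : ℕ → Set) → (∀ m → Dec (Q m)) → Q 0 → ∃[ m ] (Q m × (m ≡ M ⊎ ¬ Q (suc m)))
largestBelow zero    Q Q? q = 0 , q , inj₁ refl
largestBelow (suc M) Q Q? q with largestBelow M Q Q? q
... | m , qm , inj₂ ¬q = m , qm , inj₂ ¬q
... | m , qm , inj₁ refl with Q? (suc m)
...   | yes q′ = suc m , q′ , inj₁ refl
...   | no ¬q′ = m , qm , inj₂ ¬q′

-- The tight span is realised inside `H`. Sending `kernel i` to `g i` is nonexpansive and extends to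
-- all bounded vectors; on extremal vectors the extension is an isometry. Its image there is an
-- isometric Helly subgraph containing every `g i`, hence everything by minimality.
module Hull {H : Graph} (helly : Helly H) (wlem : WLEM) {n} (g : Fin n → V H) (δ : Fin n → Fin n → ℕ)
  (dist : ∀ i j → Dist H (g i) (g j) (δ i j))
  (minimal : (S : V H → Set) → (∀ i → S (g i)) → IsometricSubgraph H S → Helly (Induced H S) → ∀ v → S v) where

  private
    δ-refl : ∀ i → δ i i ≡ 0
    δ-refl i = Dist-unique (dist i i) Dist-refl
    δ-sym : ∀ i j → δ i j ≡ δ j i
    δ-sym i j = Dist-unique (dist i j) (Dist-sym (dist j i))
    δ-triangle : ∀ i j k → δ i k ≤ δ i j + δ j k
    δ-triangle i j k = Dist-triangle (dist i k) (dist i j) (dist j k)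

    δ-bound : ∃[ M ] (∀ i j → δ i j ≤ M)
    δ-bound = let M , b = upperBound (λ i → proj₁ (upperBound (δ i)))
              in M , λ i j → ℕ.≤-trans (proj₂ (upperBound (δ i)) j) (b i)
    M : ℕ
    M = proj₁ δ-bound
    δ≤M : ∀ i j → δ i j ≤ M
    δ≤M = proj₂ δ-bound

  open TightSpan δ δ-refl δ-sym δ-triangle
  open Placement helly (sup {n}) sup-refl sup-sym sup-triangle

  private
    kernels : List (Vec ℕ n × V H)
    kernels = List.map (λ i → kernel i , g i) (List.allFin n)

    kernels-placed : Placed kernels
    kernels-placed a b with ∈-map⁻ (λ i → kernel i , g i) a | ∈-map⁻ (λ i → kernel i , g i) b
    ... | i , _ , refl | j , _ , refl = δ i j , ℕ.≤-reflexive (sym (sup-kernels i j)) , dist i j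

  opaque
    placement : ∃[ P ] (Placed P × (∀ {i} → i ∈ kernels → i ∈ P) × (∀ e → e ∈ boundedVectors M n →
        ∃[ z ] (e , z) ∈ P))
    placement = extend kernels-placed (boundedVectors M n)

  Cell : Vec ℕ n → V H → Set
  Cell e z = (e , z) ∈ proj₁ placement

  kernel-cell : ∀ i → Cell (kernel i) (g i)
  kernel-cell i = proj₁ (proj₂ (proj₂ placement)) (∈-map⁺ (λ i → kernel i , g i) (∈-allFin i))

  opaque
    -- The placement gives only upper bounds. With `j` tight for `i`, `e i + e j = δ i j` is at most
    -- the sum of the distances from `z` to `g i` and `g j`, and the latter is at most `e j`; so the
    -- bound at `i` is attained.
    kernel-distance : ∀ {e z} → Extremal e → Cell e z → ∀ i → Dist H z (g i) (lookup e i)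
    kernel-distance {e} {z} ext c i = subst (Dist H z (g i)) (ℕ.≤-antisym (at≤ i) at≥) (at i)
      where
      near : ∀ i → InDisk H z (lookup e i) (g i)
      near i = InDisk-mono (sup-kernel {e} ext i) (proj₁ (proj₂ placement) c (kernel-cell i))
      at : ∀ i → Dist H z (g i) (proj₁ (near i))
      at i = proj₂ (proj₂ (near i))
      at≤ : ∀ i → proj₁ (near i) ≤ lookup e i
      at≤ i = proj₁ (proj₂ (near i))
      at≥ : lookup e i ≤ proj₁ (near i)
      at≥ = let j , t = proj₂ ext i in
        arith 5 0 (λ d a b a′ b′ → a :+ b :≡ d ⇒ d :≤ a′ :+ b′ ⇒ b′ :≤ b ⇒ ⊢ a :≤ a′) tt
          (δ i j) (lookup e i) (lookup e j) (proj₁ (near i)) (proj₁ (near j)) t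
          (Dist-triangle (dist i j) (Dist-sym (at i)) (at j)) (at≤ j)

    cell-distance : ∀ {e f z w} → Extremal e → Extremal f → Cell e z → Cell f w → Dist H z w (sup e f)
    cell-distance {e} {f} {z} {w} exte extf c d with proj₁ (proj₂ placement) c d
    ... | m , m≤ , zw = subst (Dist H z w) (ℕ.≤-antisym m≤ (sup-least e f m
            (λ i → subst (lookup e i ≤_) (ℕ.+-comm m _)
                (Dist-triangle (kernel-distance exte c i) zw (kernel-distance extf d i)))
            (λ i → subst (lookup f i ≤_) (ℕ.+-comm m _) (Dist-triangle (kernel-distance extf d i)
                (Dist-sym zw) (kernel-distance exte c i))))) zw

  IsExtremal : Vec ℕ n → Set
  IsExtremal e = T (isExtremal e)

  opaque
    cellOf : ∀ e → IsExtremal e → ∃[ z ] Cell e z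
    cellOf e x = proj₂ (proj₂ (proj₂ placement)) e (∈-boundedVectors M e λ i →
      let j , t = proj₂ (isExtremal-sound x) i in ℕ.≤-trans (ℕ.m≤m+n _ _) (ℕ.≤-trans (ℕ.≤-reflexive t)
              (δ≤M i j)))

  φ : ∀ e → IsExtremal e → V H
  φ e x = proj₁ (cellOf e x)

  φ-distance : ∀ {e f} (x : IsExtremal e) (y : IsExtremal f) → Dist H (φ e x) (φ f y) (sup e f)
  φ-distance x y = cell-distance (isExtremal-sound x) (isExtremal-sound y) (proj₂ (cellOf _ x))
      (proj₂ (cellOf _ y))

  Span : V H → Set
  Span v = ∃[ e ] Σ (IsExtremal e) λ x → φ e x ≡ v

  -- Needed because the vertices of an induced subgraph carry their membership proofs.
  opaque
    Span-irrelevant : ∀ {v} (a b : Span v) → a ≡ b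
    Span-irrelevant (e , x , refl) (f , y , q) with ≡e
      where
      ≡e : e ≡ f
      ≡e = vec-ext λ i → Dist-unique (kernel-distance (isExtremal-sound x) (proj₂ (cellOf e x)) i)
             (subst (λ v → Dist H v (g i) (lookup f i)) q (kernel-distance (isExtremal-sound y)
                 (proj₂ (cellOf f y)) i))
    ... | refl with T-irrelevant x y
    ...   | refl with q
    ...     | refl = refl

  private
    embedSpan : ∀ {k} {a b : Σ (V H) Span} → Walk (Induced H Span) a b k → Walk H (proj₁ a) (proj₁ b) k
    embedSpan here       = here
    embedSpan (step e w) = step e (embedSpan w)

  span-walk : ∀ k e f (x : IsExtremal e) (y : IsExtremal f) → sup e f ≤ k →
    ∃[ m ] (m ≤ k × Walk (Induced H Span) (φ e x , e , x , refl) (φ f y , f , y , refl) m)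
  span-walk k e f x y h with sup e f in eq
  ... | zero = 0 , z≤n , same (Dist-zero (subst (Dist H _ _) eq (φ-distance x y)))
    where
    same : ∀ {v w} {a : Span v} {b : Span w} → v ≡ w → Walk (Induced H Span) (v , a) (w , b) 0
    same {a = a} {b} refl = subst (λ c → Walk (Induced H Span) (_ , a) (_ , c) 0) (Span-irrelevant a b) here
  span-walk (suc k) e f x y (s≤s h) | suc l =
    let g , extg , eg , gf = geodesicStep {e} {f} (isExtremal-sound x) (isExtremal-sound y) (ℕ.≤-reflexive eq)
        z = isExtremal-complete {g} extg
        eg≡1 = ℕ.≤-antisym eg (ℕ.+-cancelʳ-≤ l 1 (sup e g)
          (ℕ.≤-trans (ℕ.≤-reflexive (sym eq)) (ℕ.≤-trans (sup-triangle e g f) (ℕ.+-monoʳ-≤ (sup e g) gf))))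
        m , m≤ , w = span-walk k g f z y (ℕ.≤-trans gf h)
    in suc m , s≤s m≤ , step (edge (subst (Dist H _ _) eg≡1 (φ-distance x z))) w
    where
    edge : ∀ {u v} → Dist H u v 1 → _~_ H u v
    edge (step e here , _) = e

  span-distance : ∀ {e f v w} (x : IsExtremal e) (y : IsExtremal f) (p : φ e x ≡ v) (q : φ f y ≡ w) →
    Dist (Induced H Span) (v , e , x , p) (w , f , y , q) (sup e f)
  span-distance {e} {f} x y refl refl =
    let m , m≤ , w = span-walk (sup e f) e f x y ℕ.≤-refl
        _ , least = φ-distance x y
    in subst (Walk _ _ _) (ℕ.≤-antisym m≤ (least _ (embedSpan w))) w , λ _ → least _ ∘ embedSpan

  span-isometric : IsometricSubgraph H Span
  span-isometric (_ , e , x , refl) (_ , f , y , refl) k =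
      (λ d → subst (Dist H _ _) (Dist-unique (span-distance x y refl refl) d) (φ-distance x y))
    , (λ d → subst (Dist (Induced H Span) _ _) (Dist-unique (φ-distance x y) d) (span-distance x y refl refl))

  -- By `sup-extremal`, an extremal function below every `f i + r i` is a common point. The infimum
  -- of these functions is admissible because the disks meet in pairs, so `extremalBelow` applies to
  -- it.
  span-helly : Helly (Induced H Span)
  span-helly I c r meet = (φ e x , e , x , refl) , λ i →
      sup (f i) e , sup-extremal (f i) e (r i) (ext i) (proj₁ exte) (λ u → ℕ.≤-trans (e≤ u) (h≤ u i))
        , span-distance (proj₁ (proj₂ (proj₂ (c i)))) x (proj₂ (proj₂ (proj₂ (c i)))) refl
    where
    f : I → Vec ℕ n
    f i = proj₁ (proj₂ (c i))
    ext : ∀ i → Extremal (f i)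
    ext i = isExtremal-sound (proj₁ (proj₂ (proj₂ (c i))))
    close : ∀ i j → sup (f i) (f j) ≤ r i + r j
    close i j with meet i j
    ... | (z , e , x , p) , d₁ , d₂ = ℕ.≤-trans (sup-triangle (f i) e (f j)) (ℕ.+-mono-≤
          (InDisk⇒≤ d₁ (span-distance (proj₁ (proj₂ (proj₂ (c i)))) x (proj₂ (proj₂ (proj₂ (c i)))) p))
          (subst (_≤ r j) (sup-sym (f j) e)
            (InDisk⇒≤ d₂ (span-distance (proj₁ (proj₂ (proj₂ (c j)))) x (proj₂ (proj₂ (proj₂ (c j)))) p))))
    Below : Fin n → ℕ → Set
    Below u m = ∀ i → m ≤ lookup (f i) u + r i
    below? : ∀ u m → Dec (Below u m)
    below? u m with wlem (Below u m)
    ... | inj₁ ¬q  = no ¬q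
    -- A bound on a natural number is stable, so the double negation can be removed separately at
    -- each index.
    ... | inj₂ ¬¬q = yes λ i → decidable-stable (m ℕ.≤? _) λ ¬m → ¬¬q λ q → ¬m (q i)
    -- The infimum is truncated at `M`, a bound for all `δ`. This keeps the search finite, even for
    -- an empty family, and a truncated value is still large enough for admissibility.
    infimum : ∀ u → ∃[ m ] (Below u m × (m ≡ M ⊎ ¬ Below u (suc m)))
    infimum u = largestBelow M (Below u) (below? u) (λ _ → z≤n)
    h : Vec ℕ n
    h = tabulate (λ u → proj₁ (infimum u))
    h≡ : ∀ u → lookup h u ≡ proj₁ (infimum u)
    h≡ = Vec.lookup∘tabulate _
    h≤ : ∀ u i → lookup h u ≤ lookup (f i) u + r i
    h≤ u i = subst (_≤ lookup (f i) u + r i) (sym (h≡ u)) (proj₁ (proj₂ (infimum u)) i)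
    adm′ : ∀ u v → δ u v ≤ proj₁ (infimum u) + proj₁ (infimum v)
    adm′ u v with infimum u | infimum v
    ... | m , _ , inj₁ refl | k , _ , _ = ℕ.≤-trans (δ≤M u v) (ℕ.m≤m+n M k)
    ... | m , _ , inj₂ _ | k , _ , inj₁ refl = ℕ.≤-trans (δ≤M u v) (ℕ.m≤n+m M m)
    -- Indices violating the bounds `suc m` and `suc k` cannot be extracted, but they may be assumed
    -- because the goal is decidable. Then `δ u v ≤ f i u + f i v ≤ f i u + f j v + r i + r j ≤ m +
    -- k`.
    ... | m , _ , inj₂ ¬m | k , _ , inj₂ ¬k = decidable-stable (δ u v ℕ.≤? m + k) λ ¬δ →
      ¬m λ i → decidable-stable (suc m ℕ.≤? lookup (f i) u + r i) λ ¬i →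
      ¬k λ j → decidable-stable (suc k ℕ.≤? lookup (f j) v + r j) λ ¬j →
      ¬δ (arith 9 0 (λ d a b b′ s ri rj m k → d :≤ a :+ b ⇒ b :≤ b′ :+ s ⇒ s :≤ ri :+ rj ⇒ a :+ ri :≤ m ⇒
          b′ :+ rj :≤ k ⇒ ⊢ d :≤ m :+ k) tt
            (δ u v) (lookup (f i) u) (lookup (f i) v) (lookup (f j) v) (sup (f i) (f j)) (r i) (r j) m k
            (proj₁ (ext i) u v) (sup-bound (f i) (f j) v) (close i j) (ℕ.≤-pred (ℕ.≰⇒> ¬i))
                (ℕ.≤-pred (ℕ.≰⇒> ¬j)))
    below : ∃[ e ] (Extremal e × (∀ i → lookup e i ≤ lookup h i))
    below = extremalBelow h λ u v → subst₂ (λ a b → δ u v ≤ a + b) (sym (h≡ u)) (sym (h≡ v)) (adm′ u v)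
    e : Vec ℕ n
    e = proj₁ below
    exte : Extremal e
    exte = proj₁ (proj₂ below)
    e≤ : ∀ i → lookup e i ≤ lookup h i
    e≤ = proj₂ (proj₂ below)
    x : IsExtremal e
    x = isExtremal-complete exte

  kernel-span : ∀ i → Span (g i)
  kernel-span i = kernel i , x , Dist-zero (subst (Dist H _ _) (sup-refl (kernel i))
      (cell-distance (isExtremal-sound x) (isExtremal-sound x) (proj₂ (cellOf (kernel i) x)) (kernel-cell i)))
    where
    x : IsExtremal (kernel i)
    x = isExtremal-complete (kernel-extremal i)

  everywhere : ∀ v → Span v
  everywhere = minimal Span kernel-span span-isometric span-helly

  -- A positive distance is attained at some coordinate `u`, say `f u = e u + suc k`. If `j` is
  -- tight for `u` in `f`, then `e u + suc k + f j = δ u j`, so the path from `g u` through `v` and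
  -- `w` to `g j` is a geodesic.
  geodesicExtension : ∀ {v w k} → Dist H v w (suc k) →
    ∃[ i ] ∃[ j ] ∃[ p ] ∃[ q ] (Dist H v (g i) p × Dist H w (g j) q × p + suc k + q ≡ δ i j)
  geodesicExtension {v} {w} {k} d with everywhere v | everywhere w
  ... | e , x , refl | f , y , refl with sup-attained e f (Dist-unique (φ-distance x y) d)
  ...   | u , inj₂ fu = let j , t = proj₂ (isExtremal-sound y) u in
          u , j , lookup e u , lookup f j , kernel-distance (isExtremal-sound x) (proj₂ (cellOf e x)) u
            , kernel-distance (isExtremal-sound y) (proj₂ (cellOf f y)) j
            , trans (cong (_+ lookup f j) (sym fu)) t
  ...   | u , inj₁ eu = let j , t = proj₂ (isExtremal-sound x) u in
          j , u , lookup e j , lookup f u , kernel-distance (isExtremal-sound x) (proj₂ (cellOf e x)) j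
            , kernel-distance (isExtremal-sound y) (proj₂ (cellOf f y)) u
            , trans (arith 4 0 (λ a b c k → c :≡ b :+ (con 1 :+ k) ⇒ ⊢ a :+ (con 1 :+ k) :+ b :≡ c :+ a) tt
                (lookup e j) (lookup f u) (lookup e u) k eu) (trans t (δ-sym u j))

-- Hyperbolicity

Gap : ℕ → (p q r : ℕ) → Set
Gap D p q r = q + D ≤ p × r + D ≤ p

opaque
  gap⇒ : ∀ D p q r → Gap D p q r → D ≤ largest p q r ∸ secondLargest p q r
  gap⇒ D p q r (h , k) = ℕ.m+n≤o⇒m≤o∸n D (ℕ.≤-trans (ℕ.≤-reflexive (ℕ.+-comm D _))
    (ℕ.≤-trans (second≤ (ℕ.⊔-sel ((p ⊓ q) ⊔ (q ⊓ r)) (p ⊓ r)))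
      (ℕ.≤-trans (ℕ.m≤m⊔n p q) (ℕ.m≤m⊔n (p ⊔ q) r))))
    where
    below : ∀ {x y} → x ≤ y → y + D ≤ p → x + D ≤ p
    below x≤y h = ℕ.≤-trans (ℕ.+-monoˡ-≤ D x≤y) h
    second≤ : secondLargest p q r ≡ (p ⊓ q) ⊔ (q ⊓ r) ⊎ secondLargest p q r ≡ p ⊓ r →
        secondLargest p q r + D ≤ p
    second≤ (inj₁ e) = below (ℕ.≤-trans (ℕ.≤-reflexive e) (ℕ.⊔-lub (ℕ.m⊓n≤n p q) (ℕ.m⊓n≤m q r))) h
    second≤ (inj₂ e) = below (ℕ.≤-trans (ℕ.≤-reflexive e) (ℕ.m⊓n≤n p r)) k

  ⇒gap : ∀ m p q r → ¬ (largest p q r ∸ secondLargest p q r ≤ m) →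
    Gap (suc m) p q r ⊎ Gap (suc m) q p r ⊎ Gap (suc m) r p q
  ⇒gap m p q r h = go (ℕ.⊔-sel p q) (ℕ.⊔-sel (p ⊔ q) r)
    where
    L S : ℕ
    L = largest p q r
    S = secondLargest p q r
    S+D≤L : S + suc m ≤ L
    S+D≤L with ℕ.≤-total S L
    ... | inj₁ S≤L = ℕ.≤-trans (ℕ.+-monoʳ-≤ S (ℕ.≰⇒> h)) (ℕ.≤-reflexive (ℕ.m+[n∸m]≡n S≤L))
    ... | inj₂ L≤S = ⊥-elim (h (subst (_≤ m) (sym (ℕ.m≤n⇒m∸n≡0 L≤S)) z≤n))
    pq≤ : p ⊓ q ≤ S
    pq≤ = ℕ.≤-trans (ℕ.m≤m⊔n (p ⊓ q) (q ⊓ r)) (ℕ.m≤m⊔n _ (p ⊓ r))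
    qr≤ : q ⊓ r ≤ S
    qr≤ = ℕ.≤-trans (ℕ.m≤n⊔m (p ⊓ q) (q ⊓ r)) (ℕ.m≤m⊔n _ (p ⊓ r))
    pr≤ : p ⊓ r ≤ S
    pr≤ = ℕ.m≤n⊔m ((p ⊓ q) ⊔ (q ⊓ r)) (p ⊓ r)
    p≤L : p ≤ L
    p≤L = ℕ.≤-trans (ℕ.m≤m⊔n p q) (ℕ.m≤m⊔n (p ⊔ q) r)
    q≤L : q ≤ L
    q≤L = ℕ.≤-trans (ℕ.m≤n⊔m p q) (ℕ.m≤m⊔n (p ⊔ q) r)
    r≤L : r ≤ L
    r≤L = ℕ.m≤n⊔m (p ⊔ q) r
    gap : ∀ {x y} → L ≡ x → y ≤ x → x ⊓ y ≤ S → y + suc m ≤ x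
    gap e y≤x s = ℕ.≤-trans (ℕ.+-monoˡ-≤ (suc m) (ℕ.≤-trans (ℕ.≤-reflexive (sym (ℕ.m≥n⇒m⊓n≡n y≤x))) s))
        (ℕ.≤-trans S+D≤L (ℕ.≤-reflexive e))
    go : p ⊔ q ≡ p ⊎ p ⊔ q ≡ q → (p ⊔ q) ⊔ r ≡ p ⊔ q ⊎ (p ⊔ q) ⊔ r ≡ r →
      Gap (suc m) p q r ⊎ Gap (suc m) q p r ⊎ Gap (suc m) r p q
    go (inj₁ e) (inj₁ e′) = inj₁ (gap eq (subst (q ≤_) eq q≤L) pq≤ , gap eq (subst (r ≤_) eq r≤L) pr≤)
      where
      eq : L ≡ p
      eq = trans e′ e
    go (inj₂ e) (inj₁ e′) = inj₂ (inj₁ ( gap eq (subst (p ≤_) eq p≤L) (subst (_≤ S) (ℕ.⊓-comm p q) pq≤)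
                                       , gap eq (subst (r ≤_) eq r≤L) qr≤))
      where
      eq : L ≡ q
      eq = trans e′ e
    go _ (inj₂ eq) = inj₂ (inj₂ ( gap eq (subst (p ≤_) eq p≤L) (subst (_≤ S) (ℕ.⊓-comm p r) pr≤)
                                , gap eq (subst (q ≤_) eq q≤L) (subst (_≤ S) (ℕ.⊓-comm q r) qr≤)))

module _ {G H : Graph} {f : V G → V H} (helly : Helly H) (iso : IsometricEmbedding G H f) where

  private
    Df : ∀ {u v k} → Dist G u v k → Dist H (f u) (f v) k
    Df d = proj₁ (iso _ _ _) d

  narrow⇒HbLeHalf : ∀ m → ¬ ContainsWide H (suc m) → HbLeHalf G m
  narrow⇒HbLeHalf m narrow u v w x duv dwx duw dvx dux dvw Duv Dwx Duw Dvx Dux Dvw =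
    decidable-stable (_ ℕ.≤? m) λ large → narrow (found (⇒gap m (duv + dwx) (duw + dvx) (dux + dvw) large))
    where
    -- The largest of the three sums supplies the diagonals: the quadruple is read in the cyclic
    -- order u w v x, u v w x or u v x w.
    found : Gap (suc m) (duv + dwx) (duw + dvx) (dux + dvw) ⊎ Gap (suc m) (duw + dvx) (duv + dwx) (dux + dvw) ⊎
            Gap (suc m) (dux + dvw) (duv + dwx) (duw + dvx) → ContainsWide H (suc m)
    found (inj₁ (h , k)) = wide helly (suc m) (s≤s z≤n)
      (Df Duw) (Dist-sym (Df Dvw)) (Df Dvx) (Dist-sym (Df Dux)) (Df Duv) (Df Dwx) h k
    found (inj₂ (inj₁ (h , k))) = wide helly (suc m) (s≤s z≤n)
      (Df Duv) (Df Dvw) (Df Dwx) (Dist-sym (Df Dux)) (Df Duw) (Df Dvx) h k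
    found (inj₂ (inj₂ (h , k))) = wide helly (suc m) (s≤s z≤n)
      (Df Duv) (Df Dvx) (Dist-sym (Df Dwx)) (Dist-sym (Df Duw)) (Df Dux) (Df Dvw) h k

-- From the hull back to the graph

¬¬-Dist : ∀ {G u v} k → Walk G u v k → ¬ ¬ (∃[ d ] Dist G u v d)
¬¬-Dist {G} {u} {v} k w none = <-rec (λ k → ¬ Walk G u v k)
  (λ k shorter w → none (k , w , λ m w′ → ℕ.≮⇒≥ λ m<k → shorter m<k w′)) k w

¬¬-∀ : ∀ {n} {P : Fin n → Set} → (∀ i → ¬ ¬ P i) → ¬ ¬ (∀ i → P i)
¬¬-∀ {zero}  h none = none λ ()
¬¬-∀ {suc n} h none = h zero λ p → ¬¬-∀ (h ∘ suc) λ ps → none λ { zero → p ; (suc i) → ps i }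

module _ {G H : Graph} {f : V G →
    V H} (finite : Finite G) (connected : Connected G) (hull : IsInjectiveHull G H f) where

  private
    helly : Helly H
    helly = proj₁ (proj₂ hull)
    iso : IsometricEmbedding G H f
    iso = proj₁ (proj₂ (proj₂ hull))

  -- A quadruple of the hull is moved into G by prolonging its two diagonals.
  hull-gap : ∀ m → HbLeHalf G m → ∀ {a b c d x y ab bc cd da} →
    Dist H a c (suc x) → Dist H b d (suc y) → Dist H a b ab → Dist H b c bc → Dist H c d cd → Dist H d a da →
    ¬ Gap (suc m) (suc x + suc y) (ab + cd) (da + bc)
  hull-gap m hb {a} {b} {c} {d} {x} {y} {ab} {bc} {cd} {da} Dac Dbd Dab Dbc Dcd Dda (gap₁ , gap₂) =
    ¬¬-∀ (λ i → ¬¬-∀ (λ j → ¬¬-Dist _ (proj₂ (connected (v i) (v j))))) refute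
    where
    n : ℕ
    n = proj₁ finite
    v : Fin n → V G
    v = Inverse.from (proj₂ finite)
    refute : (∀ i j → ∃[ k ] Dist G (v i) (v j) k) → ⊥
    refute all = absurd (geodesicExtension Dac) (geodesicExtension Dbd)
      where
      δ : Fin n → Fin n → ℕ
      δ i j = proj₁ (all i j)
      D : ∀ i j → Dist G (v i) (v j) (δ i j)
      D i j = proj₂ (all i j)
      Dᴴ : ∀ i j → Dist H (f (v i)) (f (v j)) (δ i j)
      Dᴴ i j = proj₁ (iso _ _ _) (D i j)
      -- The diagonals have positive length `suc x` and `suc y`, so each can be prolonged; the first
      -- also starts with an edge, from which weak excluded middle is derived.
      open Hull helly (helly⇒WLEM helly (proj₁ (proj₂ (Dist-split 1 Dac)))) (f ∘ v) δ Dᴴ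
        (λ S base si sh → proj₂ (proj₂ (proj₂ hull)) S
          (λ u → subst (S ∘ f) (Inverse.strictlyInverseʳ (proj₂ finite) u)
              (base (Inverse.to (proj₂ finite) u))) si sh)
        using (geodesicExtension)
      detour : ∀ {z w i j p q k} → Dist H z (f (v i)) p → Dist H w (f (v j)) q → Dist H z w k →
          δ i j ≤ p + (k + q)
      detour {i = i} {j} (wp , _) (wq , _) (wk , _) = proj₂ (Dᴴ i j) _ (concat (reverse wp) (concat wk wq))
      absurd : (∃[ i ] ∃[ j ] ∃[ p ] ∃[ q ] (Dist H a (f (v i)) p × Dist H c (f (v j)) q × p + suc x + q ≡ δ i j)) →
               (∃[ i ] ∃[ j ] ∃[ p ] ∃[ q ] (Dist H b (f (v i)) p × Dist H d (f (v j)) q × p + suc y + q ≡ δ i j)) → ⊥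
      -- Each of `p`, `q`, `p′`, `q′` is added in full to the sum of the diagonals, and raises
      -- either sum of opposite sides by at most the same amount, so the gap persists among vertices
      -- of `G`.
      absurd (i , j , p , q , ap , cq , e₁) (i′ , j′ , p′ , q′ , bp , dq , e₂) =
        ℕ.<-irrefl refl (ℕ.≤-trans
          (gap⇒ (suc m) (δ i j + δ i′ j′) (δ i i′ + δ j j′) (δ i j′ + δ j i′)
            ( larger (detour ap bp Dab) (detour cq dq Dcd) gap₁
            , larger′ (detour ap dq (Dist-sym Dda)) (detour cq bp (Dist-sym Dbc)) gap₂))
          (hb (v i) (v j) (v i′) (v j′) _ _ _ _ _ _ (D i j) (D i′ j′) (D i i′) (D j j′) (D i j′) (D j i′)))
        where
        larger : δ i i′ ≤ p + (ab + p′) → δ j j′ ≤ q + (cd + q′) → ab + cd + suc m ≤ suc x + suc y →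
          δ i i′ + δ j j′ + suc m ≤ δ i j + δ i′ j′
        larger h₁ h₂ h₃ = arith 13 0 (λ dij dkl dik djl ab cd x y p q p′ q′ m →
          p :+ (con 1 :+ x) :+ q :≡ dij ⇒ p′ :+ (con 1 :+ y) :+ q′ :≡ dkl ⇒
          dik :≤ p :+ (ab :+ p′) ⇒ djl :≤ q :+ (cd :+ q′) ⇒
              ab :+ cd :+ (con 1 :+ m) :≤ con 1 :+ x :+ (con 1 :+ y) ⇒
          ⊢ dik :+ djl :+ (con 1 :+ m) :≤ dij :+ dkl) tt
          (δ i j) (δ i′ j′) (δ i i′) (δ j j′) ab cd x y p q p′ q′ m e₁ e₂ h₁ h₂ h₃
        larger′ : δ i j′ ≤ p + (da + q′) → δ j i′ ≤ q + (bc + p′) → da + bc + suc m ≤ suc x + suc y →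
          δ i j′ + δ j i′ + suc m ≤ δ i j + δ i′ j′
        larger′ h₁ h₂ h₃ = arith 13 0 (λ dij dkl dil djk da bc x y p q p′ q′ m →
          p :+ (con 1 :+ x) :+ q :≡ dij ⇒ p′ :+ (con 1 :+ y) :+ q′ :≡ dkl ⇒
          dil :≤ p :+ (da :+ q′) ⇒ djk :≤ q :+ (bc :+ p′) ⇒
              da :+ bc :+ (con 1 :+ m) :≤ con 1 :+ x :+ (con 1 :+ y) ⇒
          ⊢ dil :+ djk :+ (con 1 :+ m) :≤ dij :+ dkl) tt
          (δ i j) (δ i′ j′) (δ i j′) (δ j i′) da bc x y p q p′ q′ m e₁ e₂ h₁ h₂ h₃

  king-gap : ∀ m → HbLeHalf G m → ∀ {R} → KingIsometric R → ∀ {a b c d l x y} → R a → R b → R c → R d →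
    kd a c ≡ suc x → kd b d ≡ suc y → kd a b ≡ l → kd b c ≡ l → kd c d ≡ l → kd d a ≡ l →
    l + l + suc m ≤ suc x + suc y → ¬ ContainsIsometric H (KingSub R)
  king-gap m hb isometric Ra Rb Rc Rd ac bd ab bc cd da h (φ , φ-iso) = hull-gap m hb
    (at Ra Rc ac) (at Rb Rd bd) (at Ra Rb ab) (at Rb Rc bc) (at Rc Rd cd) (at Rd Ra da) (h , h)
    where
    at : ∀ {p q k} Rp Rq → kd p q ≡ k → Dist H (φ (p , Rp)) (φ (q , Rq)) k
    at Rp Rq refl = proj₁ (φ-iso _ _ _) (isometric (_ , Rp) (_ , Rq))

module _ {G H : Graph} {f : V G →
    V H} (finite : Finite G) (connected : Connected G) (hull : IsInjectiveHull G H f) (k : ℕ) where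

  no-H₁ : HbLeHalf G (2 * k + 1) → ¬ ContainsIsometric H (H₁ (suc k) (suc k))
  no-H₁ hb = king-gap finite connected hull (2 * k + 1) hb (H₁-isometric (suc k) (suc k))
    -- With A and C equal to 0 the four points are the corners. The last two arguments are the
    -- diagonal lengths less one, in the form to which `kd-ac` and `kd-bd` compute.
    {aᶜ} {bᶜ} {cᶜ} {dᶜ} {suc k} {k + suc k} {k + (suc k + 0)}
    (arith 1 0 (λ k → ⊢ :Box (con (+ 0)) (nat (2 :* (con 1 :+ k))) (con (+ 0)) (nat (2 :* (con 1 :+ k)))
        (con (+ 0)) (con (+ 0))) tt k)
    (arith 1 0 (λ k → ⊢ :Box (con (+ 0)) (nat (2 :* (con 1 :+ k))) (con (+ 0)) (nat (2 :* (con 1 :+ k)))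
        (nat (con 1 :+ k)) (:- nat (con 1 :+ k))) tt k)
    (arith 1 0 (λ k → ⊢ :Box (con (+ 0)) (nat (2 :* (con 1 :+ k))) (con (+ 0)) (nat (2 :* (con 1 :+ k)))
        (nat (2 :* (con 1 :+ k) :+ con 0)) (con (+ 0))) tt k)
    (arith 1 0 (λ k → ⊢ :Box (con (+ 0)) (nat (2 :* (con 1 :+ k))) (con (+ 0)) (nat (2 :* (con 1 :+ k)))
        (nat (con 1 :+ k)) (nat (con 1 :+ k))) tt k)
    kd-ac kd-bd kd-ab kd-bc kd-cd (trans (kd-sym dᶜ aᶜ) kd-ad)
    (arith 1 0 (λ k → ⊢ con 1 :+ k :+ (con 1 :+ k) :+ (con 1 :+ (2 :* k :+ con 1)) :≤ con 1 :+ k :+ (con 1 :+ k) :+ 2 :* (con 1 :+ k)) tt k)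
    where
    open Span₁ (suc k) 0 0

  no-H₂ : HbLeHalf G (2 * k) → ¬ ContainsIsometric H (H₂ k k)
  no-H₂ hb = king-gap finite connected hull (2 * k) hb (H₂-isometric k)
    {aᶜ} {bᶜ} {cᶜ} {dᶜ} {k + 1} {2 * k + 1} {2 * k}
    (inj₂ (inj₁ refl))
    (inj₁ (arith 1 0 (λ k → ⊢ :Box (con (+ 0)) (nat (2 :* k :+ con 1)) (con -1ℤ) (nat (2 :* k)) (nat k)
        (:- nat k)) tt k))
    (inj₂ (inj₂ (cong₂ _,_ (cong +_ (arith 1 0 (λ k → ⊢ 2 :* k :+ con 1 :+ con 0 :≡ k :+ k :+ con 1) tt k))
                           (arith 1 0 (λ k → ⊢ con (+ 1) :≡ᶻ (nat k :- nat k) :+ con (+ 1)) tt k))))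
    (inj₁ (arith 1 0 (λ k → ⊢ :Box (con (+ 0)) (nat (2 :* k :+ con 1)) (con -1ℤ) (nat (2 :* k)) (nat k)
        (nat (k :+ con 1))) tt k))
    (trans kd-ac (arith 1 0 (λ k → ⊢ k :+ con 1 :+ (k :+ con 1) :≡ con 1 :+ (2 :* k :+ con 1)) tt k))
    (trans kd-bd (ℕ.+-comm (2 * k) 1))
    kd-ab kd-bc kd-cd (trans (kd-sym dᶜ aᶜ) kd-ad)
    (arith 1 0 (λ k → ⊢ k :+ con 1 :+ (k :+ con 1) :+ (con 1 :+ 2 :* k) :≤ con 1 :+ (2 :* k :+ con 1) :+ (con 1 :+ 2 :* k)) tt k)
    where
    open Span₂ k 0 0

  no-H₃ : HbLeHalf G (2 * k + 1) → ¬ ContainsIsometric H (H₃ k k)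
  no-H₃ hb = king-gap finite connected hull (2 * k + 1) hb (H₃-isometric k)
    {aᶜ} {bᶜ} {cᶜ} {dᶜ} {k + 2} {2 * k + 2} {2 * k + 2}
    (inj₂ (inj₁ (cong₂ _,_ (arith 1 0 (λ k → ⊢ nat k :- nat (con 0) :≡ᶻ nat k) tt k)
                           (arith 1 0 (λ k → ⊢ (:- nat (k :+ con 1 :+ con 0)) :≡ᶻ (:- nat k) :- con (+ 1)) tt k))))
    (inj₂ (inj₂ (inj₁ refl)))
    (inj₂ (inj₂ (inj₂ (inj₁ (cong₂ (λ x y → + x , + y) (ℕ.+-identityʳ (k + 1)) (ℕ.+-identityʳ (k + 2)))))))
    (inj₂ (inj₂ (inj₂ (inj₂ (cong₂ _,_ (cong +_ (arith 1 0 (λ k →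
        ⊢ 2 :* k :+ con 2 :+ con 0 :≡ k :+ k :+ con 2) tt k))
                                       (sym (ℤ.i≡j⇒i-j≡0 {+ k} refl)))))))
    (trans kd-ac (ℕ.+-suc (2 * k) 2)) (trans kd-bd (ℕ.+-suc (2 * k) 2))
    kd-ab kd-bc kd-cd (trans (kd-sym dᶜ aᶜ) kd-ad)
    (arith 1 0 (λ k → ⊢ k :+ con 2 :+ (k :+ con 2) :+ (con 1 :+ (2 :* k :+ con 1)) :≤ con 1 :+ (2 :* k :+ con 2) :+ (con 1 :+ (2 :* k :+ con 2))) tt k)
    where
    open Span₃ k 0 0 0 0

module _ {H : Graph} (k : ℕ) where

  narrow-even : ¬ ContainsIsometric H (H₂ k k) → ¬ ContainsWide H (suc (2 * k))
  narrow-even none (inj₁ (j , e , c)) = none (subst (λ i → ContainsIsometric H (H₂ i i))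
    (arith 2 0 (λ j k → con 1 :+ 2 :* k :≡ 2 :* j :+ con 1 ⇒ ⊢ j :≡ k) tt j k e) c)
  narrow-even none (inj₂ (j , e , _)) =
    arith 2 0 (λ j k → con 1 :+ 2 :* k :≡ 2 :* j :+ con 2 ⇒ ⊢ :⊥) tt j k e

  narrow-odd : ¬ ContainsIsometric H (H₁ (suc k) (suc k)) → ¬ ContainsIsometric H (H₃ k k) →
      ¬ ContainsWide H (suc (2 * k + 1))
  narrow-odd none₁ none₃ (inj₁ (j , e , _)) =
    arith 2 0 (λ j k → con 1 :+ (2 :* k :+ con 1) :≡ 2 :* j :+ con 1 ⇒ ⊢ :⊥) tt j k e
  narrow-odd none₁ none₃ (inj₂ (j , e , c))
    with arith 2 0 (λ j k → con 1 :+ (2 :* k :+ con 1) :≡ 2 :* j :+ con 2 ⇒ ⊢ j :≡ k) tt j k e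
  ... | refl = [ none₁ , none₃ ]′ c

theorem1 : (G : Graph) → Finite G → Connected G →
    (H : Graph) (f : V G → V H) → IsInjectiveHull G H f →
    (k : ℕ) →
    (HbLeHalf G (2 * k) ⇔ (¬ ContainsIsometric H (H₂ k k)))
    × (HbLeHalf G (2 * k + 1) ⇔
    ((¬ ContainsIsometric H (H₁ (suc k) (suc k))) × (¬ ContainsIsometric H (H₃ k k))))
theorem1 G finite connected H f hull@(_ , helly , iso , _) k =
    mk⇔ (no-H₂ finite connected hull k)
        (λ none → narrow⇒HbLeHalf helly iso (2 * k) (narrow-even k none))
  , mk⇔ (λ hb → no-H₁ finite connected hull k hb , no-H₃ finite connected hull k hb)
        (λ none → narrow⇒HbLeHalf helly iso (2 * k + 1) (narrow-odd k (proj₁ none) (proj₂ none)))
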